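{- There is an algorithm which, given as input $\langle G,T,u,v\rangle$, where $G$ is a directed graph on $n$ vertices, $T$ is a binary balanced tree decomposition of $G$ having depth $h$ and treewidth $w$, and $u,v\in V(G)$, decides whether there is a directed path from $u$ to $v$ in $G$, using $O(wh+\log n)$ space and polynomial time.
   Context: For tree decompositions, edge directions are ignored. A tree decomposition of $G$ is a tree $T$ with bags $B(t)\subseteq V(G)$ such that every vertex is in some bag, every edge has both endpoints in some bag, and if $t_3$ lies on the path from $t_1$ to $t_2$ then $B(t_1)\cap B(t_2)\subseteq B(t_3)$; treewidth is $\max_t(|B(t)|-1)$. A binary balanced tree decomposition is one whose tree is a rooted balanced binary tree. Space is measured as work space with read-only input. -}

module Defs where

open import Data.Nat using (ℕ; zero; suc; _+_; _*_; _∸_; _^_; _≤_; _<_; _⊔_; _⊓_; pred)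
open import Data.Nat.Logarithm using (⌊log₂_⌋)
open import Data.Bool using (Bool; true; false; if_then_else_)
open import Data.Fin using (Fin; toℕ)
open import Data.Fin.Subset using (Subset; _∈_; ∣_∣)
open import Data.Vec using (toList)
open import Data.List using (List; []; _∷_; _++_; [_]; length; replicate; map; concatMap; allFin)
open import Data.Maybe using (Maybe; just; nothing)
open import Data.Product using (Σ; ∃; ∃₂; _×_; _,_)
open import Data.Sum using (_⊎_)
open import Relation.Binary.PropositionalEquality using (_≡_)
open import Relation.Binary.Construct.Closure.ReflexiveTransitive using (Star)

Digraph : ℕ → Set
Digraph n = Fin n → Fin n → Bool

Edge : ∀ {n} → Digraph n → Fin n → Fin n → Set
Edge G a b = G a b ≡ true

Reach : ∀ {n} → Digraph n → Fin n → Fin n → Set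
Reach G u v = Star (Edge G) u v

data Dir : Set where
  L R : Dir

Pos : Set
Pos = List Dir

data BT (n : ℕ) : Set where
  tip  : BT n
  node : Subset n → BT n → BT n → BT n

data At {n : ℕ} : BT n → Pos → Subset n → Set where
  here : ∀ {b l r} → At (node b l r) [] b
  goL  : ∀ {b l r p B} → At l p B → At (node b l r) (L ∷ p) B
  goR  : ∀ {b l r p B} → At r p B → At (node b l r) (R ∷ p) B

-- longest common prefix = position of the lowest common ancestor
lcp : Pos → Pos → Pos
lcp (L ∷ p) (L ∷ q) = L ∷ lcp p q
lcp (R ∷ p) (R ∷ q) = R ∷ lcp p q
lcp _ _ = []

_⊑_ : Pos → Pos → Set
p ⊑ q = ∃ λ r → p ++ r ≡ q

OnPath : Pos → Pos → Pos → Set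
OnPath p₁ p₂ p₃ = lcp p₁ p₂ ⊑ p₃ × (p₃ ⊑ p₁ ⊎ p₃ ⊑ p₂)

-- tree decomposition (edge directions ignored)
record IsTreeDecomposition {n : ℕ} (G : Digraph n) (t : BT n) : Set where
  field
    vertexCover : ∀ x → ∃₂ λ p B → At t p B × x ∈ B
    edgeCover   : ∀ x y → Edge G x y → ∃₂ λ p B → At t p B × x ∈ B × y ∈ B
    coherence   : ∀ {p₁ p₂ p₃ B₁ B₂ B₃} → At t p₁ B₁ → At t p₂ B₂ → At t p₃ B₃ →
                  OnPath p₁ p₂ p₃ → ∀ x → x ∈ B₁ → x ∈ B₂ → x ∈ B₃

-- depth = number of levels of the tree
height : ∀ {n} → BT n → ℕ
height tip = 0
height (node _ l r) = suc (height l ⊔ height r)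

width : ∀ {n} → BT n → ℕ
width tip = 0
width (node b l r) = (∣ b ∣ ∸ 1) ⊔ (width l ⊔ width r)

data Balanced {n : ℕ} : BT n → Set where
  tip  : Balanced tip
  node : ∀ {b l r} → Balanced l → Balanced r →
         height l ≤ suc (height r) → height r ≤ suc (height l) →
         Balanced (node b l r)

data Sym : Set where
  s0 s1 sSep sTip sNode : Sym

bit : Bool → Sym
bit b = if b then s1 else s0

encNat : ℕ → List Sym
encNat k = replicate k s1 ++ [ sSep ]

encSubset : ∀ {n} → Subset n → List Sym
encSubset B = map bit (toList B) ++ [ sSep ]

encTree : ∀ {n} → BT n → List Sym
encTree tip = [ sTip ]
encTree (node b l r) = sNode ∷ (encSubset b ++ encTree l ++ encTree r)

encGraph : ∀ n → Digraph n → List Sym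
encGraph n G = concatMap (λ i → map (λ j → bit (G i j)) (allFin n)) (allFin n) ++ [ sSep ]

encode : ∀ n → Digraph n → BT n → Fin n → Fin n → List Sym
encode n G t u v = encNat n ++ encGraph n G ++ encTree t ++ encNat (toℕ u) ++ encNat (toℕ v)

-- Deterministic Turing machine with read-only input tape and one
-- work tape (alphabet Fin 3, zero = blank).  Space = work cells visited.

data Move : Set where
  mL mS mR : Move

record TM : Set where
  field
    nQ     : ℕ
    start  : Fin nQ
    halted : Fin nQ → Maybe Bool
    δ      : Fin nQ → Maybe Sym → Fin 3 → Fin nQ × Fin 3 × Move × Move
             -- new state, symbol written, input-head move, work-head move

record Config (M : TM) : Set where
  constructor conf
  field
    state : Fin (TM.nQ M)
    ipos  : ℕ
    wleft : List (Fin 3)   -- cells left of the work head (reversed)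
    wcur  : Fin 3
    wright : List (Fin 3)

open Config public

readAt : List Sym → ℕ → Maybe Sym
readAt [] _ = nothing
readAt (s ∷ _) zero = just s
readAt (_ ∷ xs) (suc i) = readAt xs i

-- input head stays within 0 .. length x (position length x = right end marker)
moveIn : ℕ → Move → ℕ → ℕ
moveIn len mL i = pred i
moveIn len mS i = i
moveIn len mR i = suc i ⊓ len

moveWork : ∀ {M} → Fin (TM.nQ M) → ℕ → List (Fin 3) → Fin 3 → List (Fin 3) → Move → Config M
moveWork q i [] c rs mL = conf q i [] c rs
moveWork q i (l ∷ ls) c rs mL = conf q i ls l (c ∷ rs)
moveWork q i ls c rs mS = conf q i ls c rs
moveWork q i ls c [] mR = conf q i (c ∷ ls) Fin.zero []
  where import Data.Fin as Fin
moveWork q i ls c (r ∷ rs) mR = conf q i (c ∷ ls) r rs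

stepWith : (M : TM) → List Sym → Config M → Maybe Bool → Config M
stepWith M x c (just _) = c
stepWith M x (conf q i ls cur rs) nothing with TM.δ M q (readAt x i) cur
... | q' , w , mi , mw = moveWork q' (moveIn (length x) mi i) ls w rs mw

step : (M : TM) → List Sym → Config M → Config M
step M x c = stepWith M x c (TM.halted M (state c))

initial : (M : TM) → Config M
initial M = conf (TM.start M) 0 [] Data.Fin.zero []
  where import Data.Fin

run : (M : TM) → List Sym → ℕ → Config M
run M x zero = initial M
run M x (suc t) = step M x (run M x t)

space : ∀ {M} → Config M → ℕ
space c = suc (length (wleft c) + length (wright c))

-- Marks spread along the bags of the current branch of the tree.  A path of length at most 2 ^ s inside
-- the subtree of a node, between vertices of its bag (to which u and v are added), is cut at its visits
-- to the bag.  The piece containing the midpoint is an edge or runs inside one child subtree; what comes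
-- before and after it has length at most 2 ^ (s − 1).  Hence Q(t, s) = Q(t, s − 1); Body(t, s); Q(t, s − 1),
-- where Body spreads the marks along edges and calls Q(child, s) for both children, marks everything that
-- such paths reach.  Space: one bit per member of each bag on the branch and a control word of O(h + log n)
-- letters.  Time: Q(t, s) takes at most 8 ^ (1 + h + s) rounds, and 2 ^ h is polynomial because t is balanced.
-- If all bags have at most one member, edges are loops and comparing u with v suffices, in space O(log n).
-- The program is written in a language of binary stacks that is compiled to a Turing machine.
module Submission where

open import Defs
open import Data.Nat hiding (_≟_)
open import Data.Nat.Properties hiding (_≟_)
open import Data.Nat.DivMod using (_/_; _%_; _mod_; m%n<n; m≡m%n+[m/n]*n; [m+kn]%n≡m%n; m<n⇒m%n≡m; [m+n]%n≡m%n; %-distribˡ-+; m%n%n≡m%n)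
open import Data.Nat.Logarithm using (⌊log₂_⌋; ⌊log₂⌋-mono-≤; ⌊log₂[2^n]⌋≡n; ⌊log₂[2*b]⌋≡1+⌊log₂b⌋)
open import Data.Nat.Solver using (module +-*-Solver)
open import Data.Bool using (Bool; true; false; if_then_else_; _∧_; _∨_)
import Data.Bool
open import Data.Bool.Properties using (∨-assoc) renaming (_≟_ to _≟ᵇ_)
import Data.Bool.Properties
open import Data.Empty using (⊥; ⊥-elim)
open import Data.Fin using (Fin; zero; suc; toℕ; fromℕ<; splitAt; join; _≟_)
import Data.Fin
open import Data.Fin.Patterns
open import Data.Fin.Properties using (splitAt-join; toℕ-fromℕ<; toℕ-injective; toℕ<n; pigeonhole)
import Data.Fin.Properties
open import Data.Fin.Subset using (Subset; _∈_; ∣_∣)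
open import Data.Fin.Subset.Properties using (∣p∣≤n)
open import Data.List using (List; []; _∷_; _++_; length; _ʳ++_; replicate; [_]; map; allFin; concatMap)
open import Data.List.Properties using (++-ʳ++; ++-assoc; ++-identityʳ; length-++; length-map; length-replicate; length-tabulate; map-++; concatMap-++; ∷-injectiveˡ; ∷-injectiveʳ)
import Data.List.Properties
open import Data.List.Relation.Binary.Pointwise using (Pointwise; []; _∷_)
open import Data.List.Relation.Unary.All using (All; []; _∷_)
open import Data.List.Relation.Unary.All.Properties using (++⁺)
import Data.List.Relation.Unary.All.Properties as Allₚ
open import Data.List.Relation.Unary.Any using (Any; here; there)
import Data.List.Relation.Unary.Any.Properties as Anyₚ
open import Data.Maybe using (Maybe; just; nothing)
open import Data.Product using (Σ; _×_; _,_; proj₁; proj₂; Σ-syntax; map₁)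
open import Data.Sum using (_⊎_; inj₁; inj₂; [_,_]′)
import Data.Sum
open import Data.Unit using (⊤; tt)
open import Data.Vec using (Vec; []; _∷_; lookup; _[_]≔_; toList)
import Data.Vec
open import Data.Vec.Properties using (length-toList; lookup⇒[]=; []=⇒lookup)
import Data.Vec.Properties as Vecₚ
open import Function using (_∘_; id; case_of_)
open import Relation.Nullary using (yes; no; ¬_; does; Dec)
open import Relation.Nullary.Decidable using (_⊎-dec_)
open import Relation.Binary.Construct.Closure.ReflexiveTransitive using (ε; _◅_; _◅◅_)
open import Relation.Binary.PropositionalEquality hiding (J; [_])

-- Turing machines

-- With one bit per member of each bag on the branch, a vertex may be marked in some of its bags
-- only, and leaving a bag forgets the marks kept there. Every propagation therefore also copies the
-- marks of a vertex to all bags of the branch that contain it. The vertices u and v are added to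
-- the bags without bits of their own: u is recognised by comparison, and reaching v sets a flag. A
-- path that goes on after v needs no tracking, because the answer is settled by then.
--
-- Soundness follows from marks being spread along edges only. Completeness is where coherence
-- enters: segments outside of the bag stay on one side, and their ends reappear in the child's bag.
--
-- Bags with at most one member are treated apart because of the space bound: the control word takes
-- O(h + log n) bits, and h is at most w h only if w is positive. In that case the (w + 1) h mark
-- bits fit as well.
--
-- The semantics of the stack language admits only executions whose stacks and loops stay within
-- given bounds. One derivation thus yields correctness, space and time of the compiled machine.

record Finite (A : Set) : Set where
  field
    size    : ℕ
    toFin     : A → Fin size
    fromFin     : Fin size → A
    fromFin∘toFin : ∀ a → fromFin (toFin a) ≡ a

open Finite

finite-⊥ : Finite ⊥
finite-⊥ = record { size = 0 ; toFin = λ () ; fromFin = λ () ; fromFin∘toFin = λ () }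

finite-⊤ : Finite ⊤
finite-⊤ = record { size = 1 ; toFin = λ _ → zero ; fromFin = λ _ → tt ; fromFin∘toFin = λ _ → refl }

finite-Fin : ∀ n → Finite (Fin n)
finite-Fin n = record { size = n ; toFin = id ; fromFin = id ; fromFin∘toFin = λ _ → refl }

finite-⊎ : ∀ {A B} → Finite A → Finite B → Finite (A ⊎ B)
finite-⊎ {A} {B} fa fb = record
  { size = size fa + size fb
  ; toFin = λ x → join (size fa) (size fb) (Data.Sum.map (toFin fa) (toFin fb) x)
  ; fromFin = λ i → Data.Sum.map (fromFin fa) (fromFin fb) (splitAt (size fa) i)
  ; fromFin∘toFin = from-to }
  where
  from-to : ∀ x → Data.Sum.map (fromFin fa) (fromFin fb)
                    (splitAt (size fa) (join (size fa) (size fb) (Data.Sum.map (toFin fa) (toFin fb) x))) ≡ x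
  from-to x rewrite splitAt-join (size fa) (size fb) (Data.Sum.map (toFin fa) (toFin fb) x) with x
  ... | inj₁ a = cong inj₁ (fromFin∘toFin fa a)
  ... | inj₂ b = cong inj₂ (fromFin∘toFin fb b)

finite-retract : ∀ {A B : Set} (f : A → B) (g : B → A) → (∀ a → g (f a) ≡ a) → Finite B → Finite A
finite-retract f g gf fb = record
  { size = size fb ; toFin = toFin fb ∘ f ; fromFin = g ∘ fromFin fb
  ; fromFin∘toFin = λ a → trans (cong g (fromFin∘toFin fb (f a))) (gf a) }

finite-Σ : ∀ {n} {F : Fin n → Set} → (∀ i → Finite (F i)) → Finite (Σ (Fin n) F)
finite-Σ {zero} fs = record { size = 0 ; toFin = λ () ; fromFin = λ () ; fromFin∘toFin = λ () }
finite-Σ {suc n} {F} fs = finite-retract to from from-to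
    (finite-⊎ (fs zero) (finite-Σ (λ i → fs (suc i))))
  where
  to : Σ (Fin (suc n)) F → F zero ⊎ Σ (Fin n) (λ i → F (suc i))
  to (zero , x)  = inj₁ x
  to (suc i , x) = inj₂ (i , x)
  from : F zero ⊎ Σ (Fin n) (λ i → F (suc i)) → Σ (Fin (suc n)) F
  from (inj₁ x)       = zero , x
  from (inj₂ (i , x)) = suc i , x
  from-to : ∀ a → from (to a) ≡ a
  from-to (zero , x)  = refl
  from-to (suc i , x) = refl

finite-× : ∀ {n} {A : Set} → Finite A → Finite (A × Fin n)
finite-× fa = finite-retract (λ (a , i) → i , a) (λ (i , a) → a , i) (λ _ → refl) (finite-Σ (λ _ → fa))

-- `run` starts from the initial configuration and appends its steps at the end; simulations have to
-- be concatenated at arbitrary configurations.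
steps : (M : TM) → List Sym → ℕ → Config M → Config M
steps M x zero    c = c
steps M x (suc t) c = steps M x t (step M x c)

step-steps : ∀ M x t c → step M x (steps M x t c) ≡ steps M x t (step M x c)
step-steps M x zero c = refl
step-steps M x (suc t) c = step-steps M x t (step M x c)

run-steps : ∀ M x t → run M x t ≡ steps M x t (initial M)
run-steps M x zero = refl
run-steps M x (suc t) = trans (cong (step M x) (run-steps M x t)) (step-steps M x t (initial M))

steps-+ : ∀ M x s t c → steps M x (s + t) c ≡ steps M x t (steps M x s c)
steps-+ M x zero t c = refl
steps-+ M x (suc s) t c = steps-+ M x s t (step M x c)

-- A zipper on the input with the part left of the head reversed; an empty right part stands for the
-- end marker.
Head : Set
Head = List Sym × List Sym

shift : Move → Head → Head
shift mL ([] , r)    = [] , r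
shift mL (c ∷ l , r) = l , c ∷ r
shift mS h           = h
shift mR (l , [])    = l , []
shift mR (l , c ∷ r) = c ∷ l , r

under : Head → Maybe Sym
under (l , [])    = nothing
under (l , c ∷ r) = just c

_On_ : Head → List Sym → Set
(l , r) On x = l ʳ++ r ≡ x

shift-On : ∀ m {h x} → h On x → shift m h On x
shift-On mL {[] , r} e = e
shift-On mL {c ∷ l , r} e = e
shift-On mS e = e
shift-On mR {l , []} e = e
shift-On mR {l , c ∷ r} e = e

length-ʳ++′ : ∀ {A : Set} (l r : List A) → length (l ʳ++ r) ≡ length l + length r
length-ʳ++′ [] r = refl
length-ʳ++′ (c ∷ l) r = trans (length-ʳ++′ l (c ∷ r)) (+-suc (length l) (length r))

readAt-ʳ++ : ∀ l r → readAt (l ʳ++ r) (length l) ≡ readAt r 0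
readAt-ʳ++ l r = trans (cong (readAt (l ʳ++ r)) (sym (+-identityʳ _))) (go l r 0)
  where
  go : ∀ l r i → readAt (l ʳ++ r) (length l + i) ≡ readAt r i
  go [] r i = refl
  go (c ∷ l) r i = trans (cong (readAt (l ʳ++ (c ∷ r))) (sym (+-suc (length l) i))) (go l (c ∷ r) (suc i))

readAt-On : ∀ {h x} → h On x → readAt x (length (proj₁ h)) ≡ under h
readAt-On {l , []} refl = readAt-ʳ++ l []
readAt-On {l , c ∷ r} refl = readAt-ʳ++ l (c ∷ r)

moveIn-On : ∀ m {h x} → h On x → moveIn (length x) m (length (proj₁ h)) ≡ length (proj₁ (shift m h))
moveIn-On mL {[] , r} e = refl
moveIn-On mL {c ∷ l , r} e = refl
moveIn-On mS e = refl
moveIn-On mR {l , []} refl =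
  trans (cong (suc (length l) ⊓_) (trans (length-ʳ++′ l []) (+-identityʳ _)))
        (m≥n⇒m⊓n≡n (n≤1+n (length l)))
moveIn-On mR {l , c ∷ r} refl =
  m≤n⇒m⊓n≡m (≤-trans (s≤s (m≤m+n (length l) (length r)))
    (≤-reflexive (sym (trans (length-ʳ++′ l (c ∷ r)) (+-suc (length l) (length r))))))

moveHead : Move → ℕ → ℕ
moveHead mL p = pred p
moveHead mS p = p
moveHead mR p = suc p

write : (ℕ → Fin 3) → ℕ → Fin 3 → ℕ → Fin 3
write g p w q = if q ≡ᵇ p then w else g q

≡ᵇ-refl : ∀ p → (p ≡ᵇ p) ≡ true
≡ᵇ-refl zero = refl
≡ᵇ-refl (suc p) = ≡ᵇ-refl p

≡ᵇ-< : ∀ {q p} → q < p → (q ≡ᵇ p) ≡ false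
≡ᵇ-< {zero} {suc p} _ = refl
≡ᵇ-< {suc q} {suc p} (s≤s h) = ≡ᵇ-< h

≡ᵇ-> : ∀ {q p} → p < q → (q ≡ᵇ p) ≡ false
≡ᵇ-> {suc q} {zero} _ = refl
≡ᵇ-> {suc q} {suc p} (s≤s h) = ≡ᵇ-> h

-- Exact on the left, so that the number of cells there is the head position. On the right,
-- `cellOr0` pads with blanks, since the machine creates cells only when it visits them.
data LeftOf (g : ℕ → Fin 3) : ℕ → List (Fin 3) → Set where
  []  : LeftOf g 0 []
  _∷_ : ∀ {p c ls} → c ≡ g p → LeftOf g p ls → LeftOf g (suc p) (c ∷ ls)

cellOr0 : List (Fin 3) → ℕ → Fin 3
cellOr0 [] q = zero
cellOr0 (c ∷ cs) zero = c
cellOr0 (c ∷ cs) (suc q) = cellOr0 cs q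

leftOf-cong : ∀ {g g′ p ls} → (∀ q → q < p → g q ≡ g′ q) → LeftOf g p ls → LeftOf g′ p ls
leftOf-cong h [] = []
leftOf-cong h (e ∷ l) = trans e (h _ ≤-refl) ∷ leftOf-cong (λ q q<p → h q (m<n⇒m<1+n q<p)) l

leftOf-length : ∀ {g p ls} → LeftOf g p ls → length ls ≡ p
leftOf-length [] = refl
leftOf-length (_ ∷ l) = cong suc (leftOf-length l)

record Machine : Set₁ where
  field
    Q       : Set
    finite  : Finite Q
    boot    : Q
    halt    : Q → Maybe Bool
    delta   : Q → Maybe Sym → Fin 3 → Q × Fin 3 × Move × Move

module Typed (𝓜 : Machine) where
  open Machine 𝓜

  tm : TM
  tm = record
    { nQ = size finite
    ; start = toFin finite boot
    ; halted = λ i → halt (fromFin finite i)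
    ; δ = λ i s c → let (q , w , mi , mw) = delta (fromFin finite i) s c in toFin finite q , w , mi , mw }

  -- The work tape is an infinite function `g`. Only `bound≥` speaks of the visited cells; together
  -- with `left` it limits the space.
  record Rep (bound : ℕ) (c : Config tm) (q : Q) (h : Head) (p : ℕ) (g : ℕ → Fin 3) : Set where
    constructor rep
    field
      state≡ : state c ≡ toFin finite q
      ipos≡  : ipos c ≡ length (proj₁ h)
      left   : LeftOf g p (wleft c)
      cur    : wcur c ≡ g p
      right  : ∀ j → cellOr0 (wright c) j ≡ g (suc p + j)
      bound≥ : suc (p + length (wright c)) ≤ bound

  rep-space : ∀ {b c q h p g} → Rep b c q h p g → space c ≤ b
  rep-space {c = c} r = subst (λ z → suc (z + length (wright c)) ≤ _) (sym (leftOf-length left)) bound≥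
    where open Rep r

  rep-cong : ∀ {b c q h p g g′} → (∀ j → g j ≡ g′ j) → Rep b c q h p g → Rep b c q h p g′
  rep-cong e (rep s i l c r b) = rep s i (leftOf-cong (λ q _ → e q) l) (trans c (e _)) (λ j → trans (r j) (e _)) b

  rep-halt : ∀ {b c q h p g} → Rep b c q h p g → TM.halted tm (state c) ≡ halt q
  rep-halt {q = q} (rep refl _ _ _ _ _) = cong halt (fromFin∘toFin finite q)

  step-eq : ∀ {x s i ls cu rs q w mi mw i′} → halt (fromFin finite s) ≡ nothing →
    delta (fromFin finite s) (readAt x i) cu ≡ (q , w , mi , mw) → moveIn (length x) mi i ≡ i′ →
    step tm x (conf s i ls cu rs) ≡ moveWork (toFin finite q) i′ ls w rs mw
  step-eq ht d refl rewrite ht | d = refl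

  rep-step : ∀ {b c q h p g x q′ w mi mw} → Rep b c q h p g → h On x → halt q ≡ nothing →
             delta q (under h) (g p) ≡ (q′ , w , mi , mw) → moveHead mw p < b →
             Rep b (step tm x c) q′ (shift mi h) (moveHead mw p) (write g p w)
  rep-step {b} {conf s i ls cu rs} {q} {h} {p} {g} {x} {q′} {w} {mi} {mw} (rep refl refl l refl r bd) on ht d lt
    = subst (λ c → Rep b c _ _ _ _) (sym (step-eq ht′ d′ (moveIn-On mi {h} on))) (go mw l lt)
    where
    ht′ : halt (fromFin finite (toFin finite q)) ≡ nothing
    ht′ = trans (cong halt (fromFin∘toFin finite q)) ht
    d′ : delta (fromFin finite (toFin finite q)) (readAt x (length (proj₁ h))) (g p) ≡ (q′ , w , mi , mw)
    d′ = trans (cong₂ (λ a s → delta a s (g p)) (fromFin∘toFin finite q) (readAt-On {h} on)) d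
    left′ : LeftOf g p ls → LeftOf (write g p w) p ls
    left′ = leftOf-cong (λ j j<p → sym (cong (if_then w else g j) (≡ᵇ-< j<p)))
    cur′ : w ≡ write g p w p
    cur′ = sym (cong (if_then w else g p) (≡ᵇ-refl p))
    right′ : ∀ j → cellOr0 rs j ≡ write g p w (suc p + j)
    right′ j = trans (r j) (sym (cong (if_then w else g (suc p + j)) (≡ᵇ-> (s≤s (m≤m+n p j)))))
    cells : ∀ j → cellOr0 (w ∷ rs) j ≡ write g p w (p + j)
    cells zero = trans cur′ (cong (write g p w) (sym (+-identityʳ p)))
    cells (suc j) = trans (right′ j) (cong (write g p w) (sym (+-suc p j)))
    goRight : ∀ {ls} rs → LeftOf (write g p w) p ls → (∀ j → cellOr0 rs j ≡ write g p w (suc p + j)) →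
          suc (p + length rs) ≤ b → suc p < b →
          Rep b (moveWork (toFin finite q′) (length (proj₁ (shift mi h))) ls w rs mR)
                q′ (shift mi h) (suc p) (write g p w)
    goRight {ls} [] l′ r′ bd lt = subst (λ c → Rep b c _ _ _ _) (eq ls)
        (rep refl refl (cur′ ∷ l′) (trans (r′ 0) (cong (write g p w) (cong suc (+-identityʳ p))))
          (λ j → trans (r′ (suc j)) (cong (write g p w) (cong suc (+-suc p j))))
          (≤-trans (≤-reflexive (cong (λ z → suc (suc z)) (+-identityʳ p))) lt))
      where
      -- `moveWork` branches on the left list before it looks at the move, so both sides agree only
      -- after a case split on `ls`.
      eq : ∀ ls → conf (toFin finite q′) (length (proj₁ (shift mi h))) (w ∷ ls) zero []
                ≡ moveWork {tm} (toFin finite q′) (length (proj₁ (shift mi h))) ls w [] mR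
      eq [] = refl
      eq (_ ∷ _) = refl
    goRight {ls} (c ∷ rs′) l′ r′ bd lt = subst (λ c → Rep b c _ _ _ _) (eq ls)
        (rep refl refl (cur′ ∷ l′) (trans (r′ 0) (cong (write g p w) (cong suc (+-identityʳ p))))
          (λ j → trans (r′ (suc j)) (cong (write g p w) (cong suc (+-suc p j))))
          (≤-trans (≤-reflexive (cong suc (sym (+-suc p _)))) bd))
      where
      eq : ∀ ls → conf (toFin finite q′) (length (proj₁ (shift mi h))) (w ∷ ls) c rs′
                ≡ moveWork {tm} (toFin finite q′) (length (proj₁ (shift mi h))) ls w (c ∷ rs′) mR
      eq [] = refl
      eq (_ ∷ _) = refl
    go : ∀ mw → LeftOf g p ls → moveHead mw p < b →
         Rep b (moveWork (toFin finite q′) (length (proj₁ (shift mi h))) ls w rs mw)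
               q′ (shift mi h) (moveHead mw p) (write g p w)
    go mL [] lt = rep refl refl [] cur′ right′ bd
    go mL l@(e ∷ l′) lt with left′ l
    ... | e′ ∷ l″ = rep refl refl l″ e′ cells (≤-trans (≤-reflexive (cong suc (+-suc _ (length rs)))) bd)
    go mS [] lt = rep refl refl [] cur′ right′ bd
    go mS l@(_ ∷ _) lt = rep refl refl (left′ l) cur′ right′ bd
    go mR [] lt = goRight rs [] right′ bd lt
    go mR l@(_ ∷ _) lt = goRight rs (left′ l) right′ bd lt
  rep-initial : ∀ {b} x → 1 ≤ b → Rep b (initial tm) boot ([] , x) 0 (λ _ → zero)
  rep-initial x 1≤b = rep refl refl [] refl (λ _ → refl) 1≤b

  record Reaches (x : List Sym) (b t : ℕ) (q : Q) (h : Head) (p : ℕ) (g : ℕ → Fin 3)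
                 (q′ : Q) (h′ : Head) (p′ : ℕ) (g′ : ℕ → Fin 3) : Set where
    constructor reaches
    field
      time  : ℕ
      time≤ : time ≤ t
      sim   : ∀ {c} → Rep b c q h p g → Rep b (steps tm x time c) q′ h′ p′ g′

  reach-refl : ∀ {x b q h p g} → Reaches x b 0 q h p g q h p g
  reach-refl = reaches 0 z≤n id

  reach-trans : ∀ {x b t t′ q h p g q′ h′ p′ g′ q″ h″ p″ g″} →
    Reaches x b t q h p g q′ h′ p′ g′ → Reaches x b t′ q′ h′ p′ g′ q″ h″ p″ g″ →
    Reaches x b (t + t′) q h p g q″ h″ p″ g″
  reach-trans {x} {b} (reaches s s≤ f) (reaches s′ s′≤ f′) = reaches (s + s′) (+-mono-≤ s≤ s′≤)
    (λ {c} r → subst (λ c′ → Rep b c′ _ _ _ _) (sym (steps-+ tm x s s′ c)) (f′ (f r)))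

  reach-weaken : ∀ {x b t t′ q h p g q′ h′ p′ g′} → t ≤ t′ →
    Reaches x b t q h p g q′ h′ p′ g′ → Reaches x b t′ q h p g q′ h′ p′ g′
  reach-weaken t≤ (reaches s s≤ f) = reaches s (≤-trans s≤ t≤) f

  reach-cong : ∀ {x b t q h p g q′ h′ p′ g′ g″} → (∀ j → g′ j ≡ g″ j) →
    Reaches x b t q h p g q′ h′ p′ g′ → Reaches x b t q h p g q′ h′ p′ g″
  reach-cong e (reaches s s≤ f) = reaches s s≤ (λ r → rep-cong e (f r))

  write-same : ∀ g p w → w ≡ g p → ∀ j → write g p w j ≡ g j
  write-same g p w e j with j ≡ᵇ p in eq
  ... | false = refl
  ... | true = trans e (cong g (sym (≡ᵇ⇒≡ j p (subst Data.Bool.T (sym eq) tt))))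

  reach-step : ∀ {x b q h p g q′ w mi mw} → h On x → halt q ≡ nothing →
    delta q (under h) (g p) ≡ (q′ , w , mi , mw) → moveHead mw p < b →
    Reaches x b 1 q h p g q′ (shift mi h) (moveHead mw p) (write g p w)
  reach-step on ht d lt = reaches 1 ≤-refl (λ r → rep-step r on ht d lt)

  reach-keep : ∀ {x b q h p g q′ w mi mw} → h On x → halt q ≡ nothing →
    delta q (under h) (g p) ≡ (q′ , w , mi , mw) → w ≡ g p → moveHead mw p < b →
    Reaches x b 1 q h p g q′ (shift mi h) (moveHead mw p) g
  reach-keep on ht d e lt = reach-cong (write-same _ _ _ e) (reach-step on ht d lt)

-- Stack programs and their compilation

if-true : ∀ {A : Set} {b} {x y : A} → b ≡ true → (if b then x else y) ≡ x
if-true refl = refl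

if-false : ∀ {A : Set} {b} {x y : A} → b ≡ false → (if b then x else y) ≡ y
if-false refl = refl

-- Nested pairs rather than functions: register files with equal components are equal by eta, so
-- that updates compute to the expected file.
Regs : ℕ → Set
Regs zero = ⊤
Regs (suc k) = List Bool × Regs k

get : ∀ {k} → Fin k → Regs k → List Bool
get zero ρ = proj₁ ρ
get (suc r) ρ = get r (proj₂ ρ)

set : ∀ {k} → Fin k → List Bool → Regs k → Regs k
set zero l ρ = l , proj₂ ρ
set (suc r) l ρ = proj₁ ρ , set r l (proj₂ ρ)

get-set : ∀ {k} (r : Fin k) l ρ → get r (set r l ρ) ≡ l
get-set zero l ρ = refl
get-set (suc r) l ρ = get-set r l (proj₂ ρ)

get-set-other : ∀ {k} (r r′ : Fin k) l ρ → r′ ≢ r → get r′ (set r l ρ) ≡ get r′ ρ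
get-set-other zero zero l ρ ne = ⊥-elim (ne refl)
get-set-other zero (suc r′) l ρ ne = refl
get-set-other (suc r) zero l ρ ne = refl
get-set-other (suc r) (suc r′) l ρ ne = get-set-other r r′ l (proj₂ ρ) (ne ∘ cong suc)

set-get : ∀ {k} (r : Fin k) ρ → set r (get r ρ) ρ ≡ ρ
set-get zero ρ = refl
set-get (suc r) ρ = cong (proj₁ ρ ,_) (set-get r (proj₂ ρ))

no-regs : ∀ {k} → Regs k
no-regs {zero} = tt
no-regs {suc k} = [] , no-regs

get-no-regs : ∀ {k} (r : Fin k) → get r no-regs ≡ []
get-no-regs zero = refl
get-no-regs (suc r) = get-no-regs r

-- A command with n exits; loop a f s runs the bodies f s, f s′, … where exits below a name the next
-- loop state and the other exits leave the loop.
data Cmd (k : ℕ) : ℕ → Set where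
  ret  : ∀ {n} → Fin n → Cmd k n
  move : Move → Cmd k 1
  read : Cmd k 6
  push : Fin k → Bool → Cmd k 1
  pop  : Fin k → Cmd k 3
  bind : ∀ {m n} → Cmd k m → (Fin m → Cmd k n) → Cmd k n
  loop : ∀ {n} a → (Fin a → Cmd k (a + n)) → Fin a → Cmd k n

symIx : Maybe Sym → Fin 6
symIx nothing = 5F
symIx (just s0) = 0F
symIx (just s1) = 1F
symIx (just sSep) = 2F
symIx (just sTip) = 3F
symIx (just sNode) = 4F

topIx : List Bool → Fin 3
topIx [] = 0F
topIx (false ∷ _) = 1F
topIx (true ∷ _) = 2F

tail : List Bool → List Bool
tail [] = []
tail (_ ∷ l) = l

State : ℕ → Set
State k = Head × Regs k

module _ {k : ℕ} (B H : ℕ) where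

  -- Resources are side conditions of the rules: `H` limits every stack when it is pushed, `B` the
  -- rounds of every loop.
  data Exec : ∀ {n} → Cmd k n → State k → Fin n → State k → Set
  data Loop {n a} (f : Fin a → Cmd k (a + n)) : Fin a → State k → Fin n → State k → ℕ → Set

  data Exec where
    ret  : ∀ {n σ} {i : Fin n} → Exec (ret i) σ i σ
    move : ∀ {m h ρ} → Exec (move m) (h , ρ) 0F (shift m h , ρ)
    read : ∀ {h ρ} → Exec read (h , ρ) (symIx (under h)) (h , ρ)
    push : ∀ {r b h ρ} → length (get r ρ) < H → Exec (push r b) (h , ρ) 0F (h , set r (b ∷ get r ρ) ρ)
    pop  : ∀ {r h ρ} → Exec (pop r) (h , ρ) (topIx (get r ρ)) (h , set r (tail (get r ρ)) ρ)
    bind : ∀ {m n} {c : Cmd k m} {f : Fin m → Cmd k n} {σ τ υ i j} →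
           Exec c σ i τ → Exec (f i) τ j υ → Exec (bind c f) σ j υ
    loop : ∀ {n a} {f : Fin a → Cmd k (a + n)} {s σ j τ t} →
           Loop f s σ j τ t → t ≤ B → Exec (loop a f s) σ j τ

  data Loop f where
    done  : ∀ {s σ e j τ} → Exec (f s) σ e τ → splitAt _ e ≡ inj₂ j → Loop f s σ j τ 1
    again : ∀ {s σ e s′ τ j υ t} → Exec (f s) σ e τ → splitAt _ e ≡ inj₁ s′ →
            Loop f s′ τ j υ t → Loop f s σ j υ (suc t)

data Instr (k : ℕ) (X : Set) : Set where
  imove : Move → X → Instr k X
  iread : (Maybe Sym → X) → Instr k X
  ipush : Fin k → Bool → X → Instr k X
  ipop  : Fin k → (Maybe Bool → X) → Instr k X

mapI : ∀ {k X Y} → (X → Y) → Instr k X → Instr k Y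
mapI g (imove m x) = imove m (g x)
mapI g (iread f) = iread (g ∘ f)
mapI g (ipush r b x) = ipush r b (g x)
mapI g (ipop r f) = ipop r (g ∘ f)

mapI-∘ : ∀ {k X Y Z} (g : Y → Z) (f : X → Y) (i : Instr k X) → mapI g (mapI f i) ≡ mapI (g ∘ f) i
mapI-∘ g f (imove m x) = refl
mapI-∘ g f (iread _) = refl
mapI-∘ g f (ipush r b x) = refl
mapI-∘ g f (ipop r _) = refl

bitIx : Maybe Bool → Fin 3
bitIx nothing = 0F
bitIx (just false) = 1F
bitIx (just true) = 2F

module _ {k : ℕ} where

  -- Control points in front of an instruction. `ret` has none and is absorbed when entry points are
  -- computed. Each state of a loop gets one of its own for a step that does nothing; without it the
  -- entry point of a loop whose body returns at once would be undefined.
  Ctl : ∀ {n} → Cmd k n → Set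
  Ctl (ret i) = ⊥
  Ctl (move m) = ⊤
  Ctl read = ⊤
  Ctl (push r b) = ⊤
  Ctl (pop r) = ⊤
  Ctl (bind {m} c f) = Ctl c ⊎ Σ (Fin m) (λ i → Ctl (f i))
  Ctl (loop a f s) = Σ (Fin a) (λ i → ⊤ ⊎ Ctl (f i))

  finite-Ctl : ∀ {n} (c : Cmd k n) → Finite (Ctl c)
  finite-Ctl (ret i) = finite-⊥
  finite-Ctl (move m) = finite-⊤
  finite-Ctl read = finite-⊤
  finite-Ctl (push r b) = finite-⊤
  finite-Ctl (pop r) = finite-⊤
  finite-Ctl (bind c f) = finite-⊎ (finite-Ctl c) (finite-Σ (λ i → finite-Ctl (f i)))
  finite-Ctl (loop a f s) = finite-Σ (λ i → finite-⊎ finite-⊤ (finite-Ctl (f i)))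

  Point : ∀ {n} → Cmd k n → Set
  Point {n} c = Ctl c ⊎ Fin n

  inner : ∀ {m n} (c : Cmd k m) (f : Fin m → Cmd k n) i → Point (f i) → Point (bind c f)
  inner c f i (inj₁ q) = inj₁ (inj₂ (i , q))
  inner c f i (inj₂ j) = inj₂ j

  next : ∀ {n a} (f : Fin a → Cmd k (a + n)) (s₀ : Fin a) → Fin a ⊎ Fin n → Point (loop a f s₀)
  next f s₀ (inj₁ s) = inj₁ (s , inj₁ tt)
  next f s₀ (inj₂ j) = inj₂ j

  body : ∀ {n a} (f : Fin a → Cmd k (a + n)) s₀ s → Point (f s) → Point (loop a f s₀)
  body f s₀ s (inj₁ q) = inj₁ (s , inj₂ q)
  body f s₀ s (inj₂ e) = next f s₀ (splitAt _ e)

  entry : ∀ {n} (c : Cmd k n) → Point c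
  outer : ∀ {m n} (c : Cmd k m) (f : Fin m → Cmd k n) → Point c → Point (bind c f)

  entry (ret i) = inj₂ i
  entry (move m) = inj₁ tt
  entry read = inj₁ tt
  entry (push r b) = inj₁ tt
  entry (pop r) = inj₁ tt
  entry (bind c f) = outer c f (entry c)
  entry (loop a f s) = inj₁ (s , inj₁ tt)

  outer c f (inj₁ q) = inj₁ (inj₁ q)
  outer c f (inj₂ i) = inner c f i (entry (f i))

  instr : ∀ {n} (c : Cmd k n) → Ctl c → Instr k (Point c)
  instr (move m) _ = imove m (inj₂ 0F)
  instr read _ = iread (λ s → inj₂ (symIx s))
  instr (push r b) _ = ipush r b (inj₂ 0F)
  instr (pop r) _ = ipop r (λ b → inj₂ (bitIx b))
  instr (bind c f) (inj₁ q) = mapI (outer c f) (instr c q)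
  instr (bind c f) (inj₂ (i , q)) = mapI (inner c f i) (instr (f i) q)
  instr (loop a f s₀) (s , inj₁ _) = imove mS (body f s₀ s (entry (f s)))
  instr (loop a f s₀) (s , inj₂ q) = mapI (body f s₀ s) (instr (f s) q)

verdict : Fin 2 → Bool
verdict 0F = true
verdict 1F = false

-- Stack r occupies, bottom first, the work cells whose index is r + 1 modulo k + 1; cell 0 is marked
-- so that the head can find its way back.
module Compile {k : ℕ} (prog : Cmd k 2) where

  K : ℕ
  K = suc k

  -- Between instructions the head rests on cell 0. A push seeks the first blank of its stack,
  -- writes there and goes home; a pop overshoots to that blank and goes back to the top bit, or to
  -- cell 0 if the stack is empty. The `Fin K` is the head position modulo `K`.
  data TState : Set where
    boot   : TState
    ready    : Point prog → TState
    seek   : Ctl prog → Fin K → TState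
    back   : Ctl prog → Fin K → TState
    homing : Point prog → Fin K → TState

  TCode : Set
  TCode = ⊤ ⊎ (Point prog ⊎ ((Ctl prog × Fin K) ⊎ ((Ctl prog × Fin K) ⊎ (Point prog × Fin K))))

  finite-TState : Finite TState
  finite-TState = finite-retract to from from-to
      (finite-⊎ finite-⊤ (finite-⊎ fp (finite-⊎ (finite-× fc) (finite-⊎ (finite-× fc) (finite-× fp)))))
    where
    fc = finite-Ctl prog
    fp = finite-⊎ fc (finite-Fin 2)
    to : TState → TCode
    to boot = inj₁ tt
    to (ready x) = inj₂ (inj₁ x)
    to (seek q j) = inj₂ (inj₂ (inj₁ (q , j)))
    to (back q j) = inj₂ (inj₂ (inj₂ (inj₁ (q , j))))
    to (homing x j) = inj₂ (inj₂ (inj₂ (inj₂ (x , j))))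
    from : TCode → TState
    from (inj₁ tt) = boot
    from (inj₂ (inj₁ x)) = ready x
    from (inj₂ (inj₂ (inj₁ (q , j)))) = seek q j
    from (inj₂ (inj₂ (inj₂ (inj₁ (q , j))))) = back q j
    from (inj₂ (inj₂ (inj₂ (inj₂ (x , j))))) = homing x j
    from-to : ∀ a → from (to a) ≡ a
    from-to boot = refl
    from-to (ready x) = refl
    from-to (seek q j) = refl
    from-to (back q j) = refl
    from-to (homing x j) = refl

  Action : Set
  Action = TState × Fin 3 × Move × Move

  up down : Fin K → Fin K
  up j = suc (toℕ j) mod K
  -- `k` is minus one modulo `K`.
  down j = (toℕ j + k) mod K

  isBlank : Fin 3 → Bool
  isBlank zero = true
  isBlank (suc _) = false

  symbol : Bool → Fin 3
  symbol false = 1F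
  symbol true = 2F

  bitOf : Fin 3 → Bool
  bitOf 2F = true
  bitOf _ = false

  atHome : Fin K → Fin 3 → Bool
  atHome zero 1F = true
  atHome _ _ = false

  seekStep : Fin k → Action → Ctl prog → Fin K → Fin 3 → Action
  seekStep r hit q j c = if does (j ≟ suc r) ∧ isBlank c then hit else (seek q (up j) , c , mS , mR)

  backStep : Fin k → (Maybe Bool → Point prog) → Ctl prog → Fin K → Fin 3 → Action
  backStep r f q j c =
    if does (j ≟ suc r) then (homing (f (just (bitOf c))) j , zero , mS , mS)
    else if atHome j c then (ready (f nothing) , c , mS , mS)
    else (back q (down j) , c , mS , mL)

  dispatch : Ctl prog → Instr k (Point prog) → Maybe Sym → Fin 3 → Action
  dispatch q (imove m x) s c = ready x , c , m , mS
  dispatch q (iread f) s c = ready (f s) , c , mS , mS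
  dispatch q (ipush r b x) s c = seek q (1 mod K) , c , mS , mR
  dispatch q (ipop r f) s c = seek q (1 mod K) , c , mS , mR

  seeking : Ctl prog → Instr k (Point prog) → Fin K → Fin 3 → Action
  seeking q (ipush r b x) j c = seekStep r (homing x j , symbol b , mS , mS) q j c
  seeking q (ipop r f) j c = seekStep r (back q (down j) , c , mS , mL) q j c
  -- A default: a search for a blank is started by pushes and pops only.
  seeking q _ j c = boot , c , mS , mS

  backing : Ctl prog → Instr k (Point prog) → Fin K → Fin 3 → Action
  backing q (ipop r f) j c = backStep r f q j c
  backing q _ j c = boot , c , mS , mS

  delta : TState → Maybe Sym → Fin 3 → Action
  delta boot s c = ready (entry prog) , 1F , mS , mS
  delta (ready (inj₁ q)) s c = dispatch q (instr prog q) s c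
  delta (ready (inj₂ e)) s c = boot , c , mS , mS
  delta (seek q j) s c = seeking q (instr prog q) j c
  delta (back q j) s c = backing q (instr prog q) j c
  delta (homing x j) s c =
    if atHome j c then (ready x , c , mS , mS) else (homing x (down j) , c , mS , mL)

  halt : TState → Maybe Bool
  halt (ready (inj₂ e)) = just (verdict e)
  halt _ = nothing

  machine : Machine
  machine = record { Q = TState ; finite = finite-TState ; boot = boot ; halt = halt ; delta = delta }

  open Typed machine public

  track : ℕ → Fin K
  track p = p mod K

  toℕ-track : ∀ p → toℕ (track p) ≡ p % K
  toℕ-track p = toℕ-fromℕ< (m%n<n p K)

  track-≡ : ∀ p q → p % K ≡ q % K → track p ≡ track q
  track-≡ p q e = toℕ-injective (trans (toℕ-track p) (trans e (sym (toℕ-track q))))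

  up-track : ∀ p → up (track p) ≡ track (suc p)
  up-track p = track-≡ (suc (toℕ (track p))) (suc p) (begin
    suc (toℕ (track p)) % K ≡⟨ cong (λ z → suc z % K) (toℕ-track p) ⟩
    (1 + p % K) % K         ≡⟨ %-distribˡ-+ 1 (p % K) K ⟩
    (1 % K + p % K % K) % K ≡⟨ cong (λ z → (1 % K + z) % K) (m%n%n≡m%n p K) ⟩
    (1 % K + p % K) % K     ≡⟨ %-distribˡ-+ 1 p K ⟨
    suc p % K ∎)
    where open ≡-Reasoning

  down-track : ∀ p → down (track (suc p)) ≡ track p
  down-track p = track-≡ (toℕ (track (suc p)) + k) p (begin
    (toℕ (track (suc p)) + k) % K   ≡⟨ cong (λ z → (z + k) % K) (toℕ-track (suc p)) ⟩
    (suc p % K + k) % K             ≡⟨ %-distribˡ-+ (suc p % K) k K ⟩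
    (suc p % K % K + k % K) % K     ≡⟨ cong (λ z → (z + k % K) % K) (m%n%n≡m%n (suc p) K) ⟩
    (suc p % K + k % K) % K         ≡⟨ %-distribˡ-+ (suc p) k K ⟨
    (suc p + k) % K                 ≡⟨ cong (_% K) (sym (+-suc p k)) ⟩
    (p + K) % K                     ≡⟨ [m+n]%n≡m%n p K ⟩
    p % K ∎)
    where open ≡-Reasoning

  -- Rows count from the bottom although the list starts at the top, so that pushing and popping
  -- leave the other cells in place.
  cell : List Bool → ℕ → Fin 3
  cell [] i = zero
  cell (b ∷ l) i = if i ≡ᵇ length l then symbol b else cell l i

  cell-blank : ∀ l i → length l ≤ i → cell l i ≡ zero
  cell-blank [] i _ = refl
  cell-blank (b ∷ l) i lt rewrite ≡ᵇ-> lt = cell-blank l i (<⇒≤ lt)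

  cell-full : ∀ l i → i < length l → isBlank (cell l i) ≡ false
  cell-full (b ∷ l) i lt with i ≡ᵇ length l in eq
  cell-full (false ∷ l) i lt | true = refl
  cell-full (true ∷ l) i lt | true = refl
  ... | false = cell-full l i (≤∧≢⇒< (≤-pred lt) (λ { refl → case trans (sym (≡ᵇ-refl i)) eq of λ () }))

  content : Regs k → Fin K → ℕ → Fin 3
  content ρ zero i = if i ≡ᵇ 0 then 1F else 0F
  content ρ (suc r) i = cell (get r ρ) i

  tape : Regs k → ℕ → Fin 3
  tape ρ p = content ρ (track p) (p / K)

  spot : Fin k → ℕ → ℕ
  spot r i = suc (toℕ r) + i * K

  spot-track : ∀ r i → track (spot r i) ≡ suc r
  spot-track r i = toℕ-injective (trans (toℕ-track (spot r i))
    (trans ([m+kn]%n≡m%n (suc (toℕ r)) i K) (m<n⇒m%n≡m (s≤s (toℕ<n r)))))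

  on-track : ∀ p r → track p ≡ suc r → p ≡ spot r (p / K)
  on-track p r e = trans (m≡m%n+[m/n]*n p K) (cong (_+ p / K * K) (trans (sym (toℕ-track p)) (cong toℕ e)))

  spot-row : ∀ r i → spot r i / K ≡ i
  spot-row r i = *-cancelʳ-≡ _ i K (+-cancelˡ-≡ (suc (toℕ r)) _ _
    (sym (on-track (spot r i) r (spot-track r i))))

  spot-< : ∀ r {i j} → spot r i < spot r j → i < j
  spot-< r {i} {j} lt = *-cancelʳ-< K i j (+-cancelˡ-< (suc (toℕ r)) _ _ lt)

  tape-spot : ∀ ρ r i → tape ρ (spot r i) ≡ cell (get r ρ) i
  tape-spot ρ r i rewrite spot-track r i = cong (cell (get r ρ)) (spot-row r i)

  atHome-later : ∀ ρ p → atHome (track (suc p)) (tape ρ (suc p)) ≡ false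
  atHome-later ρ p with track (suc p) in eq
  ... | suc r = refl
  ... | zero with suc p / K in row
  ...   | suc _ = refl
  ...   | zero = case trans (m≡m%n+[m/n]*n (suc p) K)
                        (cong₂ (λ a b → a + b * K) (trans (sym (toℕ-track (suc p))) (cong toℕ eq)) row) of λ ()

  blank-tape : ∀ p → tape no-regs (suc p) ≡ zero
  blank-tape p with track (suc p) in eq
  ... | suc r rewrite get-no-regs r = refl
  ... | zero with suc p / K | subst (λ j → atHome j (content no-regs j (suc p / K)) ≡ false) eq (atHome-later no-regs p)
  ...   | suc _ | _ = refl
  ...   | zero | ()

  ≡ᵇ-spot : ∀ j r i → track j ≡ suc r → (j ≡ᵇ spot r i) ≡ (j / K ≡ᵇ i)
  ≡ᵇ-spot j r i e with j / K ≡ᵇ i in eq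
  ... | true with refl ← ≡ᵇ⇒≡ (j / K) i (subst Data.Bool.T (sym eq) tt) =
        trans (cong (j ≡ᵇ_) (sym (on-track j r e))) (≡ᵇ-refl j)
  ... | false with j ≡ᵇ spot r i in eq′
  ...   | false = refl
  ...   | true with refl ← ≡ᵇ⇒≡ j (spot r i) (subst Data.Bool.T (sym eq′) tt) =
          case trans (sym (≡ᵇ-refl i)) (trans (cong (_≡ᵇ i) (sym (spot-row r i))) eq) of λ ()

  ≡ᵇ-off : ∀ j r i → track j ≢ suc r → (j ≡ᵇ spot r i) ≡ false
  ≡ᵇ-off j r i ne with j ≡ᵇ spot r i in eq
  ... | false = refl
  ... | true with refl ← ≡ᵇ⇒≡ j (spot r i) (subst Data.Bool.T (sym eq) tt) = ⊥-elim (ne (spot-track r i))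

  write-spot : ∀ ρ r l i w → (∀ j → cell l j ≡ (if j ≡ᵇ i then w else cell (get r ρ) j)) →
               ∀ j → write (tape ρ) (spot r i) w j ≡ tape (set r l ρ) j
  write-spot ρ r l i w h j with track j in eq
  ... | zero rewrite ≡ᵇ-off j r i (λ e → case trans (sym eq) e of λ ()) = refl
  ... | suc r′ with r′ ≟ r
  ...   | yes refl rewrite get-set r′ l ρ | ≡ᵇ-spot j r′ i eq = sym (h (j / K))
  ...   | no ne rewrite get-set-other r r′ l ρ ne
                      | ≡ᵇ-off j r i (λ e → ne (Data.Fin.Properties.suc-injective (trans (sym eq) e))) = refl

  module _ {x : List Sym} {b : ℕ} {h : Head} (on : h On x) where

    go-home : ∀ ρ y p → p < b → Reaches x b (suc p) (homing y (track p)) h p (tape ρ) (ready y) h 0 (tape ρ)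
    go-home ρ y zero lt = reach-keep on refl refl refl lt
    go-home ρ y (suc p) lt = reach-trans
      (reach-keep {mi = mS} {mw = mL} on refl
        (trans (if-false (atHome-later ρ p))
               (cong (λ z → homing y z , tape ρ (suc p) , mS , mL) (down-track p))) refl (<-trans (n<1+n p) lt))
      (go-home ρ y p (<-trans (n<1+n p) lt))

    seek-miss : ∀ ρ r hit q p → p < spot r (length (get r ρ)) →
      seekStep r hit q (track p) (tape ρ p) ≡ (seek q (track (suc p)) , tape ρ p , mS , mR)
    seek-miss ρ r hit q p lt = trans (if-false miss)
                                     (cong (λ z → seek q z , tape ρ p , mS , mR) (up-track p))
      where
      miss : does (track p ≟ suc r) ∧ isBlank (tape ρ p) ≡ false
      miss with track p ≟ suc r
      ... | no _ = refl
      ... | yes e = trans (cong (λ z → isBlank (tape ρ z)) (on-track p r e))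
                     (trans (cong isBlank (tape-spot ρ r (p / K)))
                       (cell-full (get r ρ) (p / K) (spot-< r {p / K} {length (get r ρ)} (subst (_< _) (on-track p r e) lt))))

    seek-hit : ∀ ρ r hit q → let p = spot r (length (get r ρ)) in seekStep r hit q (track p) (tape ρ p) ≡ hit
    seek-hit ρ r hit q = if-true found
      where
      P = spot r (length (get r ρ))
      found : does (track P ≟ suc r) ∧ isBlank (tape ρ P) ≡ true
      found with track P ≟ suc r
      ... | no ne = ⊥-elim (ne (spot-track r (length (get r ρ))))
      ... | yes _ = cong isBlank (trans (tape-spot ρ r (length (get r ρ))) (cell-blank (get r ρ) _ ≤-refl))

    go-seek : ∀ ρ r q (hit : Fin K → Fin 3 → Action) →
      (∀ j c → seeking q (instr prog q) j c ≡ seekStep r (hit j c) q j c) →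
      ∀ d p → p + d ≡ spot r (length (get r ρ)) → spot r (length (get r ρ)) < b →
      Reaches x b d (seek q (track p)) h p (tape ρ)
                    (seek q (track (spot r (length (get r ρ))))) h (spot r (length (get r ρ))) (tape ρ)
    go-seek ρ r q hit eq zero p e lt rewrite sym (trans (sym (+-identityʳ p)) e) = reach-refl
    go-seek ρ r q hit eq (suc d) p e lt = reach-trans
      (reach-keep {mi = mS} {mw = mR} on refl (trans (eq (track p) (tape ρ p)) (seek-miss ρ r _ q p p<)) refl (≤-<-trans p< lt))
      (go-seek ρ r q hit eq d (suc p) (trans (sym (+-suc p d)) e) lt)
      where p< = subst (suc p ≤_) e (subst (suc p ≤_) (sym (+-suc p d)) (s≤s (m≤m+n p d)))

    back-miss : ∀ ρ r f q p → track (suc p) ≢ suc r →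
      backStep r f q (track (suc p)) (tape ρ (suc p)) ≡ (back q (track p) , tape ρ (suc p) , mS , mL)
    back-miss ρ r f q p ne with track (suc p) ≟ suc r
    ... | yes e = ⊥-elim (ne e)
    ... | no _ = trans (if-false (atHome-later ρ p))
                   (cong (λ z → back q z , tape ρ (suc p) , mS , mL) (down-track p))

    go-back : ∀ ρ r q f → instr prog q ≡ ipop r f → ∀ p₀ d → (∀ p → p₀ < p → p ≤ p₀ + d → track p ≢ suc r) →
      p₀ + d < b → Reaches x b d (back q (track (p₀ + d))) h (p₀ + d) (tape ρ) (back q (track p₀)) h p₀ (tape ρ)
    go-back ρ r q f eq p₀ zero off lt rewrite +-identityʳ p₀ = reach-refl
    go-back ρ r q f eq p₀ (suc d) off lt rewrite +-suc p₀ d = reach-trans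
      (reach-keep {mi = mS} {mw = mL} on refl
        (trans (cong (λ z → backing q z (track (suc (p₀ + d))) (tape ρ (suc (p₀ + d)))) eq)
          (back-miss ρ r f q (p₀ + d) (off _ (s≤s (m≤m+n p₀ d)) ≤-refl))) refl (<-trans (n<1+n _) lt))
      (go-back ρ r q f eq p₀ d (λ p a c → off p a (m≤n⇒m≤1+n c)) (<-trans (n<1+n _) lt))

    Op : ℕ → Ctl prog → Head → Regs k → Point prog → Head → Regs k → Set
    Op t q h ρ y h′ ρ′ = Reaches x b t (ready (inj₁ q)) h 0 (tape ρ) (ready y) h′ 0 (tape ρ′)

    -- Out to the first blank of the track and home again, two passes over fewer than `b` cells;
    -- `4 * b` is a common bound for all instructions.
    op-push : ∀ ρ r q c y → instr prog q ≡ ipush r c y → spot r (length (get r ρ)) < b →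
      Op (4 * b) q h ρ y h (set r (c ∷ get r ρ) ρ)
    op-push ρ r q c y eq lt = reach-weaken bound
      (reach-trans (reach-keep {mi = mS} {mw = mR} on refl (cong (λ z → dispatch q z (under h) (tape ρ 0)) eq) refl (≤-trans (s≤s (s≤s z≤n)) lt))
      (reach-trans (go-seek ρ r q (λ j _ → homing y j , symbol c , mS , mS) (λ j d → cong (λ z → seeking q z j d) eq) p 1 refl lt)
      (reach-trans (reach-cong (write-spot ρ r (c ∷ get r ρ) (length (get r ρ)) (symbol c) (λ _ → refl))
                     (reach-step {mi = mS} {mw = mS} on refl (trans (cong (λ z → seeking q z (track (suc p)) (tape ρ (suc p))) eq)
                        (seek-hit ρ r _ q)) lt))
        (go-home (set r (c ∷ get r ρ) ρ) y (suc p) lt))))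
      where
      p = toℕ r + length (get r ρ) * K
      bound : 1 + (p + (1 + suc (suc p))) ≤ 4 * b
      bound = ≤-trans (s≤s (+-monoʳ-≤ p (s≤s (s≤s (s≤s (m≤n+m p 0))))))
        (≤-trans (≤-trans (s≤s (m≤n+m _ 0)) (+-mono-≤ {1 + p} (≤-trans (n≤1+n _) lt)
          (≤-trans {3 + p} (s≤s lt) (≤-trans (+-monoˡ-≤ b (≤-trans (s≤s z≤n) lt)) (+-monoʳ-≤ b (m≤m+n b _))))))
          ≤-refl)

    -- Row 0 is the leftmost cell of the stack, so the way back meets the marker in cell 0 before
    -- any other cell of the track.
    op-pop-empty : ∀ ρ r q f → instr prog q ≡ ipop r f → get r ρ ≡ [] → spot r 0 < b →
      Op (4 * b) q h ρ (f nothing) h ρ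
    op-pop-empty ρ r q f eq emp lt = reach-weaken bound
      (reach-trans (reach-keep {mi = mS} {mw = mR} on refl (cong (λ z → dispatch q z (under h) (tape ρ 0)) eq) refl (≤-trans (s≤s (s≤s z≤n)) lt))
      (reach-trans (subst (λ z → Reaches x b p (seek q (track 1)) h 1 (tape ρ) (seek q (track z)) h z (tape ρ)) spot≡
                     (go-seek ρ r q (λ j d → back q (down j) , d , mS , mL) (λ j d → cong (λ z → seeking q z j d) eq) p 1 (sym spot≡)
                       (subst (_< b) (sym spot≡) lt)))
      (reach-trans (reach-keep {mi = mS} {mw = mL} on refl
                     (trans (cong (λ z → seeking q z (track (suc p)) (tape ρ (suc p))) eq)
                       (trans (subst (λ z → seekStep r (retreat z) q (track z) (tape ρ z) ≡ retreat z) spot≡ (seek-hit ρ r (retreat (spot r (length (get r ρ)))) q))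
                          (cong (λ z → back q z , tape ρ (suc p) , mS , mL) (down-track p)))) refl (<-trans (n<1+n _) lt))
      (reach-trans (go-back ρ r q f eq 0 p off (<-trans (n<1+n _) lt))
        (reach-keep {mi = mS} {mw = mS} on refl (cong (λ z → backing q z (track 0) (tape ρ 0)) eq) refl (≤-trans (s≤s z≤n) lt))))))
      where
      p = toℕ r + 0
      retreat : ℕ → Action
      retreat z = back q (down (track z)) , tape ρ z , mS , mL
      spot≡ : spot r (length (get r ρ)) ≡ suc p
      spot≡ = cong (λ l → spot r (length l)) emp
      off : ∀ j → 0 < j → j ≤ p → track j ≢ suc r
      off j _ j≤ e = <⇒≢ (≤-trans (s≤s j≤) (≤-reflexive (cong suc (+-identityʳ (toℕ r)))))
        (trans (sym (m<n⇒m%n≡m (s≤s (≤-trans j≤ (≤-trans (≤-reflexive (+-identityʳ _)) (<⇒≤ (toℕ<n r)))))))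
               (trans (sym (toℕ-track j)) (cong toℕ e)))
      bound : 1 + (p + (1 + (p + 1))) ≤ 4 * b
      bound = ≤-trans (+-mono-≤ {1 + p} {b} (<⇒≤ lt) (≤-trans (≤-reflexive (cong suc (+-comm p 1))) lt))
                      (+-monoʳ-≤ b (m≤m+n b _))

    -- The first blank lies one row above the top bit, `k + 1` cells to its right, and no cell in
    -- between belongs to the same stack: one step to turn around, `k` steps back.
    op-pop-cons : ∀ ρ r q f c l → instr prog q ≡ ipop r f → get r ρ ≡ c ∷ l → spot r (suc (length l)) < b →
      Op (4 * b) q h ρ (f (just c)) h (set r l ρ)
    op-pop-cons ρ r q f c l eq ful lt = reach-weaken bound
      (reach-trans (reach-keep {mi = mS} {mw = mR} on refl (cong (λ z → dispatch q z (under h) (tape ρ 0)) eq) refl (≤-trans (s≤s (s≤s z≤n)) lt))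
      (reach-trans (subst (λ z → Reaches x b p (seek q (track 1)) h 1 (tape ρ) (seek q (track z)) h z (tape ρ)) spot≡
                     (go-seek ρ r q (λ j d → back q (down j) , d , mS , mL) (λ j d → cong (λ z → seeking q z j d) eq) p 1 (sym spot≡)
                       (subst (_< b) (sym (trans spot≡ (cong suc p≡))) lt′)))
      (reach-trans (reach-keep {mi = mS} {mw = mL} on refl
                     (trans (cong (λ z → seeking q z (track (suc p)) (tape ρ (suc p))) eq)
                       (trans (subst (λ z → seekStep r (retreat z) q (track z) (tape ρ z) ≡ retreat z) spot≡ (seek-hit ρ r (retreat (spot r (length (get r ρ)))) q))
                          (cong (λ z → back q z , tape ρ (suc p) , mS , mL) (down-track p)))) refl (<-trans (n<1+n _) lt))
      (reach-trans (subst (λ z → Reaches x b k (back q (track z)) h z (tape ρ) (back q (track p₀)) h p₀ (tape ρ)) (sym p≡)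
                     (go-back ρ r q f eq p₀ k off (<-trans (n<1+n _) lt′)))
      (reach-trans (reach-cong (write-spot ρ r l (length l) zero erased)
                     (reach-step {mi = mS} {mw = mS} on refl (trans (cong (λ z → backing q z (track p₀) (tape ρ p₀)) eq) found) p₀<))
        (subst (λ z → Reaches x b (suc p₀) (homing (f (just z)) (track p₀)) h p₀ (tape (set r l ρ))
                              (ready (f (just c))) h 0 (tape (set r l ρ))) (sym bit≡)
          (go-home (set r l ρ) (f (just c)) p₀ p₀<)))))))
      where
      p₀ = spot r (length l)
      p = toℕ r + suc (length l) * K
      retreat : ℕ → Action
      retreat z = back q (down (track z)) , tape ρ z , mS , mL
      p≡ : p ≡ p₀ + k
      p≡ = trans (cong (toℕ r +_) (+-comm (suc k) (length l * K)))
             (trans (sym (+-assoc (toℕ r) (length l * K) (suc k))) (+-suc _ k))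
      lt′ : suc (p₀ + k) < b
      lt′ = subst (λ z → suc z < b) p≡ lt
      p₀< : p₀ < b
      p₀< = ≤-trans (s≤s (m≤m+n p₀ k)) (<⇒≤ lt′)
      spot≡ : spot r (length (get r ρ)) ≡ suc p
      spot≡ = cong (λ l → spot r (length l)) ful
      off : ∀ j → p₀ < j → j ≤ p₀ + k → track j ≢ suc r
      off j lo hi e = <⇒≱ (spot-< r {length l} {j / K} (subst (p₀ <_) (on-track j r e) lo))
        (≤-pred (spot-< r {j / K} {suc (length l)} (subst (_< spot r (suc (length l))) (on-track j r e)
          (s≤s (≤-trans hi (≤-reflexive (sym p≡)))))))
      bit≡ : bitOf (tape ρ p₀) ≡ c
      bit≡ = trans (cong bitOf (trans (tape-spot ρ r (length l)) (trans (cong (λ m → cell m (length l)) ful)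
               (if-true (≡ᵇ-refl (length l)))))) (lemma c)
        where
        lemma : ∀ c → bitOf (symbol c) ≡ c
        lemma false = refl
        lemma true = refl
      found : backStep r f q (track p₀) (tape ρ p₀) ≡ (homing (f (just (bitOf (tape ρ p₀)))) (track p₀) , zero , mS , mS)
      found with track p₀ ≟ suc r
      ... | yes _ = refl
      ... | no ne = ⊥-elim (ne (spot-track r (length l)))
      erased : ∀ j → cell l j ≡ (if j ≡ᵇ length l then zero else cell (get r ρ) j)
      erased j rewrite ful with j ≡ᵇ length l in e
      ... | true = cell-blank l j (≤-reflexive (sym (≡ᵇ⇒≡ j _ (subst Data.Bool.T (sym e) tt))))
      ... | false = refl
      bound : 1 + (p + (1 + (k + (1 + suc p₀)))) ≤ 4 * b
      bound = ≤-trans (+-mono-≤ {1 + p} {b} (<⇒≤ lt) (≤-trans (≤-reflexive (trans (cong suc (trans (+-suc k _) (cong suc (trans (+-suc k _) (cong suc (+-comm k p₀))))))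
                                                        refl)) (≤-trans (s≤s lt′) (+-monoˡ-≤ b (≤-trans (s≤s z≤n) lt′)))))
                      (+-monoʳ-≤ b (+-monoʳ-≤ b (m≤m+n b _)))

top : List Bool → Maybe Bool
top [] = nothing
top (c ∷ _) = just c

bitIx-top : ∀ l → bitIx (top l) ≡ topIx l
bitIx-top [] = refl
bitIx-top (false ∷ l) = refl
bitIx-top (true ∷ l) = refl

total : ∀ {m} → (Fin m → ℕ) → ℕ
total {zero} f = 0
total {suc m} f = f zero + total (f ∘ suc)

member≤total : ∀ {m} (f : Fin m → ℕ) i → f i ≤ total f
member≤total f zero = m≤m+n _ _
member≤total f (suc i) = ≤-trans (member≤total (f ∘ suc) i) (m≤n+m _ (f zero))

-- Exec with loops bounded by X takes at most X to the power cost machine steps.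
cost : ∀ {k n} → Cmd k n → ℕ
cost (ret i) = 0
cost (move m) = 1
cost read = 1
cost (push r b) = 1
cost (pop r) = 1
cost (bind c f) = suc (cost c + total (λ i → cost (f i)))
cost (loop a f s) = 2 + total (λ i → cost (f i))

module Simulate {k : ℕ} (prog : Cmd k 2) (B H X : ℕ) (2≤X : 2 ≤ X) (B≤X : B ≤ X)
                (step≤X : 4 * (suc H * suc k) ≤ X) {x : List Sym} where

  open Compile prog

  -- A stack of height `H` has its first blank in row `H`, hence `suc H` rows of `K` cells.
  b : ℕ
  b = suc H * K

  Small : Regs k → Set
  Small ρ = ∀ r → length (get r ρ) ≤ H

  record Sim (t : ℕ) (y : Point prog) (h : Head) (ρ : Regs k) (y′ : Point prog) (h′ : Head) (ρ′ : Regs k) : Set where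
    constructor sim
    field
      path   : Reaches x b t (ready y) h 0 (tape ρ) (ready y′) h′ 0 (tape ρ′)
      on′    : h′ On x
      small′ : Small ρ′

  X≥1 : 1 ≤ X
  X≥1 = ≤-trans (s≤s z≤n) 2≤X

  ^-mono : ∀ {m n} → m ≤ n → X ^ m ≤ X ^ n
  ^-mono = ^-monoʳ-≤ X {{>-nonZero X≥1}}

  -- Because `X` is at least 2. This is the reason for the extra one in the cost of a sequence.
  add-powers : ∀ p q → X ^ p + X ^ q ≤ X ^ suc (p + q)
  add-powers p q = begin
    X ^ p + X ^ q             ≤⟨ +-mono-≤ (^-mono (m≤m+n p q)) (^-mono (m≤n+m q p)) ⟩
    X ^ (p + q) + X ^ (p + q) ≡⟨ cong (X ^ (p + q) +_) (+-identityʳ _) ⟨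
    2 * X ^ (p + q)           ≤⟨ *-monoˡ-≤ (X ^ (p + q)) 2≤X ⟩
    X ^ suc (p + q) ∎
    where open ≤-Reasoning

  spot-bound : ∀ r i → i ≤ H → spot r i < b
  spot-bound r i i≤ = +-mono-<-≤ (s≤s (toℕ<n r)) (*-monoˡ-≤ K i≤)

  small-set : ∀ {ρ r l} → Small ρ → length l ≤ H → Small (set r l ρ)
  small-set {ρ} {r} {l} sm l≤ r′ with r′ ≟ r
  ... | yes refl = subst (λ z → length z ≤ H) (sym (get-set r′ l ρ)) l≤
  ... | no ne = subst (λ z → length z ≤ H) (sym (get-set-other r r′ l ρ ne)) (sm r′)

  -- A subcommand is simulated inside the whole program: its control points are sent to control
  -- points that carry the same instructions up to renamed targets.
  Embeds : ∀ {n} (c : Cmd k n) → (Point c → Point prog) → Set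
  Embeds c e = ∀ q → Σ (Ctl prog) λ q′ → e (inj₁ q) ≡ inj₁ q′ × instr prog q′ ≡ mapI e (instr c q)

  compose : ∀ {n m} {c : Cmd k n} {c′ : Cmd k m} {e : Point c → Point prog} (f : Point c′ → Point c) →
    Embeds c e → (∀ q → Σ (Ctl c) λ q′ → f (inj₁ q) ≡ inj₁ q′ × instr c q′ ≡ mapI f (instr c′ q)) →
    Embeds c′ (e ∘ f)
  compose {c′ = c′} {e} f em in-f q with in-f q
  ... | q′ , e₁ , e₂ with em q′
  ...   | q″ , e₃ , e₄ = q″ , trans (cong e e₁) e₃ , trans e₄ (trans (cong (mapI e) e₂) (mapI-∘ e f (instr c′ q)))

  sim-exec : ∀ {n} (c : Cmd k n) (e : Point c → Point prog) → Embeds c e →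
    ∀ {h ρ i h′ ρ′} → Exec B H c (h , ρ) i (h′ , ρ′) → h On x → Small ρ →
    Sim (X ^ cost c) (e (entry c)) h ρ (e (inj₂ i)) h′ ρ′

  sim-loop : ∀ {n a} (f : Fin a → Cmd k (a + n)) s₀ (e : Point (loop a f s₀) → Point prog) → Embeds (loop a f s₀) e →
    ∀ {s h ρ i h′ ρ′ t} → Loop B H f s (h , ρ) i (h′ , ρ′) t → h On x → Small ρ →
    Sim (t * X ^ suc (total (λ s → cost (f s)))) (e (inj₁ (s , inj₁ tt))) h ρ (e (inj₂ i)) h′ ρ′

  sim-exec (ret i) e em ret on sm = sim (reach-weaken z≤n reach-refl) on sm
  sim-exec (move m) e em {h} {ρ} move on sm with em tt
  ... | q , eq , ins rewrite eq = sim (reach-weaken (≤-trans X≥1 (≤-reflexive (sym (*-identityʳ X))))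
        (reach-keep {h = h} {mi = m} {mw = mS} on refl (cong (λ z → dispatch q z (under h) (tape ρ 0)) ins) refl (s≤s z≤n)))
        (shift-On m {h} on) sm
  sim-exec read e em {h} {ρ} read on sm with em tt
  ... | q , eq , ins rewrite eq = sim (reach-weaken (≤-trans X≥1 (≤-reflexive (sym (*-identityʳ X))))
        (reach-keep {mi = mS} {mw = mS} on refl (cong (λ z → dispatch q z (under h) (tape ρ 0)) ins) refl (s≤s z≤n)))
        on sm
  sim-exec (push r c) e em {h} {ρ} (push lt) on sm with em tt
  ... | q , eq , ins rewrite eq = sim (reach-weaken (≤-trans step≤X (≤-reflexive (sym (*-identityʳ X))))
        (op-push {h = h} on ρ r q c _ ins (spot-bound r _ (<⇒≤ lt)))) on (small-set sm lt)
  sim-exec (pop r) e em {h} {ρ} pop on sm with em tt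
  ... | q , eq , ins rewrite eq with get r ρ in got | sm r
  ...   | [] | _ = sim (reach-weaken (≤-trans step≤X (≤-reflexive (sym (*-identityʳ X))))
          (subst (λ z → Op {h = h} on (4 * b) q h ρ (e (inj₂ 0F)) h z) (trans (sym (set-get r ρ)) (cong (λ l → set r l ρ) got))
            (op-pop-empty {h = h} on ρ r q _ ins got (spot-bound r 0 z≤n)))) on (small-set sm z≤n)
  ...   | c ∷ l | l≤ = sim (reach-weaken (≤-trans step≤X (≤-reflexive (sym (*-identityʳ X))))
          (subst (λ z → Op {h = h} on (4 * b) q h ρ (e (inj₂ z)) h (set r l ρ)) (bitIx-top (c ∷ l))
            (op-pop-cons {h = h} on ρ r q _ c l ins got (spot-bound r _ l≤)))) on (small-set sm (<⇒≤ l≤))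
  sim-exec (bind c f) e em (bind {τ = _ , _} {i = i} p₁ p₂) on sm
    with sim-exec c (e ∘ outer c f) (compose (outer c f) em (λ q → inj₁ q , refl , refl)) p₁ on sm
  ... | sim r₁ on₁ sm₁
    with sim-exec (f i) (e ∘ inner c f i) (compose (inner c f i) em (λ q → inj₂ (i , q) , refl , refl)) p₂ on₁ sm₁
  ... | sim r₂ on₂ sm₂ = sim (reach-weaken
          (≤-trans (add-powers (cost c) (cost (f i))) (^-mono (s≤s (+-monoʳ-≤ (cost c) (member≤total (cost ∘ f) i)))))
          (reach-trans r₁ r₂)) on₂ sm₂
  sim-exec (loop a f s) e em (loop p t≤) on sm with sim-loop f s e em p on sm
  ... | sim r on′ sm′ = sim (reach-weaken (*-monoˡ-≤ _ (≤-trans t≤ B≤X)) r) on′ sm′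

  enter : ∀ {n a} (f : Fin a → Cmd k (a + n)) s₀ (e : Point (loop a f s₀) → Point prog) → Embeds (loop a f s₀) e →
    ∀ {s h ρ i h′ ρ′} → Exec B H (f s) (h , ρ) i (h′ , ρ′) → h On x → Small ρ →
    Sim (X ^ suc (total (λ s → cost (f s)))) (e (inj₁ (s , inj₁ tt))) h ρ (e (body f s₀ s (inj₂ i))) h′ ρ′
  enter f s₀ e em {s} {h} {ρ} p on sm
    with em (s , inj₁ tt) | sim-exec (f s) (e ∘ body f s₀ s) (compose (body f s₀ s) em (λ q → (s , inj₂ q) , refl , refl)) p on sm
  ... | q , eq , ins | sim r on′ sm′ rewrite eq = sim (reach-weaken
        -- The single step at the loop head counts as `X ^ 0`.
        (≤-trans (add-powers 0 (cost (f s))) (^-mono (s≤s (member≤total (cost ∘ f) s))))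
        (reach-trans (reach-keep {mi = mS} {mw = mS} on refl (cong (λ z → dispatch q z (under h) (tape ρ 0)) ins) refl (s≤s z≤n)) r))
        on′ sm′

  sim-loop f s₀ e em (done p ex) on sm with enter f s₀ e em p on sm
  ... | sim r on₁ sm₁ rewrite ex = sim (reach-weaken (≤-reflexive (sym (+-identityʳ _))) r) on₁ sm₁
  sim-loop f s₀ e em (again {τ = _ , _} p ex ps) on sm with enter f s₀ e em p on sm
  ... | sim r on₁ sm₁ rewrite ex with sim-loop f s₀ e em ps on₁ sm₁
  ...   | sim r₂ on₂ sm₂ = sim (reach-trans r r₂) on₂ sm₂

  simulate : ∀ {i h ρ} → Exec B H prog (([] , x) , no-regs) i (h , ρ) →
    Σ ℕ λ t → TM.halted tm (state (run tm x t)) ≡ just (verdict i) × t ≤ suc (X ^ cost prog) × space (run tm x t) ≤ b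
  simulate p with sim-exec prog id (λ q → q , refl , sym (mapI-id (instr prog q))) p refl (λ r → subst (λ z → length z ≤ H) (sym (get-no-regs r)) z≤n)
    where
    mapI-id : ∀ {Y} (i : Instr k Y) → mapI id i ≡ i
    mapI-id (imove m y) = refl
    mapI-id (iread f) = refl
    mapI-id (ipush r b y) = refl
    mapI-id (ipop r f) = refl
  ... | sim (reaches t t≤ r) _ _ = suc t ,
        subst (λ c → TM.halted tm (state c) ≡ _) (sym (run-steps tm x (suc t))) (rep-halt final) ,
        s≤s t≤ , subst (λ c → space c ≤ b) (sym (run-steps tm x (suc t))) (rep-space final)
    where
    started : Rep b (steps tm x 1 (initial tm)) (ready (entry prog)) ([] , x) 0 (tape no-regs)
    started = rep-cong written (rep-step {mi = mS} {mw = mS} (rep-initial x (s≤s z≤n)) refl refl refl (s≤s z≤n))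
      where
      written : ∀ j → write (λ _ → zero) 0 1F j ≡ tape no-regs j
      written zero = refl
      written (suc p) = sym (blank-tape p)
    final = r started

-- The reachability program

Reg : Set
Reg = Fin 13

Com : ℕ → Set
Com = Cmd 13

-- I, J, E: row, column and entry counters; C, T: scratch; W, W′: the control word, most recent letter
-- on top of W; Mk, Mk′: the marks of all bags on the current branch; F: recursion budget; D: pending
-- subtrees; G: whether the current row vertex is marked; A: nonempty once v is reached.
pattern I = 0F
pattern J = 1F
pattern E = 2F
pattern C = 3F
pattern T = 4F
pattern W = 5F
pattern W′ = 6F
pattern Mk = 7F
pattern Mk′ = 8F
pattern F = 9F
pattern D = suc 9F
pattern G = suc (suc 9F)
pattern A = suc (suc (suc 9F))

infixl 1 _>>=_ _>>_

_>>=_ : ∀ {m n} → Com m → (Fin m → Com n) → Com n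
_>>=_ = bind

_>>_ : ∀ {n} → Com 1 → Com n → Com n
c >> d = bind c (λ _ → d)

repeat : ∀ {n} → Com (suc n) → Com n
repeat c = loop 1 (λ _ → c) 0F

skip : Com 1
skip = ret 0F

case2 : ∀ {n} → Com n → Com n → Fin 2 → Com n
case2 a b 0F = a
case2 a b 1F = b

case3 : ∀ {n} → Com n → Com n → Com n → Fin 3 → Com n
case3 a b c 0F = a
case3 a b c 1F = b
case3 a b c 2F = c

-- In the order s0, s1, sSep, sTip, sNode, end of input.
case6 : ∀ {n} → Com n → Com n → Com n → Com n → Com n → Com n → Fin 6 → Com n
case6 a b c d e f 0F = a
case6 a b c d e f 1F = b
case6 a b c d e f 2F = c
case6 a b c d e f 3F = d
case6 a b c d e f 4F = e
case6 a b c d e f 5F = f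

clear : Reg → Com 1
clear r = repeat (pop r >>= case3 (ret 1F) (ret 0F) (ret 0F))

pour : Reg → Reg → Com 1
pour a b = repeat (pop a >>= case3 (ret 1F) (push b false >> ret 0F) (push b true >> ret 0F))

fill : Reg → Bool → Com 1
fill r b = repeat (pop T >>= case3 (ret 1F) (push r b >> ret 0F) (push r b >> ret 0F))

inc : Reg → Com 1
inc r = repeat (pop r >>= case3 (push r true >> ret 1F) (push r true >> ret 1F) (push T true >> ret 0F))
     >> fill r false

-- Exit 1 means that the counter was zero; it is then left empty, which still has the value zero.
dec : Com 2
dec = repeat (pop C >>= case3 (ret 2F) (push T true >> ret 0F) (push C false >> ret 1F))
  >>= case2 (fill C true >> ret 0F) (clear T >> ret 1F)

copy : Reg → Com 1
copy r = pour r T >> repeat (pop T >>= case3 (ret 1F) (push r false >> push C false >> ret 0F)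
                                                      (push r true >> push C true >> ret 0F))

seek : Reg → Com 1
seek r = copy r >> repeat (dec >>= case2 (move mR >> ret 0F) (ret 1F))

skipSep : Com 1
skipSep = repeat (read >>= case6 go go (move mR >> ret 1F) go go (ret 1F))
  where go = move mR >> ret 0F

toEnd : Com 1
toEnd = repeat (read >>= case6 go go go go go (ret 1F))
  where go = move mR >> ret 0F

-- The encoding of a tree ends with `sTip` and unary fields contain none, so the last `sTip` of the
-- input stands right before the field of u.
uField : Com 1
uField = toEnd >> repeat (move mL >> read >>= case6 (ret 0F) (ret 0F) (ret 0F) (ret 1F) (ret 0F) (ret 0F)) >> move mR

vField : Com 1
vField = uField >> skipSep

-- Leftwards of the u-field, the first separator that is followed on its left by bits and another
-- separator (not by a node symbol) is the one that closes the adjacency matrix.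
homeStep : Fin 2 → Com 3
homeStep 0F = move mL >> read >>= case6 (ret 0F) (ret 0F) (ret 1F) (ret 0F) (ret 0F) (ret 0F)
homeStep 1F = move mL >> read >>= case6 (ret 1F) (ret 1F) (ret 2F) (ret 0F) (ret 0F) (ret 0F)

home : Com 1
home = uField >> loop 2 homeStep 0F >> move mR

root : Com 1
root = home >> skipSep

equals : Reg → Com 2
equals r = copy r >> repeat (dec >>= case2
    (read >>= case6 (ret 1F) (move mR >> ret 0F) (ret 1F) (ret 1F) (ret 1F) (ret 1F))
    (read >>= case6 (ret 2F) (ret 1F) (ret 2F) (ret 2F) (ret 2F) (ret 2F)))
  >>= λ b → clear C >> ret b

shiftMark : Com 1
shiftMark = pop Mk′ >>= case3 skip (push Mk false) (push Mk true)

-- One routine for marking and for testing: both the mark and `G` become their disjunction. If `G`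
-- starts true the vertex gets marked; if it starts false it ends up telling whether a mark was
-- found.
orMark : Com 1
orMark = pop G >>= case3 skip
  (pop Mk′ >>= case3 skip (push Mk false >> push G false) (push Mk true >> push G true))
  (pop Mk′ >>= λ _ → push Mk true >> push G true)

bagStep : Fin 2 → Com 3
bagStep 0F = read >>= case6
  (dec >>= case2 (move mR >> ret 0F) (move mR >> ret 1F))
  (dec >>= case2 (shiftMark >> move mR >> ret 0F) (orMark >> move mR >> ret 1F))
  out out out out
  where out = move mR >> ret 2F
bagStep 1F = read >>= case6 (move mR >> ret 1F) (shiftMark >> move mR >> ret 1F) out out out out
  where out = move mR >> ret 2F

bagOr : Reg → Com 1
bagOr r = copy r >> move mR >> loop 2 bagStep 0F

skipTree : Com 1
skipTree = push D true >> repeat (pop D >>= case3 (ret 1F) go go)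
  where
  go = read >>= case6 (ret 1F) (ret 1F) (ret 1F) (move mR >> ret 0F)
                      (push D true >> push D true >> skipSep >> ret 0F) (ret 1F)

-- Each access to a bag starts at the root again and replays the control word. The letters with
-- first bit false stay at the node; the others visit its bag and descend, a right turn skipping the
-- left subtree.
route : Com 1 → Com 1
route visit = root >> pour W W′ >> repeat (pop W′ >>= case3 (ret 1F)
  (push W false >> (pop W′ >>= case3 (ret 1F) (push W false >> ret 0F) (push W true >> ret 0F)))
  (visit >> push W true >> (pop W′ >>= case3 (ret 1F) (push W false >> ret 0F) (push W true >> skipTree >> ret 0F))))

-- Pouring brings the marks of the root bag to the top, in the order in which the bags are met. The
-- bag at the end of the branch is handled separately, as `route` visits proper ancestors only.
walk-steps : Reg → Com 1
walk-steps r = pour Mk Mk′ >> route (bagOr r) >> bagOr r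

-- Sealed, so that statements about larger programs do not expand into their whole flow graph.
opaque
  walk : Reg → Com 1
  walk r = walk-steps r

  fold-walk : ∀ {B H r σ i τ} → Exec B H (walk-steps r) σ i τ → Exec B H (walk r) σ i τ
  fold-walk p = p

eachMember : Com 1 → Com 1
eachMember c = repeat (move mR >> read >>= case6 (ret 0F) (c >> ret 0F) (ret 1F) (ret 1F) (ret 1F) (ret 1F))

enterBag-steps : Com 2
enterBag-steps = route skipSep >> read >>= case6 (ret 0F) (ret 0F) (ret 0F) (ret 0F)
  (eachMember (push Mk false) >> ret 1F) (ret 0F)

opaque
  enterBag : Com 2
  enterBag = enterBag-steps

  fold-enterBag : ∀ {B H σ i τ} → Exec B H enterBag-steps σ i τ → Exec B H enterBag σ i τ
  fold-enterBag p = p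

leaveBag-steps : Com 1
leaveBag-steps = route skipSep >> eachMember (pop Mk >>= λ _ → skip)

opaque
  leaveBag : Com 1
  leaveBag = leaveBag-steps

  fold-leaveBag : ∀ {B H σ i τ} → Exec B H leaveBag-steps σ i τ → Exec B H leaveBag σ i τ
  fold-leaveBag p = p

mark-steps : Reg → Com 1
mark-steps r = walk r >> vField >> equals r >>= case2 skip (clear A >> push A true)

opaque
  mark : Reg → Com 1
  mark r = mark-steps r

  fold-mark : ∀ {B H r σ i τ} → Exec B H (mark-steps r) σ i τ → Exec B H (mark r) σ i τ
  fold-mark p = p

ifMarked : Com 1 → Com 1
ifMarked c = pop G >>= case3 (push G false) (push G false) (push G true >> c)

-- The root bag is written with exactly `n` bits and serves as a ruler: the loop ends when the index
-- points at the separator behind them.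
eachIndex : Reg → Com 1 → Com 1
eachIndex r c = repeat (root >> move mR >> seek r >> read >>= case6 (c >> ret 0F) (c >> ret 0F) (ret 1F) (ret 1F) (ret 1F) (ret 1F))
  >> clear r

-- `E` keeps counting across the rows, so the position of an entry in the matrix is available
-- without multiplication.
entry-steps : Com 1
entry-steps = home >> seek E >> read >>= case6 skip (ifMarked (mark J)) skip skip skip skip >> inc J >> inc E

opaque
  entryStep : Com 1
  entryStep = entry-steps

  fold-entryStep : ∀ {B H σ i τ} → Exec B H entry-steps σ i τ → Exec B H entryStep σ i τ
  fold-entryStep p = p

-- Comparing with u gives the initial value of `G`, so that u counts as marked. The walk may find a
-- mark only in a bag low on the branch; `mark I` walks again with `G` true to reach the bags above
-- it.
row-steps : Com 1
row-steps = uField >> equals I >>= case2 (push G false) (push G true) >> walk I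
  >> ifMarked (mark I) >> eachIndex J entryStep >> clear G >> inc I

opaque
  rowStep : Com 1
  rowStep = row-steps

  fold-rowStep : ∀ {B H σ i τ} → Exec B H row-steps σ i τ → Exec B H rowStep σ i τ
  fold-rowStep p = p

propagate-steps : Com 1
propagate-steps = eachIndex I rowStep >> clear E

opaque
  propagate : Com 1
  propagate = propagate-steps

  fold-propagate : ∀ {B H σ i τ} → Exec B H propagate-steps σ i τ → Exec B H propagate σ i τ
  fold-propagate p = p

pushLetter : Bool → Bool → Com 1
pushLetter a b = push W a >> push W b

popLetter : Com 1
popLetter = pop W >>= λ _ → pop W >>= λ _ → skip

pattern DOWN = 0F
pattern BODY = 1F
pattern AFTER-LEFT = 2F
pattern AFTER-BODY = 3F
pattern RETURN = 4F
pattern FINISHED = 5F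

tryChild : Bool → Fin 6 → Com 6
tryChild d next = pushLetter true d >> enterBag >>= case2 (popLetter >> ret next) (ret DOWN)

-- The letter removed by `RETURN` is put back because the child's bag is found by means of the
-- control word. Propagation saves the marks of that bag before it is dropped.
fromChild : Bool → Fin 6 → Com 6
fromChild d next = pushLetter true d >> propagate >> leaveBag >> popLetter >> ret next

spend : Bool → Fin 6 → Com 6
spend b next = pop F >>= case3 (ret next) go go
  where go = pushLetter false b >> ret DOWN

-- The letter on top of the control word is the return address. It is pushed with its kind first, so
-- `RETURN` pops the second bit of the code before the first; a call with reduced budget gives its
-- unit back to `F`.
searchStep : Fin 5 → Com 6
searchStep DOWN = spend false BODY
searchStep BODY = propagate >> tryChild false AFTER-LEFT
searchStep AFTER-LEFT = tryChild true AFTER-BODY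
searchStep AFTER-BODY = spend true RETURN
searchStep RETURN = pop W >>= case3 (ret FINISHED)
  (pop W >>= case3 (ret FINISHED) (push F true >> ret BODY) (fromChild false AFTER-LEFT))
  (pop W >>= case3 (ret FINISHED) (push F true >> ret RETURN) (fromChild true AFTER-BODY))

countField : Com 1
countField = repeat (read >>= case6 (ret 1F) (inc I >> move mR >> ret 0F) (ret 1F) (ret 1F) (ret 1F) (ret 1F))

-- State 0: outside of the bags; states 1 and 2: in a bag after no or one member.
wideStep : Fin 3 → Com 5
wideStep 0F = read >>= case6 (go 0F) (go 0F) (go 0F) (go 0F) (go 1F) (ret 3F)
  where go = λ (s : Fin 5) → move mR >> ret s
wideStep 1F = read >>= case6 (go 1F) (go 2F) (go 0F) (go 0F) (go 0F) (ret 3F)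
  where go = λ (s : Fin 5) → move mR >> ret s
wideStep 2F = read >>= case6 (go 2F) (ret 4F) (go 0F) (go 0F) (go 0F) (ret 3F)
  where go = λ (s : Fin 5) → move mR >> ret s

wide : Com 2
wide = loop 3 wideStep 0F

pattern ACCEPT = 0F
pattern REJECT = 1F

sameVertex-steps : Com 2
sameVertex-steps = clear I >> vField >> countField >> uField >> equals I >>= case2 (ret REJECT) (ret ACCEPT)

opaque
  sameVertex : Com 2
  sameVertex = sameVertex-steps

  fold-sameVertex : ∀ {B H σ i τ} → Exec B H sameVertex-steps σ i τ → Exec B H sameVertex σ i τ
  fold-sameVertex p = p

-- `I` holds `n` in binary, and its number of digits becomes the budget: 2 to that power is at least
-- `n`, which bounds the length of a shortest path. The last propagation lets a mark on v, or u
-- being v, set `A`.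
search-steps : Com 2
search-steps = pour I T >> fill F true >> enterBag >>= λ _ → loop 5 searchStep DOWN >> propagate
  >> pop A >>= case3 (ret REJECT) (ret ACCEPT) (ret ACCEPT)

opaque
  search : Com 2
  search = search-steps

  fold-search : ∀ {B H σ i τ} → Exec B H search-steps σ i τ → Exec B H search σ i τ
  fold-search p = p

main-steps : Com 2
main-steps = countField >> wide >>= case2 sameVertex search

opaque
  main : Com 2
  main = main-steps

  fold-main : ∀ {B H σ i τ} → Exec B H main-steps σ i τ → Exec B H main σ i τ
  fold-main p = p

-- Counters, branches and marks

val : List Bool → ℕ
val [] = 0
val (false ∷ l) = val l + val l
val (true ∷ l) = suc (val l + val l)

incL : List Bool → List Bool
incL [] = true ∷ []
incL (false ∷ l) = true ∷ l
incL (true ∷ l) = false ∷ incL l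

decL : List Bool → List Bool
decL [] = []
decL (false ∷ l) = true ∷ decL l
decL (true ∷ l) = false ∷ l

val-incL : ∀ l → val (incL l) ≡ suc (val l)
val-incL [] = refl
val-incL (false ∷ l) = refl
val-incL (true ∷ l) rewrite val-incL l = cong suc (+-suc (val l) (val l))

val-decL : ∀ l {m} → val l ≡ suc m → val (decL l) ≡ m
val-decL (true ∷ l) e = suc-injective e
val-decL (false ∷ l) e with val l in eq
... | suc v rewrite val-decL l eq = trans (sym (+-suc v v)) (suc-injective e)

length-decL : ∀ l → length (decL l) ≡ length l
length-decL [] = refl
length-decL (false ∷ l) = cong suc (length-decL l)
length-decL (true ∷ l) = refl

fills : Bool → List Bool → List Bool → List Bool
fills b [] l = l
fills b (_ ∷ t) l = fills b t (b ∷ l)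

-- The very list that `m` increments produce, not merely one of value `m`, because its length has to
-- be bounded.
cnt : ℕ → List Bool
cnt zero = []
cnt (suc m) = incL (cnt m)

val-cnt : ∀ m → val (cnt m) ≡ m
val-cnt zero = refl
val-cnt (suc m) = trans (val-incL (cnt m)) (cong suc (val-cnt m))

-- Lets a lemma on a few registers be proved once for every choice of them; `mk` fills in the rest
-- of the register file.
record View {m} (rs : Vec Reg m) (mk : Vec (List Bool) m → Regs 13) : Set where
  field
    look : ∀ k v → get (lookup rs k) (mk v) ≡ lookup v k
    upd  : ∀ k l v → set (lookup rs k) l (mk v) ≡ mk (v [ k ]≔ l)

st : (i j e c t w w′ m m′ f d g a : List Bool) → Regs 13
st i j e c t w w′ m m′ f d g a = i , j , e , c , t , w , w′ , m , m′ , f , d , g , a , tt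

sel : Fin 3 → Reg
sel 0F = I
sel 1F = J
sel 2F = E

pick : Fin 3 → (i j e : List Bool) → List Bool
pick 0F i j e = i
pick 1F i j e = j
pick 2F i j e = e

isYes : Bool → Fin 2
isYes false = 0F
isYes true = 1F

-- The control word names the pending calls: first and second are the two calls with a smaller budget,
-- left and right the calls on the children.
data Letter : Set where
  first second left right : Letter

code : Letter → List Bool
code first  = false ∷ false ∷ []
code second = false ∷ true ∷ []
code left   = true ∷ false ∷ []
code right  = true ∷ true ∷ []

codes : List Letter → List Bool
codes = concatMap code

-- The listed bags are those of the proper ancestors of the last tree; its own bag is entered by a
-- separate command.
data Branch {n} : BT n → List Letter → List (Subset n) → BT n → Set where
  here   : ∀ {t} → Branch t [] [] t
  first  : ∀ {t w bs t′} → Branch t w bs t′ → Branch t (first ∷ w) bs t′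
  second : ∀ {t w bs t′} → Branch t w bs t′ → Branch t (second ∷ w) bs t′
  left   : ∀ {b l r w bs t′} → Branch l w bs t′ → Branch (node b l r) (left ∷ w) (b ∷ bs) t′
  right  : ∀ {b l r w bs t′} → Branch r w bs t′ → Branch (node b l r) (right ∷ w) (b ∷ bs) t′

-- Only members of the bag get a bit, which is what brings the space down from `n` to the bag size.
-- In the proofs `S` stays uncompressed so that it can be addressed by vertex.
comp : ∀ {n} → Vec Bool n → Vec Bool n → List Bool
comp [] [] = []
comp (true ∷ B) (x ∷ S) = x ∷ comp B S
comp (false ∷ B) (x ∷ S) = comp B S

orAt : ∀ {n} → ℕ → Bool → Vec Bool n → Vec Bool n → Vec Bool n × Bool
orAt j g [] [] = [] , g
orAt zero g (true ∷ B) (x ∷ S) = ((g ∨ x) ∷ S) , (g ∨ x)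
orAt zero g (false ∷ B) (x ∷ S) = (x ∷ S) , g
orAt (suc j) g (_ ∷ B) (x ∷ S) = map₁ (x ∷_) (orAt j g B S)

length-comp : ∀ {n} (B S S′ : Vec Bool n) → length (comp B S) ≡ length (comp B S′)
length-comp [] [] [] = refl
length-comp (true ∷ B) (x ∷ S) (y ∷ S′) = cong suc (length-comp B S S′)
length-comp (false ∷ B) (x ∷ S) (y ∷ S′) = length-comp B S S′

bits : ∀ {n} → Vec Bool n → List Sym
bits B = map bit (toList B)

bits-noSep : ∀ {n} (B : Vec Bool n) → All (_≢ sSep) (bits B)
bits-noSep [] = []
bits-noSep (true ∷ B) = (λ ()) ∷ bits-noSep B
bits-noSep (false ∷ B) = (λ ()) ∷ bits-noSep B

Levels : ℕ → Set
Levels n = List (Subset n × Subset n)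

flat : ∀ {n} → Levels n → List Bool
flat [] = []
flat ((B , S) ∷ ls) = comp B S ++ flat ls

-- The effect of one `walk` for vertex number `j`, from the root bag down. The Boolean is the
-- content of `G`, so a mark that is found reaches only the bags further down.
walkL : ∀ {n} → ℕ → Bool → Levels n → Levels n × Bool
walkL j g [] = [] , g
walkL j g ((B , S) ∷ ls) = map₁ ((B , proj₁ (orAt j g B S)) ∷_) (walkL j (proj₂ (orAt j g B S)) ls)

bags : ∀ {n} → Levels n → List (Subset n)
bags = map proj₁

bags-walkL : ∀ {n} j g (ls : Levels n) → bags (proj₁ (walkL j g ls)) ≡ bags ls
bags-walkL j g [] = refl
bags-walkL j g ((B , S) ∷ ls) = cong (B ∷_) (bags-walkL j _ ls)

flat-++ : ∀ {n} (ls ls′ : Levels n) → flat (ls ++ ls′) ≡ flat ls ++ flat ls′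
flat-++ [] ls′ = refl
flat-++ ((B , S) ∷ ls) ls′ = trans (cong (comp B S ++_) (flat-++ ls ls′)) (sym (++-assoc (comp B S) _ _))

-- The number of mark bits depends on the bags alone, so the space bound survives every change of
-- marks.
flat-length : ∀ {n} (ls ls′ : Levels n) → bags ls ≡ bags ls′ → length (flat ls) ≡ length (flat ls′)
flat-length [] [] e = refl
flat-length ((B , S) ∷ ls) ((B′ , S′) ∷ ls′) e with refl ← Data.List.Properties.∷-injectiveˡ e =
  trans (length-++ (comp B S)) (trans (cong₂ _+_ (length-comp B S S′) (flat-length ls ls′ (Data.List.Properties.∷-injectiveʳ e)))
    (sym (length-++ (comp B S′))))

walkL-++ : ∀ {n} j g (ls : Levels n) B S →
  walkL j g (ls ++ (B , S) ∷ []) ≡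
  (proj₁ (walkL j g ls) ++ (B , proj₁ (orAt j (proj₂ (walkL j g ls)) B S)) ∷ [] , proj₂ (orAt j (proj₂ (walkL j g ls)) B S))
walkL-++ j g [] B S = refl
walkL-++ j g ((B′ , S′) ∷ ls) B S rewrite walkL-++ j (proj₂ (orAt j g B′ S′)) ls B S = refl

unsnoc : ∀ {n} (ls : Levels n) bs b → bags ls ≡ bs ++ b ∷ [] →
  Σ[ ls₁ ∈ Levels n ] Σ[ S ∈ Subset n ] ls ≡ ls₁ ++ (b , S) ∷ [] × bags ls₁ ≡ bs
unsnoc ((B , S) ∷ []) [] b refl = [] , S , refl , refl
unsnoc ((B , S) ∷ ls) (b′ ∷ bs) b e with unsnoc ls bs b (Data.List.Properties.∷-injectiveʳ e)
... | ls₁ , S′ , refl , e′ = (B , S) ∷ ls₁ , S′ , refl , cong₂ _∷_ (Data.List.Properties.∷-injectiveˡ e) e′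
unsnoc ((B , S) ∷ x ∷ ls) [] b ()
unsnoc [] [] b ()
unsnoc [] (_ ∷ _) b ()

tree-snoc : ∀ {n} (t : BT n) → Σ[ s ∈ List Sym ] encTree t ≡ s ++ sTip ∷ []
tree-snoc tip = [] , refl
tree-snoc (node b l r) with tree-snoc r
... | s , e = sNode ∷ (encSubset b ++ encTree l ++ s) ,
  cong (sNode ∷_) (trans (cong (λ z → encSubset b ++ encTree l ++ z) e)
    (trans (cong (encSubset b ++_) (sym (++-assoc (encTree l) s _))) (sym (++-assoc (encSubset b) _ _))))

ones-noTip : ∀ k → All (_≢ sTip) (encNat k)
ones-noTip zero = (λ ()) ∷ []
ones-noTip (suc k) = (λ ()) ∷ ones-noTip k

All-ʳ++ : ∀ {A : Set} {P : A → Set} {xs ys} → All P xs → All P ys → All P (xs ʳ++ ys)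
All-ʳ++ [] q = q
All-ʳ++ (p ∷ ps) q = All-ʳ++ ps (p ∷ q)

ʳ++-ʳ++ : ∀ {A : Set} (p r s : List A) → (p ʳ++ r) ʳ++ s ≡ r ʳ++ (p ++ s)
ʳ++-ʳ++ p r s = Data.List.Properties.ʳ++-ʳ++ p

ones-∨ : ∀ {n} j (B S : Vec Bool n) → proj₂ (orAt j true B S) ≡ true
ones-∨ j [] [] = refl
ones-∨ zero (true ∷ B) (x ∷ S) = refl
ones-∨ zero (false ∷ B) (x ∷ S) = refl
ones-∨ (suc j) (_ ∷ B) (x ∷ S) = ones-∨ j B S

walkL-true : ∀ {n} j (ls : Levels n) → proj₂ (walkL j true ls) ≡ true
walkL-true j [] = refl
walkL-true j ((B , S) ∷ ls) rewrite ones-∨ j B S = walkL-true j ls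

fresh : ∀ n → Vec Bool n
fresh n = Data.Vec.replicate n false

Has : ∀ {n} → Subset n → Fin n → Set
Has B y = lookup B y ≡ true

orAt-other : ∀ {n} c g (B S : Vec Bool n) z → toℕ z ≢ c → lookup (proj₁ (orAt c g B S)) z ≡ lookup S z
orAt-other zero g (true ∷ B) (x ∷ S) zero ne = ⊥-elim (ne refl)
orAt-other zero g (true ∷ B) (x ∷ S) (suc z) ne = refl
orAt-other zero g (false ∷ B) (x ∷ S) z ne = refl
orAt-other (suc c) g (_ ∷ B) (x ∷ S) zero ne = refl
orAt-other (suc c) g (_ ∷ B) (x ∷ S) (suc z) ne = orAt-other c g B S z (ne ∘ cong suc)

orAt-in : ∀ {n} g (B S : Vec Bool n) y → Has B y →
  lookup (proj₁ (orAt (toℕ y) g B S)) y ≡ g ∨ lookup S y × proj₂ (orAt (toℕ y) g B S) ≡ g ∨ lookup S y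
orAt-in g (true ∷ B) (x ∷ S) zero e = refl , refl
orAt-in g (_ ∷ B) (x ∷ S) (suc y) e = orAt-in g B S y e

orAt-out : ∀ {n} g (B S : Vec Bool n) y → lookup B y ≡ false → orAt (toℕ y) g B S ≡ (S , g)
orAt-out g (false ∷ B) (x ∷ S) zero e = refl
orAt-out g (_ ∷ B) (x ∷ S) (suc y) e rewrite orAt-out g B S y e = refl

Grows : ∀ {n} → Subset n × Subset n → Subset n × Subset n → Set
Grows (B , S) (B′ , S′) = B ≡ B′ × (∀ z → Has S z → Has S′ z)

Grow : ∀ {n} → Levels n → Levels n → Set
Grow = Pointwise Grows

-- A mark in one bag makes a vertex a source, whereas a finished propagation promises marks in all
-- its bags (`Full`). The stronger form is what survives the removal of a bag.
Marked : ∀ {n} → Levels n → Fin n → Set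
Marked ls y = Any (λ (B , S) → Has B y × Has S y) ls

Full : ∀ {n} → Levels n → Fin n → Set
Full ls y = All (λ (B , S) → Has B y → Has S y) ls

grow-refl : ∀ {n} {ls : Levels n} → Grow ls ls
grow-refl {ls = []} = []
grow-refl {ls = l ∷ ls} = (refl , λ _ → id) ∷ grow-refl

grow-trans : ∀ {n} {ls ls′ ls″ : Levels n} → Grow ls ls′ → Grow ls′ ls″ → Grow ls ls″
grow-trans [] [] = []
grow-trans ((refl , f) ∷ p) ((refl , g) ∷ q) = (refl , λ z → g z ∘ f z) ∷ grow-trans p q

grow-bags : ∀ {n} {ls ls′ : Levels n} → Grow ls ls′ → bags ls′ ≡ bags ls
grow-bags [] = refl
grow-bags ((refl , _) ∷ p) = cong (_ ∷_) (grow-bags p)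

marked-grow : ∀ {n} {ls ls′ : Levels n} {y} → Grow ls ls′ → Marked ls y → Marked ls′ y
marked-grow ((refl , f) ∷ p) (here (b , s)) = here (b , f _ s)
marked-grow ((refl , f) ∷ p) (there m) = there (marked-grow p m)

full-grow : ∀ {n} {ls ls′ : Levels n} {y} → Grow ls ls′ → Full ls y → Full ls′ y
full-grow [] [] = []
full-grow ((refl , f) ∷ p) (h ∷ hs) = (λ b → f _ (h b)) ∷ full-grow p hs

orAt-grows : ∀ {n} c g (B S : Vec Bool n) z → Has S z → Has (proj₁ (orAt c g B S)) z
orAt-grows zero g (true ∷ B) (true ∷ S) zero e = Data.Bool.Properties.∨-zeroʳ g
orAt-grows zero g (true ∷ B) (x ∷ S) (suc z) e = e
orAt-grows zero g (false ∷ B) (x ∷ S) z e = e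
orAt-grows (suc c) g (_ ∷ B) (x ∷ S) zero e = e
orAt-grows (suc c) g (_ ∷ B) (x ∷ S) (suc z) e = orAt-grows c g B S z e

walkL-grow : ∀ {n} c g (ls : Levels n) → Grow ls (proj₁ (walkL c g ls))
walkL-grow c g [] = []
walkL-grow c g ((B , S) ∷ ls) = (refl , orAt-grows c g B S) ∷ walkL-grow c _ ls

∨-true : ∀ a b → a ∨ b ≡ true → a ≡ true ⊎ b ≡ true
∨-true true b e = inj₁ refl
∨-true false b e = inj₂ e

∨-left : ∀ {a} b → a ≡ true → a ∨ b ≡ true
∨-left b refl = refl

∨-right : ∀ a {b} → b ≡ true → a ∨ b ≡ true
∨-right true refl = refl
∨-right false refl = refl

walkL-flag : ∀ {n} (y : Fin n) g ls → g ≡ true ⊎ Marked ls y → proj₂ (walkL (toℕ y) g ls) ≡ true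
walkL-flag y g ls (inj₁ refl) = walkL-true (toℕ y) ls
walkL-flag y g ((B , S) ∷ ls) (inj₂ (here (b , s))) =
  walkL-flag y _ ls (inj₁ (trans (proj₂ (orAt-in g B S y b)) (∨-right g s)))
walkL-flag y g ((B , S) ∷ ls) (inj₂ (there m)) = walkL-flag y _ ls (inj₂ m)

walkL-cause : ∀ {n} (y : Fin n) g ls → proj₂ (walkL (toℕ y) g ls) ≡ true → g ≡ true ⊎ Marked ls y
walkL-cause y g [] e = inj₁ e
walkL-cause y g ((B , S) ∷ ls) e with walkL-cause y _ ls e
... | inj₂ m = inj₂ (there m)
... | inj₁ e′ with lookup B y in b
...   | false rewrite orAt-out g B S y b = inj₁ e′
...   | true with ∨-true g (lookup S y) (trans (sym (proj₂ (orAt-in g B S y b))) e′)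
...     | inj₁ e″ = inj₁ e″
...     | inj₂ s = inj₂ (here (b , s))

walkL-full : ∀ {n} (y : Fin n) ls → Full (proj₁ (walkL (toℕ y) true ls)) y
walkL-full y [] = []
walkL-full y ((B , S) ∷ ls) rewrite ones-∨ (toℕ y) B S = (λ b → proj₁ (orAt-in true B S y b)) ∷ walkL-full y ls

walkL-sound : ∀ {n} (y : Fin n) g ls {z} → Marked (proj₁ (walkL (toℕ y) g ls)) z →
  Marked ls z ⊎ (z ≡ y × (g ≡ true ⊎ Marked ls y))
walkL-sound y g ((B , S) ∷ ls) {z} (here (b , s)) with z Data.Fin.≟ y
... | no ne = inj₁ (here (b , trans (sym (orAt-other (toℕ y) g B S z (ne ∘ toℕ-injective))) s))
... | yes refl with ∨-true g (lookup S z) (trans (sym (proj₁ (orAt-in g B S z b))) s)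
...   | inj₁ e = inj₂ (refl , inj₁ e)
...   | inj₂ s′ = inj₁ (here (b , s′))
walkL-sound y g ((B , S) ∷ ls) (there m) with walkL-sound y _ ls m
... | inj₁ m′ = inj₁ (there m′)
... | inj₂ (e , inj₂ m′) = inj₂ (e , inj₂ (there m′))
... | inj₂ (e , inj₁ g′) with lookup B y in b
...   | false rewrite orAt-out g B S y b = inj₂ (e , inj₁ g′)
...   | true with ∨-true g (lookup S y) (trans (sym (proj₂ (orAt-in g B S y b))) g′)
...     | inj₁ e″ = inj₂ (e , inj₁ e″)
...     | inj₂ s = inj₂ (e , inj₂ (here (b , s)))

split-tabulate : ∀ {A : Set} {n} (f : Fin n → A) i →
  Σ[ s ∈ List A ] Σ[ r ∈ List A ] Data.List.tabulate f ≡ s ++ f i ∷ r × length s ≡ toℕ i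
split-tabulate f zero = [] , _ , refl , refl
split-tabulate f (suc i) with split-tabulate (f ∘ suc) i
... | s , r , e , e′ = f zero ∷ s , r , cong (f zero ∷_) e , cong suc e′

length-concatMap : ∀ {A C : Set} (f : A → List C) k → (∀ a → length (f a) ≡ k) → ∀ as → length (concatMap f as) ≡ length as * k
length-concatMap f k h [] = refl
length-concatMap f k h (a ∷ as) = trans (length-++ (f a)) (cong₂ _+_ (h a) (length-concatMap f k h as))

split-bits : ∀ {n} (b : Subset n) (k : Fin n) → Σ[ s ∈ List Sym ] Σ[ r ∈ List Sym ] bits b ≡ s ++ bit (lookup b k) ∷ r × length s ≡ toℕ k
split-bits (x ∷ b) zero = [] , _ , refl , refl
split-bits (x ∷ b) (suc k) with split-bits b k
... | s , r , e , e′ = bit x ∷ s , r , cong (bit x ∷_) e , cong suc e′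

accL : Bool → List Bool
accL true = true ∷ []
accL false = []

≡ᵇ-sound : ∀ {n} (y z : Fin n) → (toℕ y ≡ᵇ toℕ z) ≡ true → y ≡ z
≡ᵇ-sound y z e = toℕ-injective (≡ᵇ⇒≡ (toℕ y) (toℕ z) (subst Data.Bool.T (sym e) tt))

-- Paths in a tree decomposition

data Some {n} (P : Subset n → Set) : BT n → Set where
  atRoot  : ∀ {b l r} → P b → Some P (node b l r)
  left  : ∀ {b l r} → Some P l → Some P (node b l r)
  right : ∀ {b l r} → Some P r → Some P (node b l r)

some-map : ∀ {n} {P Q : Subset n → Set} {t} → (∀ {b} → P b → Q b) → Some P t → Some Q t
some-map f (atRoot p) = atRoot (f p)
some-map f (left s) = left (some-map f s)
some-map f (right s) = right (some-map f s)

Root : ∀ {n} → (Subset n → Set) → BT n → Set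
Root P tip = ⊥
Root P (node b l r) = P b

In : ∀ {n} → Fin n → Subset n → Set
In x b = Has b x

-- The instances of path coherence that an induction on the tree consumes: from a node into a
-- subtree through the child's root, on either side, and from one subtree to the other through the
-- node.
data Coherent {n} : BT n → Set where
  tip  : Coherent tip
  node : ∀ {b l r} →
    (∀ x → Has b x → Some (In x) l → Root (In x) l) →
    (∀ x → Has b x → Some (In x) r → Root (In x) r) →
    (∀ x → Some (In x) l → Some (In x) r → Has b x) →
    Coherent l → Coherent r → Coherent (node b l r)

module Decompose {n} (𝒢 : Digraph n) (u v : Fin n) where

  Both : Fin n → Fin n → Subset n → Set
  Both x z b = Has b x × Has b z

  EdgeIn : BT n → Fin n → Fin n → Set
  EdgeIn t x z = Edge 𝒢 x z × Some (Both x z) t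

  data Path (t : BT n) (x : Fin n) : Fin n → ℕ → Set where
    []  : Path t x x 0
    _▷_ : ∀ {y z m} → Path t x y m → EdgeIn t y z → Path t x z (suc m)

  _▷▷_ : ∀ {t x y z m k} → Path t x y m → Path t y z k → Path t x z (k + m)
  p ▷▷ [] = p
  p ▷▷ (q ▷ e) = (p ▷▷ q) ▷ e

  path-map : ∀ {t t′ x z m} → (∀ {y z} → EdgeIn t y z → EdgeIn t′ y z) → Path t x z m → Path t′ x z m
  path-map f [] = []
  path-map f (p ▷ e) = path-map f p ▷ f e

  path-ends : ∀ {t x z m} → Path t x z m → x ≡ z ⊎ (Some (In x) t × Some (In z) t)
  path-ends [] = inj₁ refl
  path-ends (p ▷ (_ , s)) with path-ends p
  ... | inj₁ refl = inj₂ (some-map proj₁ s , some-map proj₂ s)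
  ... | inj₂ (a , _) = inj₂ (a , some-map proj₂ s)

  -- Membership in a bag to which the endpoints u and v have been added.
  Bnd : Subset n → Fin n → Set
  Bnd b x = (x ≡ u ⊎ x ≡ v) ⊎ Has b x

  bnd? : ∀ b x → Dec (Bnd b x)
  bnd? b x = ((x Data.Fin.≟ u) ⊎-dec (x Data.Fin.≟ v)) ⊎-dec (lookup b x ≟ᵇ true)

  data Segment (b : Subset n) (l r : BT n) (x z : Fin n) : ℕ → Set where
    edge  : Edge 𝒢 x z → Both x z b → Segment b l r x z 1
    left  : ∀ {m} → Path l x z m → Segment b l r x z m
    right : ∀ {m} → Path r x z m → Segment b l r x z m

  data Segments (b : Subset n) (l r : BT n) (x : Fin n) : Fin n → ℕ → Set where
    []  : Segments b l r x x 0
    _▸_ : ∀ {y z m d} → Segments b l r x y m × Bnd b y → Segment b l r y z d → Segments b l r x z (d + m)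

  segment-path : ∀ {b l r x z m} → Segment b l r x z m → Path (node b l r) x z m
  segment-path (edge e s) = [] ▷ (e , atRoot s)
  segment-path (left p) = path-map (λ (e , s) → e , left s) p
  segment-path (right p) = path-map (λ (e , s) → e , right s) p

  segments-path : ∀ {b l r x z m} → Segments b l r x z m → Path (node b l r) x z m
  segments-path [] = []
  segments-path ((p , _) ▸ s) = segments-path p ▷▷ segment-path s

  -- `middle` is the piece that carries the path beyond its first `p` edges, so `short` and `long`
  -- keep both remainders small when `p` is half of the length bound.
  record Split (b : Subset n) (l r : BT n) (x z : Fin n) (p m : ℕ) : Set where
    constructor cut
    field
      {x′ z′} : Fin n
      {m₁ d m₂} : ℕ
      before : Path (node b l r) x x′ m₁
      bnd₁   : Bnd b x′
      middle : Segment b l r x′ z′ d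
      bnd₂   : Bnd b z′
      after  : Path (node b l r) z′ z m₂
      short  : m₁ ≤ p
      long   : p < d + m₁
      length≡ : m₂ + (d + m₁) ≡ m

  split : ∀ {b l r x z m} p → Segments b l r x z m → Bnd b z → m ≤ p ⊎ Split b l r x z p m
  split p [] bz = inj₁ z≤n
  split p (_▸_ {m = m} {d} (ss , by) s) bz with split p ss by
  ... | inj₂ (cut {m₁ = m₁} {d′} {m₂} q b₁ mid b₂ q′ sh lo to) =
        inj₂ (cut q b₁ mid b₂ (q′ ▷▷ segment-path s) sh lo (trans (+-assoc d m₂ _) (cong (d +_) to)))
  ... | inj₁ le with d + m ≤? p
  ...   | yes le′ = inj₁ le′
  ...   | no gt = inj₂ (cut (segments-path ss) by s bz [] le (≰⇒> gt) refl)

  -- Reading a path edge by edge, the current run of vertices outside of the bag lies in one child only.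
  data Open (b : Subset n) (l r : BT n) (x : Fin n) : Fin n → ℕ → Set where
    closed : ∀ {y m} → Segments b l r x y m → Bnd b y → Open b l r x y m
    inLeft : ∀ {y z m d} → Segments b l r x y m → Bnd b y → Path l y z d → Some (In z) l → ¬ Bnd b z → Open b l r x z (d + m)
    inRight : ∀ {y z m d} → Segments b l r x y m → Bnd b y → Path r y z d → Some (In z) r → ¬ Bnd b z → Open b l r x z (d + m)

  -- Changing sides, or using an edge of the bag, requires the current vertex to lie in both
  -- subtrees or in the bag; coherence puts it into the bag in either case, so the run would have
  -- been closed.
  open-path : ∀ {b l r x z m} → Coherent (node b l r) → Path (node b l r) x z m → Bnd b x → Open b l r x z m
  open-path co [] bx = closed [] bx
  open-path {b} co@(node _ _ both _ _) (_▷_ {z = z} p (e , s)) bx with open-path co p bx | s | bnd? b z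
  ... | closed ss by | atRoot s | _ = closed ((ss , by) ▸ edge e s) (inj₂ (proj₂ s))
  ... | closed ss by | left s | yes bz = closed ((ss , by) ▸ left ([] ▷ (e , s))) bz
  ... | closed ss by | left s | no nz = inLeft ss by ([] ▷ (e , s)) (some-map proj₂ s) nz
  ... | closed ss by | right s | yes bz = closed ((ss , by) ▸ right ([] ▷ (e , s))) bz
  ... | closed ss by | right s | no nz = inRight ss by ([] ▷ (e , s)) (some-map proj₂ s) nz
  ... | inLeft ss by q sz ny | atRoot s | _ = ⊥-elim (ny (inj₂ (proj₁ s)))
  ... | inLeft ss by q sz ny | left s | yes bz = closed ((ss , by) ▸ left (q ▷ (e , s))) bz
  ... | inLeft ss by q sz ny | left s | no nz = inLeft ss by (q ▷ (e , s)) (some-map proj₂ s) nz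
  ... | inLeft ss by q sz ny | right s | _ = ⊥-elim (ny (inj₂ (both _ sz (some-map proj₁ s))))
  ... | inRight ss by q sz ny | atRoot s | _ = ⊥-elim (ny (inj₂ (proj₁ s)))
  ... | inRight ss by q sz ny | left s | _ = ⊥-elim (ny (inj₂ (both _ (some-map proj₁ s) sz)))
  ... | inRight ss by q sz ny | right s | yes bz = closed ((ss , by) ▸ right (q ▷ (e , s))) bz
  ... | inRight ss by q sz ny | right s | no nz = inRight ss by (q ▷ (e , s)) (some-map proj₂ s) nz

  segments : ∀ {b l r x z m} → Coherent (node b l r) → Path (node b l r) x z m → Bnd b x → Bnd b z → Segments b l r x z m
  segments co p bx bz with open-path co p bx
  ... | closed ss _ = ss
  ... | inLeft _ _ _ _ nz = ⊥-elim (nz bz)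
  ... | inRight _ _ _ _ nz = ⊥-elim (nz bz)

-- Bounds the rounds of the search below a node with recursion budget s.
weight : ∀ {n} → BT n → ℕ → ℕ
weight-node : ∀ {n} → BT n → BT n → ℕ → ℕ
weight tip s = 0
weight (node b l r) s = weight-node l r s
weight-node l r zero = weight l 0 + weight r 0 + 6
weight-node l r (suc s) = weight-node l r s + weight-node l r s + (weight l (suc s) + weight r (suc s) + 8)

-- The surplus 8 pays for the additive constants of the recurrence. Each of its two or four
-- recursive terms has 8 to spare and is bounded by a power with exponent one less, so their sum
-- stays within the factor 8.
weight-bound : ∀ {n} (t : BT n) s → weight t s + 8 ≤ 8 ^ suc (height t + s)
weight-node-bound : ∀ {n} (l r : BT n) s → weight-node l r s + 8 ≤ 8 ^ suc (suc (height l ⊔ height r) + s)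

8^-mono : ∀ {m n} → m ≤ n → 8 ^ m ≤ 8 ^ n
8^-mono = ^-monoʳ-≤ 8

weight-bound tip s = ^-monoʳ-≤ 8 {1} {suc s} (s≤s z≤n)
weight-bound (node b l r) s = weight-node-bound l r s
weight-node-bound l r zero = begin
  a + c + 6 + 8       ≤⟨ ≤-trans (≤-reflexive (+-assoc (a + c) 6 8)) (+-monoʳ-≤ (a + c) {14} {16} (≤ᵇ⇒≤ 14 16 tt)) ⟩
  a + c + 16          ≡⟨ solve 2 (λ a c → a :+ c :+ con 16 := (a :+ con 8) :+ (c :+ con 8)) refl a c ⟩
  (a + 8) + (c + 8)   ≤⟨ +-mono-≤ (≤-trans (weight-bound l 0) (8^-mono (s≤s (+-monoˡ-≤ 0 (m≤m⊔n (height l) (height r))))))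
                                  (≤-trans (weight-bound r 0) (8^-mono (s≤s (+-monoˡ-≤ 0 (m≤n⊔m (height l) (height r)))))) ⟩
  P + P               ≤⟨ m≤m+n (P + P) (6 * P) ⟩
  P + P + 6 * P       ≡⟨ solve 1 (λ p → p :+ p :+ con 6 :* p := con 8 :* p) refl P ⟩
  8 * P ∎
  where
  open ≤-Reasoning
  open +-*-Solver
  a = weight l 0
  c = weight r 0
  P = 8 ^ suc ((height l ⊔ height r) + 0)
weight-node-bound l r (suc s) = begin
  q + q + (a + c + 8) + 8   ≤⟨ m≤m+n _ 16 ⟩
  q + q + (a + c + 8) + 8 + 16 ≡⟨ solve 3 (λ q a c → q :+ q :+ (a :+ c :+ con 8) :+ con 8 :+ con 16 :=
                                  (q :+ con 8) :+ (q :+ con 8) :+ ((a :+ con 8) :+ (c :+ con 8))) refl q a c ⟩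
  (q + 8) + (q + 8) + ((a + 8) + (c + 8)) ≤⟨ +-mono-≤ (+-mono-≤ hq hq) (+-mono-≤
       (≤-trans (weight-bound l (suc s)) (8^-mono (s≤s (≤-trans (≤-reflexive (+-suc (height l) s)) (s≤s (+-monoˡ-≤ s (m≤m⊔n (height l) (height r))))))))
       (≤-trans (weight-bound r (suc s)) (8^-mono (s≤s (≤-trans (≤-reflexive (+-suc (height r) s)) (s≤s (+-monoˡ-≤ s (m≤n⊔m (height l) (height r))))))))) ⟩
  P + P + (P + P)           ≤⟨ m≤m+n _ (4 * P) ⟩
  P + P + (P + P) + 4 * P   ≡⟨ solve 1 (λ p → p :+ p :+ (p :+ p) :+ con 4 :* p := con 8 :* p) refl P ⟩
  8 * P                     ≡⟨ cong (λ z → 8 ^ suc (suc z)) (sym (+-suc (height l ⊔ height r) s)) ⟩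
  8 ^ suc (suc (height l ⊔ height r) + suc s) ∎
  where
  open ≤-Reasoning
  open +-*-Solver
  q = weight-node l r s
  a = weight l (suc s)
  c = weight r (suc s)
  P = 8 ^ suc (suc ((height l ⊔ height r) + s))
  hq : q + 8 ≤ P
  hq = weight-node-bound l r s

-- Control words along a branch, and coherence derived from positions

childLetter : Bool → Letter
childLetter false = left
childLetter true = right

code-child : ∀ d → code (childLetter d) ≡ true ∷ d ∷ []
code-child false = refl
code-child true = refl

codes-snoc : ∀ w c → codes (w ++ c ∷ []) ≡ codes w ++ code c
codes-snoc w c = trans (concatMap-++ code w _) (cong (codes w ++_) (++-identityʳ (code c)))

branch-first : ∀ {n} {t : BT n} {w bs t′} → Branch t w bs t′ → Branch t (w ++ first ∷ []) bs t′
branch-first here = first here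
branch-first (first p) = first (branch-first p)
branch-first (second p) = second (branch-first p)
branch-first (left p) = left (branch-first p)
branch-first (right p) = right (branch-first p)

branch-second : ∀ {n} {t : BT n} {w bs t′} → Branch t w bs t′ → Branch t (w ++ second ∷ []) bs t′
branch-second here = second here
branch-second (first p) = first (branch-second p)
branch-second (second p) = second (branch-second p)
branch-second (left p) = left (branch-second p)
branch-second (right p) = right (branch-second p)

child : ∀ {n} → Bool → BT n → BT n → BT n
child false l r = l
child true l r = r

branch-child : ∀ {n} {t : BT n} {w bs b l r} d → Branch t w bs (node b l r) →
  Branch t (w ++ childLetter d ∷ []) (bs ++ b ∷ []) (child d l r)
branch-child false here = left here
branch-child true here = right here
branch-child d (first p) = first (branch-child d p)
branch-child d (second p) = second (branch-child d p)
branch-child d (left p) = left (branch-child d p)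
branch-child d (right p) = right (branch-child d p)

data Narrow {n} (K : ℕ) : BT n → Set where
  tip  : Narrow K tip
  node : ∀ {b l r} → ∣ b ∣ ≤ K → Narrow K l → Narrow K r → Narrow K (node b l r)

narrow-root : ∀ {n K b} {l r : BT n} → Narrow K (node b l r) → ∣ b ∣ ≤ K
narrow-root (node p _ _) = p

narrow-left : ∀ {n K b} {l r : BT n} → Narrow K (node b l r) → Narrow K l
narrow-left (node _ p _) = p

narrow-right : ∀ {n K b} {l r : BT n} → Narrow K (node b l r) → Narrow K r
narrow-right (node _ _ p) = p

in-left : ∀ {n b} {l r : BT n} → Coherent (node b l r) → ∀ x → Has b x → Some (In x) l → Root (In x) l
in-left (node p _ _ _ _) = p

in-right : ∀ {n b} {l r : BT n} → Coherent (node b l r) → ∀ x → Has b x → Some (In x) r → Root (In x) r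
in-right (node _ p _ _ _) = p

length-comp-∣∣ : ∀ {n} (b S : Subset n) → length (comp b S) ≡ ∣ b ∣
length-comp-∣∣ [] [] = refl
length-comp-∣∣ (true ∷ b) (x ∷ S) = cong suc (length-comp-∣∣ b S)
length-comp-∣∣ (false ∷ b) (x ∷ S) = length-comp-∣∣ b S

marked-fresh : ∀ {n} (ls : Levels n) b {z} → Marked (ls ++ (b , fresh n) ∷ []) z → Marked ls z
marked-fresh ls b {z} m with Anyₚ.++⁻ ls m
... | inj₁ m′ = m′
... | inj₂ (here (_ , s)) with () ← trans (sym (Vecₚ.lookup-replicate z false)) s

grow-init : ∀ {n} (ls ls′ : Levels n) {p q} → bags ls ≡ bags ls′ → Grow (ls ++ p ∷ []) (ls′ ++ q ∷ []) → Grow ls ls′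
grow-init [] [] e g = []
grow-init (x ∷ ls) (y ∷ ls′) e (h ∷ g) = h ∷ grow-init ls ls′ (∷-injectiveʳ e) g

module _ {n : ℕ} where

  some-at : ∀ {P : Subset n → Set} {t} → Some P t → Σ[ p ∈ Pos ] Σ[ b ∈ Subset n ] At t p b × P b
  some-at (atRoot p) = [] , _ , here , p
  some-at (left s) = let (p , b , at , q) = some-at s in Defs.L ∷ p , b , goL at , q
  some-at (right s) = let (p , b , at , q) = some-at s in Defs.R ∷ p , b , goR at , q

  at-some : ∀ {P : Subset n → Set} {t p b} → At t p b → P b → Some P t
  at-some here q = atRoot q
  at-some (goL at) q = left (at-some at q)
  at-some (goR at) q = right (at-some at q)

  Coherence : BT n → Set
  Coherence t = ∀ {p₁ p₂ p₃ B₁ B₂ B₃} → At t p₁ B₁ → At t p₂ B₂ → At t p₃ B₃ →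
    OnPath p₁ p₂ p₃ → ∀ x → x ∈ B₁ → x ∈ B₂ → x ∈ B₃

  ⊑-∷ : ∀ {p q} d → p ⊑ q → (d ∷ p) ⊑ (d ∷ q)
  ⊑-∷ d (r , e) = r , cong (d ∷_) e

  onPath-L : ∀ {p q r} → OnPath p q r → OnPath (Defs.L ∷ p) (Defs.L ∷ q) (Defs.L ∷ r)
  onPath-L (a , inj₁ b) = ⊑-∷ _ a , inj₁ (⊑-∷ _ b)
  onPath-L (a , inj₂ b) = ⊑-∷ _ a , inj₂ (⊑-∷ _ b)

  onPath-R : ∀ {p q r} → OnPath p q r → OnPath (Defs.R ∷ p) (Defs.R ∷ q) (Defs.R ∷ r)
  onPath-R (a , inj₁ b) = ⊑-∷ _ a , inj₁ (⊑-∷ _ b)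
  onPath-R (a , inj₂ b) = ⊑-∷ _ a , inj₂ (⊑-∷ _ b)

  coherent : ∀ t → Coherence t → Coherent t
  coherent tip co = tip
  coherent (node b l r) co = node
      (λ x h s → go-left l co x h s) (λ x h s → go-right r co x h s)
      (λ x s s′ → let (p , B , at , q) = some-at s ; (p′ , B′ , at′ , q′) = some-at s′ in
        []=⇒lookup (co (goL at) (goR at′) here (([] , refl) , inj₁ (_ , refl)) x (lookup⇒[]= x B q) (lookup⇒[]= x B′ q′)))
      (coherent l (λ a₁ a₂ a₃ op → co (goL a₁) (goL a₂) (goL a₃) (onPath-L op)))
      (coherent r (λ a₁ a₂ a₃ op → co (goR a₁) (goR a₂) (goR a₃) (onPath-R op)))
    where
    go-left : ∀ l → Coherence (node b l r) → ∀ x → Has b x → Some (In x) l → Root (In x) l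
    go-left (node b′ _ _) co x h s = let (p , B , at , q) = some-at s in
      []=⇒lookup (co here (goL at) (goL here) ((_ , refl) , inj₂ (p , refl)) x (lookup⇒[]= x b h) (lookup⇒[]= x B q))
    go-right : ∀ r → Coherence (node b l r) → ∀ x → Has b x → Some (In x) r → Root (In x) r
    go-right (node b′ _ _) co x h s = let (p , B , at , q) = some-at s in
      []=⇒lookup (co here (goR at) (goR here) ((_ , refl) , inj₂ (p , refl)) x (lookup⇒[]= x b h) (lookup⇒[]= x B q))

-- Short paths, small bags and the number of leaves

module Shorten {n} (𝒢 : Digraph n) (u v : Fin n) where

  open Decompose 𝒢 u v

  vertex : ∀ {t x z m} → Path t x z m → Fin (suc m) → Fin n
  vertex {z = z} p zero = z
  vertex (p ▷ e) (suc k) = vertex p k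

  upto : ∀ {t x z m} (p : Path t x z m) k → Path t x (vertex p k) (m ∸ toℕ k)
  upto p zero = p
  upto (p ▷ e) (suc k) = upto p k

  from : ∀ {t x z m} (p : Path t x z m) k → Path t (vertex p k) z (toℕ k)
  from p zero = []
  from (p ▷ e) (suc k) = from p k ▷ e

  -- A path with more than `n` edges repeats a vertex, and the part between two occurrences is cut
  -- out. Positions count from the end of the path, so the larger index `j` is the earlier
  -- occurrence.
  shorten : ∀ fuel {t x z m} → m ≤ fuel → Path t x z m → Σ[ k ∈ ℕ ] k ≤ n × Path t x z k
  shorten fuel {m = m} le p with m ≤? n
  shorten fuel le p | yes m≤n = _ , m≤n , p
  shorten zero z≤n [] | no _ = 0 , z≤n , []
  shorten (suc fuel) {t} {x} {z} {m} le p | no m≰n with pigeonhole (m<n⇒m<1+n (≰⇒> m≰n)) (vertex p)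
  ... | i , j , i<j , e = shorten fuel shorter (upto p j ▷▷ subst (λ y → Path t y z (toℕ i)) e (from p i))
    where
    shorter : toℕ i + (m ∸ toℕ j) ≤ fuel
    shorter = ≤-pred (≤-trans (≤-trans (+-monoˡ-≤ (m ∸ toℕ j) i<j) (≤-reflexive (m+[n∸m]≡n (≤-pred (toℕ<n j))))) le)

  reach-path : ∀ {t} → (∀ x y → Edge 𝒢 x y → Some (Both x y) t) → ∀ {x z} → Reach 𝒢 x z → Σ[ m ∈ ℕ ] Path t x z m
  reach-path cover ε = 0 , []
  reach-path cover (e ◅ es) = let (m , p) = reach-path cover es in _ , ([] ▷ (e , cover _ _ e)) ▷▷ p

  short-path : ∀ {t} → (∀ x y → Edge 𝒢 x y → Some (Both x y) t) → ∀ {x z} → Reach 𝒢 x z → Σ[ m ∈ ℕ ] m ≤ n × Path t x z m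
  short-path cover re = let (m , p) = reach-path cover re in shorten m ≤-refl p

none-small : ∀ {n} (b : Subset n) → ∣ b ∣ ≤ 0 → ∀ x → ¬ Has b x
none-small (false ∷ b) le (suc x) h = none-small b le x h

one-small : ∀ {n} (b : Subset n) → ∣ b ∣ ≤ 1 → ∀ x y → Has b x → Has b y → x ≡ y
one-small (b ∷ bs) le zero zero hx hy = refl
one-small (true ∷ b) (s≤s le) zero (suc y) hx hy = ⊥-elim (none-small b le y hy)
one-small (true ∷ b) (s≤s le) (suc x) zero hx hy = ⊥-elim (none-small b le x hx)
one-small (true ∷ b) (s≤s le) (suc x) (suc y) hx hy = ⊥-elim (none-small b le x hx)
one-small (false ∷ b) le (suc x) (suc y) hx hy = cong suc (one-small b le x y hx hy)

narrow-some : ∀ {n} {t : BT n} {x y} → Narrow 1 t → Some (λ b → Has b x × Has b y) t → x ≡ y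
narrow-some (node {b} le _ _) (atRoot (hx , hy)) = one-small b le _ _ hx hy
narrow-some (node _ nl _) (left s) = narrow-some nl s
narrow-some (node _ _ nr) (right s) = narrow-some nr s

narrow-mono : ∀ {n k k′} {t : BT n} → k ≤ k′ → Narrow k t → Narrow k′ t
narrow-mono le tip = tip
narrow-mono le (node p nl nr) = node (≤-trans p le) (narrow-mono le nl) (narrow-mono le nr)

narrow-width : ∀ {n} (t : BT n) → Narrow (suc (width t)) t
narrow-width tip = tip
narrow-width (node b l r) = node (≤-trans (m≤n+m∸n ∣ b ∣ 1) (s≤s (m≤m⊔n (∣ b ∣ ∸ 1) (width l ⊔ width r))))
  (narrow-mono (s≤s (≤-trans (m≤m⊔n (width l) (width r)) (m≤n⊔m (∣ b ∣ ∸ 1) _))) (narrow-width l))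
  (narrow-mono (s≤s (≤-trans (m≤n⊔m (width l) (width r)) (m≤n⊔m (∣ b ∣ ∸ 1) _))) (narrow-width r))

big : ∀ {n} → Subset n → Bool
big b = 2 ≤ᵇ ∣ b ∣

isWide : ∀ {n} → BT n → Bool
isWide tip = false
isWide (node b l r) = big b ∨ (isWide l ∨ isWide r)

narrow-isWide : ∀ {n} (t : BT n) → isWide t ≡ false → Narrow 1 t
narrow-isWide tip e = tip
narrow-isWide (node b l r) e with big b in eb | isWide l in el | isWide r in er
... | false | false | false = node (≤-pred (≰⇒> (λ le → case≢ (trans (sym eb) (T-≡ (≤⇒≤ᵇ le)))))) (narrow-isWide l el) (narrow-isWide r er)
  where
  T-≡ : ∀ {b} → Data.Bool.T b → b ≡ true
  T-≡ {true} _ = refl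
  case≢ : false ≡ true → ⊥
  case≢ ()

width-isWide : ∀ {n} (t : BT n) → isWide t ≡ true → 1 ≤ width t
width-isWide (node b l r) e with ∨-true (big b) (isWide l ∨ isWide r) e
... | inj₁ eb = ≤-trans (∸-monoˡ-≤ 1 (≤ᵇ⇒≤ 2 ∣ b ∣ (subst Data.Bool.T (sym eb) tt))) (m≤m⊔n (∣ b ∣ ∸ 1) _)
... | inj₂ e′ with ∨-true (isWide l) (isWide r) e′
...   | inj₁ el = ≤-trans (width-isWide l el) (≤-trans (m≤m⊔n (width l) (width r)) (m≤n⊔m (∣ b ∣ ∸ 1) _))
...   | inj₂ er = ≤-trans (width-isWide r er) (≤-trans (m≤n⊔m (width l) (width r)) (m≤n⊔m (∣ b ∣ ∸ 1) _))

tips : ∀ {n} → BT n → ℕ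
tips tip = 1
tips (node b l r) = tips l + tips r

-- Every leaf costs a symbol of the input; together with `balanced-tips` this makes `2 ^ height t`
-- at most the square of the input length.
tips-length : ∀ {n} (t : BT n) → tips t ≤ length (encTree t)
tips-length tip = ≤-refl
tips-length (node b l r) = ≤-trans (+-mono-≤ (tips-length l) (tips-length r))
  (≤-trans (≤-reflexive (sym (length-++ (encTree l)))) (m≤n⇒m≤1+n (≤-trans (m≤n+m _ (length (encSubset b))) (≤-reflexive (sym (length-++ (encSubset b)))))))

-- The smaller of the two subtrees of a balanced tree of height h has height at least h − 2.
balanced-tips : ∀ {n} {t : BT n} → Balanced t → 2 ^ height t ≤ tips t * tips t
balanced-tips tip = ≤-refl
balanced-tips (node {b} {l} {r} bl br hl hr) with ≤-total (tips l) (tips r)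
... | inj₁ le = ≤-trans (^-monoʳ-≤ 2 (s≤s (⊔-lub (n≤1+n (height l)) hr))) (≤-trans (*-monoʳ-≤ 2 (*-monoʳ-≤ 2 (balanced-tips bl))) (quadruple (tips l) (tips r) le))
  where
  quadruple : ∀ a c → a ≤ c → 2 * (2 * (a * a)) ≤ (a + c) * (a + c)
  quadruple a c le = ≤-trans (≤-reflexive (solve 1 (λ a → con 2 :* (con 2 :* (a :* a)) := (a :+ a) :* (a :+ a)) refl a))
      (*-mono-≤ (+-monoʳ-≤ a le) (+-monoʳ-≤ a le))
    where open +-*-Solver
... | inj₂ le = ≤-trans (^-monoʳ-≤ 2 (s≤s (⊔-lub hl (n≤1+n (height r))))) (≤-trans (*-monoʳ-≤ 2 (*-monoʳ-≤ 2 (balanced-tips br))) (quadruple (tips l) (tips r) le))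
  where
  quadruple : ∀ a c → c ≤ a → 2 * (2 * (c * c)) ≤ (a + c) * (a + c)
  quadruple a c le = ≤-trans (≤-reflexive (solve 1 (λ a → con 2 :* (con 2 :* (a :* a)) := (a :+ a) :* (a :+ a)) refl c))
      (*-mono-≤ (+-monoˡ-≤ c le) (+-monoˡ-≤ c le))
    where open +-*-Solver

-- Lengths of counters

-- No leading zeros, the most significant digit being last. This excludes a counter that is longer
-- than the logarithm of its value requires.
data Canonical : List Bool → Set where
  msb : Canonical (true ∷ [])
  _∷_ : ∀ b {l} → Canonical l → Canonical (b ∷ l)

canonical-incL : ∀ {l} → Canonical l → Canonical (incL l)
canonical-incL msb = false ∷ msb
canonical-incL (false ∷ c) = true ∷ c
canonical-incL (true ∷ c) = false ∷ canonical-incL c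

canonical-cnt : ∀ m → Canonical (cnt (suc m))
canonical-cnt zero = msb
canonical-cnt (suc m) = canonical-incL (canonical-cnt m)

canonical-val : ∀ {l} → Canonical l → 2 ^ length l ≤ 2 * val l
canonical-val msb = ≤-refl
canonical-val (_∷_ b {l} c) = *-monoʳ-≤ 2 (≤-trans (canonical-val c) (≤-trans (≤-reflexive (cong (val l +_) (+-identityʳ (val l)))) (double b)))
  where
  double : ∀ b → val l + val l ≤ val (b ∷ l)
  double false = ≤-refl
  double true = n≤1+n _

val-< : ∀ l → val l < 2 ^ length l
val-< [] = s≤s z≤n
val-< (false ∷ l) = ≤-trans (+-mono-≤ (val-< l) (<⇒≤ (val-< l))) (≤-reflexive (cong (2 ^ length l +_) (sym (+-identityʳ _))))
val-< (true ∷ l) = ≤-trans (≤-reflexive (cong suc (sym (+-suc (val l) (val l))))) (≤-trans (+-mono-≤ (val-< l) (val-< l)) (≤-reflexive (cong (2 ^ length l +_) (sym (+-identityʳ _)))))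

cnt-below : ∀ m → m ≤ 2 ^ length (cnt m)
cnt-below m = <⇒≤ (subst (_< 2 ^ length (cnt m)) (val-cnt m) (val-< (cnt m)))

cnt-pow : ∀ m → 2 ^ length (cnt (suc m)) ≤ 2 * suc m
cnt-pow m = subst (λ z → 2 ^ length (cnt (suc m)) ≤ 2 * z) (val-cnt (suc m)) (canonical-val (canonical-cnt m))

2^-cancel : ∀ {a b} → 2 ^ a ≤ 2 ^ b → a ≤ b
2^-cancel {a} {b} le = subst₂ _≤_ (⌊log₂[2^n]⌋≡n a) (⌊log₂[2^n]⌋≡n b) (⌊log₂⌋-mono-≤ le)

cnt-log : ∀ m → length (cnt (suc m)) ≤ suc ⌊log₂ suc m ⌋
cnt-log m = subst₂ _≤_ (⌊log₂[2^n]⌋≡n (length (cnt (suc m)))) (⌊log₂[2*b]⌋≡1+⌊log₂b⌋ (suc m)) (⌊log₂⌋-mono-≤ (cnt-pow m))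

-- Needed for the matrix position `E`, which runs up to the square of the number of vertices.
cnt-square : ∀ n m → m ≤ suc n * suc n → length (cnt m) ≤ 3 + 2 * ⌊log₂ suc n ⌋
cnt-square n zero le = z≤n
cnt-square n (suc m) le = ≤-trans (2^-cancel pow) (s≤s (≤-trans (+-mono-≤ (cnt-log n) (cnt-log n))
    (≤-reflexive (solve 1 (λ g → con 1 :+ g :+ (con 1 :+ g) := con 2 :+ con 2 :* g) refl ⌊log₂ suc n ⌋))))
  where
  open +-*-Solver
  s = length (cnt (suc n))
  pow : 2 ^ length (cnt (suc m)) ≤ 2 ^ suc (s + s)
  pow = ≤-trans (cnt-pow m) (*-monoʳ-≤ 2 (≤-trans le (≤-trans (*-mono-≤ (cnt-below (suc n)) (cnt-below (suc n))) (≤-reflexive (sym (^-distribˡ-+-* 2 s s))))))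

-- Recognising a bag with two members in the encoded input

widens : Fin 3 → List Sym → Bool
widens s [] = false
widens 0F (sNode ∷ r) = widens 1F r
widens 0F (s0 ∷ r) = widens 0F r
widens 0F (s1 ∷ r) = widens 0F r
widens 0F (sSep ∷ r) = widens 0F r
widens 0F (sTip ∷ r) = widens 0F r
widens 1F (s0 ∷ r) = widens 1F r
widens 1F (s1 ∷ r) = widens 2F r
widens 1F (sSep ∷ r) = widens 0F r
widens 1F (sTip ∷ r) = widens 0F r
widens 1F (sNode ∷ r) = widens 0F r
widens 2F (s0 ∷ r) = widens 2F r
widens 2F (s1 ∷ r) = true
widens 2F (sSep ∷ r) = widens 0F r
widens 2F (sTip ∷ r) = widens 0F r
widens 2F (sNode ∷ r) = widens 0F r

-- The scan may run over the whole input, because only `sNode` opens a bag and it occurs in encoded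
-- trees alone.
widens-skip : ∀ s r → All (_≢ sNode) s → widens 0F (s ++ r) ≡ widens 0F r
widens-skip [] r [] = refl
widens-skip (s0 ∷ s) r (_ ∷ ne) = widens-skip s r ne
widens-skip (s1 ∷ s) r (_ ∷ ne) = widens-skip s r ne
widens-skip (sSep ∷ s) r (_ ∷ ne) = widens-skip s r ne
widens-skip (sTip ∷ s) r (_ ∷ ne) = widens-skip s r ne
widens-skip (sNode ∷ s) r (n ∷ ne) = ⊥-elim (n refl)

widens-bag2 : ∀ {n} (b : Subset n) r → widens 2F (bits b ++ sSep ∷ r) ≡ (1 ≤ᵇ ∣ b ∣) ∨ widens 0F r
widens-bag2 [] r = refl
widens-bag2 (true ∷ b) r = refl
widens-bag2 (false ∷ b) r = widens-bag2 b r

widens-bag : ∀ {n} (b : Subset n) r → widens 1F (bits b ++ sSep ∷ r) ≡ big b ∨ widens 0F r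
widens-bag [] r = refl
widens-bag (true ∷ b) r = trans (widens-bag2 b r) (cong (_∨ widens 0F r) (positive ∣ b ∣))
  where
  positive : ∀ m → (1 ≤ᵇ m) ≡ (2 ≤ᵇ suc m)
  positive zero = refl
  positive (suc m) = refl
widens-bag (false ∷ b) r = widens-bag b r

widens-tree : ∀ {n} (t : BT n) r → widens 0F (encTree t ++ r) ≡ isWide t ∨ widens 0F r
widens-tree tip r = refl
widens-tree (node b l r′) r = begin
  widens 1F ((encSubset b ++ encTree l ++ encTree r′) ++ r) ≡⟨ cong (widens 1F) (trans (++-assoc (encSubset b) _ r)
       (trans (++-assoc (bits b) _ _) (cong (λ z → bits b ++ sSep ∷ z) (++-assoc (encTree l) _ r)))) ⟩
  widens 1F (bits b ++ sSep ∷ encTree l ++ encTree r′ ++ r) ≡⟨ widens-bag b _ ⟩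
  big b ∨ widens 0F (encTree l ++ encTree r′ ++ r)          ≡⟨ cong (big b ∨_) (widens-tree l _) ⟩
  big b ∨ (isWide l ∨ widens 0F (encTree r′ ++ r))          ≡⟨ cong (λ z → big b ∨ (isWide l ∨ z)) (widens-tree r′ r) ⟩
  big b ∨ (isWide l ∨ (isWide r′ ∨ widens 0F r))            ≡⟨ cong (big b ∨_) (sym (∨-assoc (isWide l) _ _)) ⟩
  big b ∨ ((isWide l ∨ isWide r′) ∨ widens 0F r)            ≡⟨ sym (∨-assoc (big b) _ _) ⟩
  (big b ∨ (isWide l ∨ isWide r′)) ∨ widens 0F r ∎
  where
  open ≡-Reasoning

ones-noNode : ∀ k → All (_≢ sNode) (encNat k)
ones-noNode zero = (λ ()) ∷ []
ones-noNode (suc k) = (λ ()) ∷ ones-noNode k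

fills-trues : ∀ t k → fills true t (replicate k true) ≡ replicate (length t + k) true
fills-trues [] k = refl
fills-trues (_ ∷ t) k = trans (fills-trues t (suc k)) (cong (λ z → replicate z true) (+-suc (length t) k))

counted : List Bool → Regs 13
counted i = st i [] [] [] [] [] [] [] [] [] [] [] []

verdictIx : Bool → Fin 2
verdictIx true = ACCEPT
verdictIx false = REJECT

-- Executions of the program, with loops of at most B rounds and stacks of at most H bits

module Registers (B H : ℕ) (H<B : H < B) where

  Ex : ∀ {n} → Com n → State 13 → Fin n → State 13 → Set
  Ex = Exec B H

  Rep : ∀ {n} → Com (suc n) → State 13 → Fin n → State 13 → ℕ → Set
  Rep c = Loop B H {a = 1} (λ _ → c) 0F

  stop : ∀ {n} {c : Com (suc n)} {σ j τ} → Ex c σ (suc j) τ → Rep c σ j τ 1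
  stop p = done p refl

  more : ∀ {n} {c : Com (suc n)} {σ τ j υ t} → Ex c σ 0F τ → Rep c τ j υ t → Rep c σ j υ (suc t)
  more p q = again p refl q

  infixr 6 _⨾_
  _⨾_ : ∀ {m n} {c : Com m} {f : Fin m → Com n} {σ i τ j υ} → Ex c σ i τ → Ex (f i) τ j υ → Ex (bind c f) σ j υ
  _⨾_ = bind

  private variable
    h : Head
    i j e c t w w′ m m′ f d g a : List Bool

  module _ {k} {rs : Vec Reg k} {mk} (V : View rs mk) where
    open View V

    vpop : ∀ i v → Ex (pop (lookup rs i)) (h , mk v) (topIx (lookup v i)) (h , mk (v [ i ]≔ tail (lookup v i)))
    vpop {h} i v = subst₂ (λ l ρ → Ex (pop (lookup rs i)) (h , mk v) (topIx l) (h , ρ)) (look i v)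
      (trans (cong (λ l → set (lookup rs i) (tail l) (mk v)) (look i v)) (upd i _ v)) pop

    vpush : ∀ i b v → length (lookup v i) < H →
      Ex (push (lookup rs i) b) (h , mk v) 0F (h , mk (v [ i ]≔ (b ∷ lookup v i)))
    vpush {h} i b v lt = subst (λ ρ → Ex (push (lookup rs i) b) (h , mk v) 0F (h , ρ))
      (trans (cong (λ l → set (lookup rs i) (b ∷ l) (mk v)) (look i v)) (upd i _ v))
      (push (subst (λ l → length l < H) (sym (look i v)) lt))

  count : ∀ (l : List Bool) → length l ≤ H → suc (length l) ≤ B
  count l le = ≤-trans (s≤s le) H<B

  clear-ex : ∀ {r mk} → View (r ∷ []) mk → ∀ l → length l ≤ H → Ex (clear r) (h , mk (l ∷ [])) 0F (h , mk ([] ∷ []))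
  clear-ex {h} {r} {mk} V l le = loop (go l) (count l le)
    where
    go : ∀ l → Rep {1} (pop r >>= case3 (ret 1F) (ret 0F) (ret 0F)) (h , mk (l ∷ [])) 0F (h , mk ([] ∷ [])) (suc (length l))
    go [] = stop (vpop V 0F _ ⨾ ret)
    go (false ∷ l) = more (vpop V 0F _ ⨾ ret) (go l)
    go (true ∷ l) = more (vpop V 0F _ ⨾ ret) (go l)

  module _ {r s mk} (V : View (r ∷ s ∷ []) mk) where

    pour-ex : ∀ l n → length l + length n ≤ H → Ex (pour r s) (h , mk (l ∷ n ∷ [])) 0F (h , mk ([] ∷ (l ʳ++ n) ∷ []))
    pour-ex {h} l n le = loop (go l n le) (count l (m+n≤o⇒m≤o (length l) le))
      where
      go : ∀ l n → length l + length n ≤ H →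
        Rep {1} (pop r >>= case3 (ret 1F) (push s false >> ret 0F) (push s true >> ret 0F))
            (h , mk (l ∷ n ∷ [])) 0F (h , mk ([] ∷ (l ʳ++ n) ∷ [])) (suc (length l))
      go [] n le = stop (vpop V 0F _ ⨾ ret)
      go (false ∷ l) n le = more (vpop V 0F _ ⨾ vpush V 1F false _ (m+n≤o⇒n≤o (length l) le′) ⨾ ret) (go l (false ∷ n) le′)
        where le′ = subst (_≤ H) (sym (+-suc (length l) (length n))) le
      go (true ∷ l) n le = more (vpop V 0F _ ⨾ vpush V 1F true _ (m+n≤o⇒n≤o (length l) le′) ⨾ ret) (go l (true ∷ n) le′)
        where le′ = subst (_≤ H) (sym (+-suc (length l) (length n))) le

  module _ {r mk} (V : View (r ∷ T ∷ []) mk) where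

    fill-ex : ∀ b l n → length n + length l ≤ H → Ex (fill r b) (h , mk (l ∷ n ∷ [])) 0F (h , mk (fills b n l ∷ [] ∷ []))
    fill-ex {h} b l n le = loop (go l n le) (count n (m+n≤o⇒m≤o (length n) le))
      where
      go : ∀ l n → length n + length l ≤ H →
        Rep {1} (pop T >>= case3 (ret 1F) (push r b >> ret 0F) (push r b >> ret 0F))
            (h , mk (l ∷ n ∷ [])) 0F (h , mk (fills b n l ∷ [] ∷ [])) (suc (length n))
      go l [] le = stop (vpop V 1F _ ⨾ ret)
      go l (false ∷ n) le = more (vpop V 1F _ ⨾ vpush V 0F b _ (m+n≤o⇒n≤o (length n) le′) ⨾ ret) (go (b ∷ l) n le′)
        where le′ = subst (_≤ H) (sym (+-suc (length n) (length l))) le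
      go l (true ∷ n) le = more (vpop V 1F _ ⨾ vpush V 0F b _ (m+n≤o⇒n≤o (length n) le′) ⨾ ret) (go (b ∷ l) n le′)
        where le′ = subst (_≤ H) (sym (+-suc (length n) (length l))) le

    inc-ex : ∀ l → length l < B → length (incL l) ≤ H → Ex (inc r) (h , mk (l ∷ [] ∷ [])) 0F (h , mk (incL l ∷ [] ∷ []))
    inc-ex {h} l lt le with carry l [] (≤-trans (≤-reflexive (+-identityʳ _)) le)
      where
      -- Ones parked on `T` come back as zeros; the invariant compares the stacks as they will be
      -- after this refilling.
      carry : ∀ l n → length (incL l) + length n ≤ H → Σ[ l′ ∈ List Bool ] Σ[ n′ ∈ List Bool ] Σ[ t ∈ ℕ ]
        Rep {1} (pop r >>= case3 (push r true >> ret 1F) (push r true >> ret 1F) (push T true >> ret 0F))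
          (h , mk (l ∷ n ∷ [])) 0F (h , mk (l′ ∷ n′ ∷ [])) t × t ≤ suc (length l)
        × fills false n′ l′ ≡ fills false n (incL l) × length n′ + length l′ ≤ H
      carry [] n le = _ , n , _ , stop (vpop V 0F _ ⨾ vpush V 0F true _ (m+n≤o⇒m≤o 1 le) ⨾ ret) , s≤s z≤n , refl ,
        ≤-trans (≤-reflexive (+-comm (length n) 1)) le
      carry (false ∷ l) n le = _ , n , _ , stop (vpop V 0F _ ⨾ vpush V 0F true _ (m+n≤o⇒m≤o _ le) ⨾ ret) , s≤s z≤n , refl ,
        ≤-trans (≤-reflexive (+-comm (length n) _)) le
      carry (true ∷ l) n le with carry l (true ∷ n) le′
        where le′ = subst (_≤ H) (sym (+-suc (length (incL l)) (length n))) le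
      ... | l′ , n′ , t , p , t≤ , eq , le″ = l′ , n′ , _ ,
        more (vpop V 0F _ ⨾ vpush V 1F true _ (m+n≤o⇒n≤o (length (incL l)) (subst (_≤ H) (sym (+-suc (length (incL l)) (length n))) le)) ⨾ ret) p , s≤s t≤ , eq , le″
    ... | l′ , n′ , t , p , t≤ , eq , le′ = loop p (≤-trans t≤ lt) ⨾
          subst (λ z → Ex (fill r false) (h , mk (l′ ∷ n′ ∷ [])) 0F (h , mk (z ∷ [] ∷ []))) eq (fill-ex false l′ n′ le′)

  viewC : View (C ∷ []) (λ v → st i j e (lookup v 0F) t w w′ m m′ f d g a)
  viewC = record { look = λ { 0F v → refl } ; upd = λ { 0F l (_ ∷ []) → refl } }

  viewT : View (T ∷ []) (λ v → st i j e c (lookup v 0F) w w′ m m′ f d g a)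
  viewT = record { look = λ { 0F v → refl } ; upd = λ { 0F l (_ ∷ []) → refl } }

  viewCT : View (C ∷ T ∷ []) (λ v → st i j e (lookup v 0F) (lookup v 1F) w w′ m m′ f d g a)
  viewCT = record { look = λ { 0F v → refl ; 1F v → refl }
                  ; upd = λ { 0F l (_ ∷ _ ∷ []) → refl ; 1F l (_ ∷ _ ∷ []) → refl } }

  viewIT : View (I ∷ T ∷ []) (λ v → st (lookup v 0F) j e c (lookup v 1F) w w′ m m′ f d g a)
  viewIT = record { look = λ { 0F v → refl ; 1F v → refl }
                  ; upd = λ { 0F l (_ ∷ _ ∷ []) → refl ; 1F l (_ ∷ _ ∷ []) → refl } }

  viewJT : View (J ∷ T ∷ []) (λ v → st i (lookup v 0F) e c (lookup v 1F) w w′ m m′ f d g a)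
  viewJT = record { look = λ { 0F v → refl ; 1F v → refl }
                  ; upd = λ { 0F l (_ ∷ _ ∷ []) → refl ; 1F l (_ ∷ _ ∷ []) → refl } }

  viewET : View (E ∷ T ∷ []) (λ v → st i j (lookup v 0F) c (lookup v 1F) w w′ m m′ f d g a)
  viewET = record { look = λ { 0F v → refl ; 1F v → refl }
                  ; upd = λ { 0F l (_ ∷ _ ∷ []) → refl ; 1F l (_ ∷ _ ∷ []) → refl } }

  viewWW′ : View (W ∷ W′ ∷ []) (λ v → st i j e c t (lookup v 0F) (lookup v 1F) m m′ f d g a)
  viewWW′ = record { look = λ { 0F v → refl ; 1F v → refl }
                   ; upd = λ { 0F l (_ ∷ _ ∷ []) → refl ; 1F l (_ ∷ _ ∷ []) → refl } }

  viewMM′ : View (Mk ∷ Mk′ ∷ []) (λ v → st i j e c t w w′ (lookup v 0F) (lookup v 1F) f d g a)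
  viewMM′ = record { look = λ { 0F v → refl ; 1F v → refl }
                   ; upd = λ { 0F l (_ ∷ _ ∷ []) → refl ; 1F l (_ ∷ _ ∷ []) → refl } }

  viewA : View (A ∷ []) (λ v → st i j e c t w w′ m m′ f d g (lookup v 0F))
  viewA = record { look = λ { 0F v → refl } ; upd = λ { 0F l (_ ∷ []) → refl } }

  viewI : View (I ∷ []) (λ v → st (lookup v 0F) j e c t w w′ m m′ f d g a)
  viewI = record { look = λ { 0F v → refl } ; upd = λ { 0F l (_ ∷ []) → refl } }

  viewJ : View (J ∷ []) (λ v → st i (lookup v 0F) e c t w w′ m m′ f d g a)
  viewJ = record { look = λ { 0F v → refl } ; upd = λ { 0F l (_ ∷ []) → refl } }

  viewE : View (E ∷ []) (λ v → st i j (lookup v 0F) c t w w′ m m′ f d g a)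
  viewE = record { look = λ { 0F v → refl } ; upd = λ { 0F l (_ ∷ []) → refl } }

  viewG : View (G ∷ []) (λ v → st i j e c t w w′ m m′ f d (lookup v 0F) a)
  viewG = record { look = λ { 0F v → refl } ; upd = λ { 0F l (_ ∷ []) → refl } }

  module _ {h : Head} where

    dec-zero : ∀ l → val l ≡ 0 → length l ≤ H →
      Ex dec (h , st i j e l [] w w′ m m′ f d g a) 1F (h , st i j e [] [] w w′ m m′ f d g a)
    dec-zero l z le with go l [] z (subst (_≤ H) (sym (+-identityʳ _)) le)
      where
      go : ∀ l n → val l ≡ 0 → length l + length n ≤ H → Σ[ n′ ∈ List Bool ] length n′ ≤ H ×
        Rep {2} (pop C >>= case3 (ret 2F) (push T true >> ret 0F) (push C false >> ret 1F))
          (h , st i j e l n w w′ m m′ f d g a) 1F (h , st i j e [] n′ w w′ m m′ f d g a) (suc (length l))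
      go [] n z le = n , le , stop (pop ⨾ ret)
      go (false ∷ l) n z le with go l (true ∷ n) (m+n≡0⇒m≡0 (val l) z) (subst (_≤ H) (sym (+-suc (length l) (length n))) le)
      ... | n′ , le′ , p = n′ , le′ , more (pop ⨾ push (m+n≤o⇒n≤o (length l) (subst (_≤ H) (sym (+-suc (length l) (length n))) le)) ⨾ ret) p
    ... | n′ , le′ , p = loop p (count l le) ⨾ clear-ex viewT n′ le′ ⨾ ret

    dec-suc : ∀ l {v} → val l ≡ suc v → length l ≤ H →
      Ex dec (h , st i j e l [] w w′ m m′ f d g a) 0F (h , st i j e (decL l) [] w w′ m m′ f d g a)
    dec-suc {i} {j} {e} {w} {w′} {m} {m′} {f} {d} {g} {a} l z le with go l [] z (subst (_≤ H) (sym (+-identityʳ _)) le)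
      where
      go : ∀ l n {v} → val l ≡ suc v → length l + length n ≤ H → Σ[ l′ ∈ List Bool ] Σ[ n′ ∈ List Bool ] Σ[ t ∈ ℕ ]
        Rep {2} (pop C >>= case3 (ret 2F) (push T true >> ret 0F) (push C false >> ret 1F))
          (h , st i j e l n w w′ m m′ f d g a) 0F (h , st i j e l′ n′ w w′ m m′ f d g a) t
        × t ≤ suc (length l) × fills true n′ l′ ≡ fills true n (decL l) × length n′ + length l′ ≤ H
      go (true ∷ l) n z le = _ , n , _ , stop (pop ⨾ push (m+n≤o⇒m≤o _ le) ⨾ ret) , s≤s z≤n , refl ,
        ≤-trans (≤-reflexive (+-comm (length n) _)) le
      go (false ∷ l) n z le with val l in eq
      ... | suc v with go l (true ∷ n) eq (subst (_≤ H) (sym (+-suc (length l) (length n))) le)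
      ... | l′ , n′ , t , p , t≤ , eq , le′ = l′ , n′ , _ ,
          more (pop ⨾ push (m+n≤o⇒n≤o (length l) (subst (_≤ H) (sym (+-suc (length l) (length n))) le)) ⨾ ret) p , s≤s t≤ , eq , le′
    ... | l′ , n′ , t , p , t≤ , eq , le′ = loop p (≤-trans t≤ (count l le)) ⨾
          subst (λ z → Ex (fill C true) (h , st i j e l′ n′ w w′ m m′ f d g a) 0F (h , st i j e z [] w w′ m m′ f d g a))
            eq (fill-ex viewCT true l′ n′ le′) ⨾ ret

  copy-view : ∀ {r mk} → View (r ∷ C ∷ T ∷ []) mk → View (r ∷ T ∷ []) (λ v → mk (lookup v 0F ∷ [] ∷ lookup v 1F ∷ [])) →
    ∀ l → length l ≤ H → Ex (copy r) (h , mk (l ∷ [] ∷ [] ∷ [])) 0F (h , mk (l ∷ l ∷ [] ∷ []))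
  copy-view {h} {r} {mk} V V₂ l le = pour-ex V₂ l [] le₀ ⨾
      loop (subst₂ (λ p q → Rep {1} _ (h , mk ([] ∷ [] ∷ (l ʳ++ []) ∷ [])) 0F (h , mk (p ∷ q ∷ [] ∷ [])) (suc (length (l ʳ++ []))))
             (rev-rev l) (rev-rev l) (go (l ʳ++ []) [] [] le₁ le₁))
           (count (l ʳ++ []) (m+n≤o⇒m≤o _ le₁))
    where
    rev-rev : ∀ (l : List Bool) → (l ʳ++ []) ʳ++ [] ≡ l
    rev-rev l = Data.List.Properties.reverse-involutive l
    le₀ = subst (_≤ H) (sym (+-identityʳ _)) le
    le₁ : length (l ʳ++ []) + 0 ≤ H
    le₁ = subst (_≤ H) (sym (trans (+-identityʳ _) (length-ʳ++′ l []))) le₀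
    go : ∀ n p q → length n + length p ≤ H → length n + length q ≤ H →
      Rep {1} (pop T >>= case3 (ret 1F) (push r false >> push C false >> ret 0F) (push r true >> push C true >> ret 0F))
        (h , mk (p ∷ q ∷ n ∷ [])) 0F (h , mk ((n ʳ++ p) ∷ (n ʳ++ q) ∷ [] ∷ [])) (suc (length n))
    go [] p q a b = stop (vpop V 2F _ ⨾ ret)
    go (false ∷ n) p q a b = more (vpop V 2F _ ⨾ (vpush V 0F false _ (m+n≤o⇒n≤o (length n) a′) ⨾ vpush V 1F false _ (m+n≤o⇒n≤o (length n) b′)) ⨾ ret)
                                  (go n _ _ a′ b′)
      where a′ = subst (_≤ H) (sym (+-suc (length n) (length p))) a
            b′ = subst (_≤ H) (sym (+-suc (length n) (length q))) b
    go (true ∷ n) p q a b = more (vpop V 2F _ ⨾ (vpush V 0F true _ (m+n≤o⇒n≤o (length n) a′) ⨾ vpush V 1F true _ (m+n≤o⇒n≤o (length n) b′)) ⨾ ret)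
                                 (go n _ _ a′ b′)
      where a′ = subst (_≤ H) (sym (+-suc (length n) (length p))) a
            b′ = subst (_≤ H) (sym (+-suc (length n) (length q))) b

  copy-ex : ∀ q → length (pick q i j e) ≤ H →
    Ex (copy (sel q)) (h , st i j e [] [] w w′ m m′ f d g a) 0F (h , st i j e (pick q i j e) [] w w′ m m′ f d g a)
  copy-ex {i} {j} {e} {h} {w} {w′} {m} {m′} {f} {d} {g} {a} 0F =
    copy-view {mk = λ v → st (lookup v 0F) j e (lookup v 1F) (lookup v 2F) w w′ m m′ f d g a}
      (record { look = λ { 0F v → refl ; 1F v → refl ; 2F v → refl }
              ; upd = λ { 0F l (_ ∷ _ ∷ _ ∷ []) → refl ; 1F l (_ ∷ _ ∷ _ ∷ []) → refl ; 2F l (_ ∷ _ ∷ _ ∷ []) → refl } })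
      viewIT i
  copy-ex {i} {j} {e} {h} {w} {w′} {m} {m′} {f} {d} {g} {a} 1F =
    copy-view {mk = λ v → st i (lookup v 0F) e (lookup v 1F) (lookup v 2F) w w′ m m′ f d g a}
      (record { look = λ { 0F v → refl ; 1F v → refl ; 2F v → refl }
              ; upd = λ { 0F l (_ ∷ _ ∷ _ ∷ []) → refl ; 1F l (_ ∷ _ ∷ _ ∷ []) → refl ; 2F l (_ ∷ _ ∷ _ ∷ []) → refl } })
      viewJT j
  copy-ex {i} {j} {e} {h} {w} {w′} {m} {m′} {f} {d} {g} {a} 2F =
    copy-view {mk = λ v → st i j (lookup v 0F) (lookup v 1F) (lookup v 2F) w w′ m m′ f d g a}
      (record { look = λ { 0F v → refl ; 1F v → refl ; 2F v → refl }
              ; upd = λ { 0F l (_ ∷ _ ∷ _ ∷ []) → refl ; 1F l (_ ∷ _ ∷ _ ∷ []) → refl ; 2F l (_ ∷ _ ∷ _ ∷ []) → refl } })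
      viewET e

  seek-ex : ∀ q (p : List Sym) s r → val (pick q i j e) ≡ length s → length (pick q i j e) ≤ H → length s < B →
    Ex (seek (sel q)) ((p , s ++ r) , st i j e [] [] w w′ m m′ f d g a) 0F
                      ((s ʳ++ p , r) , st i j e [] [] w w′ m m′ f d g a)
  seek-ex {i} {j} {e} {w} {w′} {m} {m′} {f} {d} {g} {a} q p s r v le lt = copy-ex q le ⨾ loop (go (pick q i j e) p s v le) lt
    where
    go : ∀ l p s → val l ≡ length s → length l ≤ H →
      Rep (dec >>= case2 (move mR >> ret 0F) (ret 1F)) ((p , s ++ r) , st i j e l [] w w′ m m′ f d g a) 0F
                      ((s ʳ++ p , r) , st i j e [] [] w w′ m m′ f d g a) (suc (length s))
    go l p [] v le = stop (dec-zero l v le ⨾ ret)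
    go l p (y ∷ s) v le = more (dec-suc l v le ⨾ move ⨾ ret)
      (go (decL l) (y ∷ p) s (val-decL l v) (subst (_≤ H) (sym (length-decL l)) le))

  -- Where the head stops depends on the outcome. It is only claimed to be on the input, as the
  -- routines that follow find their own position.
  equals-ex : ∀ q p n r → length (pick q i j e) ≤ H → n < B →
    Σ[ h ∈ Head ] h On (p ʳ++ (encNat n ++ r)) ×
    Ex (equals (sel q)) ((p , encNat n ++ r) , st i j e [] [] w w′ m m′ f d g a) (isYes (val (pick q i j e) ≡ᵇ n))
                      (h , st i j e [] [] w w′ m m′ f d g a)
  equals-ex {i} {j} {e} {w} {w′} {m} {m′} {f} {d} {g} {a} q p n r le lt with go (pick q i j e) p n le
    where
    go : ∀ l p n → length l ≤ H → Σ[ h ∈ Head ] Σ[ l′ ∈ List Bool ] Σ[ t ∈ ℕ ] h On (p ʳ++ (encNat n ++ r)) ×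
      length l′ ≤ H × t ≤ suc n ×
      Rep (dec >>= case2
            (read >>= case6 (ret 1F) (move mR >> ret 0F) (ret 1F) (ret 1F) (ret 1F) (ret 1F))
            (read >>= case6 (ret 2F) (ret 1F) (ret 2F) (ret 2F) (ret 2F) (ret 2F)))
          ((p , encNat n ++ r) , st i j e l [] w w′ m m′ f d g a) (isYes (val l ≡ᵇ n))
          (h , st i j e l′ [] w w′ m m′ f d g a) t
    go l p zero le with val l in v
    ... | zero = _ , [] , _ , refl , z≤n , ≤-refl , stop (dec-zero l v le ⨾ read ⨾ ret)
    ... | suc _ = _ , _ , _ , refl , subst (_≤ H) (sym (length-decL l)) le , ≤-refl , stop (dec-suc l v le ⨾ read ⨾ ret)
    go l p (suc n) le with val l in v
    ... | zero = _ , [] , _ , refl , z≤n , s≤s z≤n , stop (dec-zero l v le ⨾ read ⨾ ret)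
    ... | suc u with go (decL l) (s1 ∷ p) n (subst (_≤ H) (sym (length-decL l)) le)
    ...   | h , l′ , t , on , le′ , t≤ , ps rewrite val-decL l v = h , l′ , _ , on , le′ , s≤s t≤ ,
            more (dec-suc l v le ⨾ read ⨾ move ⨾ ret) ps
  ... | h , l′ , t , on , le′ , t≤ , ps = h , on , (copy-ex q le ⨾ loop ps (≤-trans t≤ lt)) ⨾ clear-ex viewC l′ le′ ⨾ ret

  skipSep-ex : ∀ {ρ} p s r → All (_≢ sSep) s → length s < B →
    Ex skipSep ((p , s ++ sSep ∷ r) , ρ) 0F ((sSep ∷ (s ʳ++ p) , r) , ρ)
  skipSep-ex {ρ} p s r ne lt = loop (go p s ne) lt
    where
    go : ∀ p s → All (_≢ sSep) s → Rep _ ((p , s ++ sSep ∷ r) , ρ) 0F ((sSep ∷ (s ʳ++ p) , r) , ρ) (suc (length s))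
    go p [] [] = stop (read ⨾ move ⨾ ret)
    go p (s0 ∷ s) (_ ∷ ne) = more (read ⨾ move ⨾ ret) (go _ s ne)
    go p (s1 ∷ s) (_ ∷ ne) = more (read ⨾ move ⨾ ret) (go _ s ne)
    go p (sSep ∷ s) (n ∷ ne) = ⊥-elim (n refl)
    go p (sTip ∷ s) (_ ∷ ne) = more (read ⨾ move ⨾ ret) (go _ s ne)
    go p (sNode ∷ s) (_ ∷ ne) = more (read ⨾ move ⨾ ret) (go _ s ne)

  toEnd-ex : ∀ {ρ} p r → length r < B → Ex toEnd ((p , r) , ρ) 0F ((r ʳ++ p , []) , ρ)
  toEnd-ex {ρ} p r lt = loop (go p r) lt
    where
    go : ∀ p r → Rep _ ((p , r) , ρ) 0F ((r ʳ++ p , []) , ρ) (suc (length r))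
    go p [] = stop (read ⨾ ret)
    go p (s0 ∷ r) = more (read ⨾ move ⨾ ret) (go _ r)
    go p (s1 ∷ r) = more (read ⨾ move ⨾ ret) (go _ r)
    go p (sSep ∷ r) = more (read ⨾ move ⨾ ret) (go _ r)
    go p (sTip ∷ r) = more (read ⨾ move ⨾ ret) (go _ r)
    go p (sNode ∷ r) = more (read ⨾ move ⨾ ret) (go _ r)

  -- Finding the fields of the input

  module Positions {n} (𝒢 : Digraph n) (t₀ : BT n) (u v : Fin n) (len<B : length (encode n 𝒢 t₀ u v) < B) where

    x : List Sym
    x = encode n 𝒢 t₀ u v

    fields : List Sym
    fields = encNat (toℕ u) ++ encNat (toℕ v)

    entries : List Sym
    entries = concatMap (λ i → map (λ j → bit (𝒢 i j)) (allFin n)) (allFin n)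

    home-left root-left u-left v-left : List Sym
    home-left = encNat n ʳ++ []
    root-left = encGraph n 𝒢 ʳ++ home-left
    u-left = encTree t₀ ʳ++ root-left
    v-left = encNat (toℕ u) ʳ++ u-left

    home-right : List Sym
    home-right = encGraph n 𝒢 ++ encTree t₀ ++ fields

    home-On : (home-left , home-right) On x
    home-On = ʳ++-ʳ++ (encNat n) [] _

    root-On : (root-left , encTree t₀ ++ fields) On x
    root-On = trans (ʳ++-ʳ++ (encGraph n 𝒢) home-left _) home-On

    u-On : (u-left , fields) On x
    u-On = trans (ʳ++-ʳ++ (encTree t₀) root-left _) root-On

    v-On : (v-left , encNat (toℕ v)) On x
    v-On = trans (ʳ++-ʳ++ (encNat (toℕ u)) u-left _) u-On

    On-length : ∀ {p r} → (p , r) On x → length p + length r ≡ length x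
    On-length {p} {r} e = trans (sym (length-ʳ++′ p r)) (cong length e)

    right<B : ∀ {p r} → (p , r) On x → length r < B
    right<B {p} {r} on = ≤-<-trans (≤-trans (m≤n+m _ (length p)) (≤-reflexive (On-length {p} on))) len<B

    prefix<B : ∀ {p s r} → (p , s ++ r) On x → length s < B
    prefix<B {p} {s} {r} on = ≤-<-trans (≤-trans (m≤m+n (length s) (length r)) (≤-reflexive (sym (length-++ s)))) (right<B {p} on)

    reverse-On : ∀ {p r} → (p , r) On x → r ʳ++ p ≡ fields ʳ++ u-left
    reverse-On {p} {r} on = trans (sym (trans (ʳ++-ʳ++ p r []) (cong (r ʳ++_) (++-identityʳ p))))
      (trans (cong (_ʳ++ []) (trans on (sym u-On)))
        (trans (ʳ++-ʳ++ u-left fields []) (cong (fields ʳ++_) (++-identityʳ u-left))))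

    leftTip : ∀ {ρ} s p r → All (_≢ sTip) s → length s < B →
      Ex (repeat (move mL >> read >>= case6 (ret 0F) (ret 0F) (ret 0F) (ret 1F) (ret 0F) (ret 0F)))
         ((s ++ sTip ∷ p , r) , ρ) 0F ((p , sTip ∷ (s ʳ++ r)) , ρ)
    leftTip {ρ} s p r ne lt = loop (go s r ne) lt
      where
      go : ∀ s r → All (_≢ sTip) s → Rep {1} _ ((s ++ sTip ∷ p , r) , ρ) 0F ((p , sTip ∷ (s ʳ++ r)) , ρ) (suc (length s))
      go [] r [] = stop ((move ⨾ read) ⨾ ret)
      go (s0 ∷ s) r (_ ∷ ne) = more ((move ⨾ read) ⨾ ret) (go s _ ne)
      go (s1 ∷ s) r (_ ∷ ne) = more ((move ⨾ read) ⨾ ret) (go s _ ne)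
      go (sSep ∷ s) r (_ ∷ ne) = more ((move ⨾ read) ⨾ ret) (go s _ ne)
      go (sTip ∷ s) r (n ∷ ne) = ⊥-elim (n refl)
      go (sNode ∷ s) r (_ ∷ ne) = more ((move ⨾ read) ⨾ ret) (go s _ ne)

    uField-ex : ∀ {h ρ} → h On x → Ex uField (h , ρ) 0F ((u-left , fields) , ρ)
    uField-ex {p , r} {ρ} on = (toEnd-ex p r (right<B {p} on) ⨾
        subst₂ (λ a z → Ex _ ((a , []) , ρ) 0F ((p′ , sTip ∷ z) , ρ)) (sym start) finish
          (leftTip (fields ʳ++ []) p′ [] (All-ʳ++ (++⁺ (ones-noTip (toℕ u)) (ones-noTip (toℕ v))) [])
            (≤-<-trans (≤-reflexive (trans (length-ʳ++′ fields []) (+-identityʳ _))) (right<B {u-left} u-On)))) ⨾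
        subst (λ a → Ex (move mR) ((p′ , sTip ∷ fields) , ρ) 0F ((a , fields) , ρ)) (sym u-left≡) move
      where
      s = proj₁ (tree-snoc t₀)
      p′ = s ʳ++ root-left
      u-left≡ : u-left ≡ sTip ∷ p′
      u-left≡ = trans (cong (_ʳ++ root-left) (proj₂ (tree-snoc t₀))) (++-ʳ++ s)
      start : r ʳ++ p ≡ (fields ʳ++ []) ++ sTip ∷ p′
      start = trans (reverse-On {p} on) (trans (cong (fields ʳ++_) u-left≡) (Data.List.Properties.ʳ++-defn fields))
      finish : (fields ʳ++ []) ʳ++ [] ≡ fields
      finish = trans (ʳ++-ʳ++ fields [] []) (++-identityʳ fields)

    ones-noSep : ∀ k → All (_≢ sSep) (replicate k s1)
    ones-noSep zero = []
    ones-noSep (suc k) = (λ ()) ∷ ones-noSep k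

    skipNat-ex : ∀ {ρ} p k r → k < B → Ex skipSep ((p , encNat k ++ r) , ρ) 0F ((encNat k ʳ++ p , r) , ρ)
    skipNat-ex {ρ} p k r lt = subst₂ (λ a z → Ex skipSep ((p , a) , ρ) 0F ((z , r) , ρ))
      (sym (++-assoc (replicate k s1) _ r)) (sym (++-ʳ++ (replicate k s1)))
      (skipSep-ex p (replicate k s1) r (ones-noSep k) (≤-<-trans (≤-reflexive (Data.List.Properties.length-replicate k)) lt))

    toℕ<B : ∀ (i : Fin n) → toℕ i < B
    toℕ<B i = <-trans (toℕ<n i) (≤-<-trans (≤-trans (≤-trans (n≤1+n n) (≤-reflexive len)) (≤-trans (m≤m+n _ _) (≤-reflexive (sym (length-++ (encNat n))))))
                                 len<B)
      where
      len : suc n ≡ length (encNat n)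
      len = sym (trans (length-++ (replicate n s1)) (trans (cong (_+ 1) (length-replicate n)) (+-comm n 1)))

    vField-ex : ∀ {h ρ} → h On x → Ex vField (h , ρ) 0F ((v-left , encNat (toℕ v)) , ρ)
    vField-ex on = uField-ex on ⨾ skipNat-ex u-left (toℕ u) (encNat (toℕ v)) (toℕ<B u)

    -- Rounds that stay in the loop. Unlike `Loop`, which includes the exit, they can be
    -- concatenated.
    data Steps {n a} (f : Fin a → Com (a + n)) : Fin a → State 13 → Fin a → State 13 → ℕ → Set where
      []  : ∀ {s σ} → Steps f s σ s σ 0
      _∷_ : ∀ {s σ e s′ τ s″ υ k} → Ex (f s) σ e τ × splitAt a e ≡ inj₁ s′ → Steps f s′ τ s″ υ k → Steps f s σ s″ υ (suc k)

    _then_ : ∀ {n a} {f : Fin a → Com (a + n)} {s σ s′ τ s″ υ k k′} →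
      Steps f s σ s′ τ k → Steps f s′ τ s″ υ k′ → Steps f s σ s″ υ (k + k′)
    [] then q = q
    (p ∷ ps) then q = p ∷ (ps then q)

    _end_ : ∀ {n a} {f : Fin a → Com (a + n)} {s σ s′ τ j υ k k′} →
      Steps f s σ s′ τ k → Loop B H f s′ τ j υ k′ → Loop B H f s σ j υ (k + k′)
    [] end q = q
    ((p , e) ∷ ps) end q = again p e (ps end q)

    scanBits : ∀ {ρ} {A : Set} (f : A → Bool) as p r →
      Steps {1} {2} homeStep 1F ((map (bit ∘ f) as ʳ++ p , r) , ρ) 1F ((p , map (bit ∘ f) as ++ r) , ρ) (length as)
    scanBits f [] p r = []
    scanBits {ρ} f (a ∷ as) p r = subst (Steps homeStep 1F _ 1F _) (+-comm (length as) 1)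
      (scanBits f as (bit (f a) ∷ p) r then (one (f a) ∷ []))
      where
      one : ∀ b {r} → Ex (homeStep 1F) ((bit b ∷ p , r) , ρ) 1F ((p , bit b ∷ r) , ρ) × splitAt 2 {1} 1F ≡ inj₁ 1F
      one true = (move ⨾ read) ⨾ ret , refl
      one false = (move ⨾ read) ⨾ ret , refl

    -- The head moves left, so the encoding is consumed from its end: right subtree, left subtree,
    -- separator, bits of the bag, node symbol. The node symbol brings the scan back to state 0.
    scanTree : ∀ {m ρ} (t : BT m) p r →
      Steps {1} {2} homeStep 0F ((encTree t ʳ++ p , r) , ρ) 0F ((p , encTree t ++ r) , ρ) (length (encTree t))
    scanTree tip p r = ((move ⨾ read) ⨾ ret , refl) ∷ []
    scanTree {ρ = ρ} (node b l r′) p r =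
      subst₂ (λ a z → Steps {1} {2} homeStep 0F ((a , r) , ρ) 0F ((p , sNode ∷ z) , ρ) (length (encTree (node b l r′)))) (sym e₁) (sym e₂)
        (subst (Steps homeStep 0F _ 0F _) e₃
          (scanTree r′ (encTree l ʳ++ (encSubset b ʳ++ (sNode ∷ p))) r then
          (scanTree l (encSubset b ʳ++ (sNode ∷ p)) (encTree r′ ++ r) then
          (subst (λ z → Steps {1} {2} homeStep 0F ((z , encTree l ++ encTree r′ ++ r) , ρ) 1F
               ((bits b ʳ++ (sNode ∷ p) , sSep ∷ encTree l ++ encTree r′ ++ r) , ρ) 1) (sym (++-ʳ++ (bits b)))
               (((move ⨾ read) ⨾ ret , refl) ∷ []) then
          (scanBits id (toList b) (sNode ∷ p) (sSep ∷ encTree l ++ encTree r′ ++ r) then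
          (((move ⨾ read) ⨾ ret , refl) ∷ []))))))
      where
      e₁ : encTree (node b l r′) ʳ++ p ≡ encTree r′ ʳ++ (encTree l ʳ++ (encSubset b ʳ++ (sNode ∷ p)))
      e₁ = trans (++-ʳ++ (encSubset b)) (++-ʳ++ (encTree l))
      e₂ : (encSubset b ++ encTree l ++ encTree r′) ++ r ≡ bits b ++ sSep ∷ encTree l ++ encTree r′ ++ r
      e₂ = trans (++-assoc (encSubset b) _ r) (trans (++-assoc (bits b) _ _) (cong (λ z → bits b ++ sSep ∷ z) (++-assoc (encTree l) _ r)))
      e₃ : length (encTree r′) + (length (encTree l) + (1 + (length (toList b) + 1))) ≡ length (encTree (node b l r′))
      e₃ = trans (sym (+-assoc (length (encTree r′)) _ _)) (trans (+-comm _ (1 + (length (toList b) + 1)))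
        (cong suc (trans (cong₂ _+_ {v = length (encTree l ++ encTree r′)}
            (sym (trans (length-++ (bits b)) (cong (_+ 1) (length-map bit (toList b)))))
            (trans (+-comm (length (encTree r′)) _) (sym (length-++ (encTree l)))))
          (sym (length-++ (encSubset b))))))

    home-ex : ∀ {h ρ} → h On x → Ex home (h , ρ) 0F ((home-left , home-right) , ρ)
    home-ex {h} {ρ} on = (uField-ex on ⨾ loop
        (scanTree t₀ root-left fields end
         (subst (λ z → Loop B H {a = 2} homeStep 0F ((z , encTree t₀ ++ fields) , ρ) 0F ((ones , sSep ∷ home-right) , ρ) (suc (length entries + 1))) (sym (++-ʳ++ entries))
           (again {s′ = 1F} ((move ⨾ read) ⨾ ret) refl
             (subst₂ (λ z y → Loop B H {a = 2} homeStep 1F ((z , sSep ∷ encTree t₀ ++ fields) , ρ) 0F ((ones , sSep ∷ y) , ρ) (length entries + 1))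
                refl (sym (++-assoc entries _ _))
                (scanRows (allFin n) home-left (sSep ∷ encTree t₀ ++ fields) end
                  subst (λ z → Loop B H {a = 2} homeStep 1F ((z , entries ++ sSep ∷ encTree t₀ ++ fields) , ρ) 0F
                        ((ones , sSep ∷ entries ++ sSep ∷ encTree t₀ ++ fields) , ρ) 1)
                    (sym home-left≡) (done ((move ⨾ read) ⨾ ret) refl))))))
        bound) ⨾
        subst (λ a → Ex (move mR) ((ones , sSep ∷ home-right) , ρ) 0F ((a , home-right) , ρ)) (sym home-left≡) move
      where
      ones = replicate n s1 ʳ++ []
      home-left≡ : home-left ≡ sSep ∷ ones
      home-left≡ = ++-ʳ++ (replicate n s1)
      rows : List (Fin n) → List Sym
      rows = concatMap (λ i → map (λ j → bit (𝒢 i j)) (allFin n))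
      scanRows : ∀ is p r →
        Steps {1} {2} homeStep 1F ((rows is ʳ++ p , r) , ρ) 1F ((p , rows is ++ r) , ρ) (length (rows is))
      scanRows [] p r = []
      scanRows (i ∷ is) p r = subst₂ (λ a z → Steps {1} {2} homeStep 1F ((a , r) , ρ) 1F ((p , z) , ρ) (length (rows (i ∷ is))))
        (sym (++-ʳ++ row)) (sym (++-assoc row (rows is) r))
        (subst (Steps homeStep 1F _ 1F _)
           (trans (+-comm (length (rows is)) _) (trans (cong (_+ length (rows is)) (sym (length-map (λ j → bit (𝒢 i j)) (allFin n)))) (sym (length-++ row))))
           (scanRows is (row ʳ++ p) r then scanBits (𝒢 i) (allFin n) p (rows is ++ r)))
        where row = map (λ j → bit (𝒢 i j)) (allFin n)
      bound : length (encTree t₀) + suc (length entries + 1) ≤ B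
      bound = ≤-trans (≤-reflexive (trans (cong (length (encTree t₀) +_) (cong suc (sym (length-++ entries))))
                        (trans (+-suc (length (encTree t₀)) _) (cong suc (+-comm (length (encTree t₀)) _)))))
                (≤-<-trans (≤-trans (+-monoʳ-≤ (length (encGraph n 𝒢)) (≤-trans (m≤m+n _ (length fields)) (≤-reflexive (sym (length-++ (encTree t₀))))))
                   (≤-reflexive (sym (length-++ (encGraph n 𝒢))))) (right<B {home-left} home-On))

    entries-noSep : All (_≢ sSep) entries
    entries-noSep = go (allFin n)
      where
      row : ∀ i js → All (_≢ sSep) (map (λ j → bit (𝒢 i j)) js)
      row i [] = []
      row i (j ∷ js) with 𝒢 i j
      ... | true = (λ ()) ∷ row i js
      ... | false = (λ ()) ∷ row i js
      go : ∀ is → All (_≢ sSep) (concatMap (λ i → map (λ j → bit (𝒢 i j)) (allFin n)) is)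
      go [] = []
      go (i ∷ is) = ++⁺ (row i (allFin n)) (go is)

    root-ex : ∀ {h ρ} → h On x → Ex root (h , ρ) 0F ((root-left , encTree t₀ ++ fields) , ρ)
    root-ex {h} {ρ} on = home-ex on ⨾ subst₂ (λ a z → Ex skipSep ((home-left , a) , ρ) 0F ((z , encTree t₀ ++ fields) , ρ))
      (sym (++-assoc entries _ _)) (sym (++-ʳ++ entries))
      (skipSep-ex home-left entries (encTree t₀ ++ fields) entries-noSep
        (prefix<B {home-left} {entries} (trans (cong (home-left ʳ++_) (sym (++-assoc entries _ _))) home-On)))

    1+n<B : suc n < B
    1+n<B = ≤-<-trans (≤-reflexive len) (prefix<B {[]} {encNat n} refl)
      where
      len : suc n ≡ length (encNat n)
      len = sym (trans (length-++ (replicate n s1)) (trans (cong (_+ 1) (length-replicate n)) (+-comm n 1)))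

    n<B : n < B
    n<B = <-trans (n<1+n n) 1+n<B

    -- Reading the number of vertices and choosing the case

    module Start (counter : ∀ m → m ≤ n → length (cnt m) ≤ H) where

      countField-loop : ∀ k m p r → m + k ≤ n →
        Rep {1} (read >>= case6 (ret 1F) (inc I >> move mR >> ret 0F) (ret 1F) (ret 1F) (ret 1F) (ret 1F))
          ((p , encNat k ++ r) , counted (cnt m)) 0F ((replicate k s1 ʳ++ p , sSep ∷ r) , counted (cnt (m + k))) (suc k)
      countField-loop zero m p r le rewrite +-identityʳ m = stop (read ⨾ ret)
      countField-loop (suc k) m p r le rewrite +-suc m k =
        more (read ⨾ (inc-ex viewIT (cnt m) (≤-<-trans (counter m (m+n≤o⇒m≤o m (<⇒≤ le))) H<B) (counter (suc m) (≤-trans (s≤s (m≤m+n m k)) le)) ⨾ move) ⨾ ret)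
          (countField-loop k (suc m) (s1 ∷ p) r le)

      countField-ex : ∀ k p r → k ≤ n → k < B →
        Ex countField ((p , encNat k ++ r) , counted []) 0F ((replicate k s1 ʳ++ p , sSep ∷ r) , counted (cnt k))
      countField-ex k p r le lt = loop (countField-loop k 0 p r le) lt

      wide-loop : ∀ {ρ} s r p → Σ[ h ∈ Head ] Σ[ k ∈ ℕ ] h On (p ʳ++ r) × k ≤ suc (length r) ×
        Loop B H {a = 3} wideStep s ((p , r) , ρ) (isYes (widens s r)) (h , ρ) k
      wide-loop 0F [] p = _ , _ , refl , ≤-refl , done (read ⨾ ret) refl
      wide-loop 1F [] p = _ , _ , refl , ≤-refl , done (read ⨾ ret) refl
      wide-loop 2F [] p = _ , _ , refl , ≤-refl , done (read ⨾ ret) refl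
      wide-loop 0F (s0 ∷ r) p = let (h , k , on , le , ps) = wide-loop 0F r (s0 ∷ p) in h , _ , on , s≤s le , again (read ⨾ move ⨾ ret) refl ps
      wide-loop 0F (s1 ∷ r) p = let (h , k , on , le , ps) = wide-loop 0F r (s1 ∷ p) in h , _ , on , s≤s le , again (read ⨾ move ⨾ ret) refl ps
      wide-loop 0F (sSep ∷ r) p = let (h , k , on , le , ps) = wide-loop 0F r (sSep ∷ p) in h , _ , on , s≤s le , again (read ⨾ move ⨾ ret) refl ps
      wide-loop 0F (sTip ∷ r) p = let (h , k , on , le , ps) = wide-loop 0F r (sTip ∷ p) in h , _ , on , s≤s le , again (read ⨾ move ⨾ ret) refl ps
      wide-loop 0F (sNode ∷ r) p = let (h , k , on , le , ps) = wide-loop 1F r (sNode ∷ p) in h , _ , on , s≤s le , again {s′ = 1F} (read ⨾ move ⨾ ret) refl ps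
      wide-loop 1F (s0 ∷ r) p = let (h , k , on , le , ps) = wide-loop 1F r (s0 ∷ p) in h , _ , on , s≤s le , again {s′ = 1F} (read ⨾ move ⨾ ret) refl ps
      wide-loop 1F (s1 ∷ r) p = let (h , k , on , le , ps) = wide-loop 2F r (s1 ∷ p) in h , _ , on , s≤s le , again {s′ = 2F} (read ⨾ move ⨾ ret) refl ps
      wide-loop 1F (sSep ∷ r) p = let (h , k , on , le , ps) = wide-loop 0F r (sSep ∷ p) in h , _ , on , s≤s le , again (read ⨾ move ⨾ ret) refl ps
      wide-loop 1F (sTip ∷ r) p = let (h , k , on , le , ps) = wide-loop 0F r (sTip ∷ p) in h , _ , on , s≤s le , again (read ⨾ move ⨾ ret) refl ps
      wide-loop 1F (sNode ∷ r) p = let (h , k , on , le , ps) = wide-loop 0F r (sNode ∷ p) in h , _ , on , s≤s le , again (read ⨾ move ⨾ ret) refl ps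
      wide-loop 2F (s0 ∷ r) p = let (h , k , on , le , ps) = wide-loop 2F r (s0 ∷ p) in h , _ , on , s≤s le , again {s′ = 2F} (read ⨾ move ⨾ ret) refl ps
      wide-loop 2F (s1 ∷ r) p = _ , _ , refl , s≤s z≤n , done (read ⨾ ret) refl
      wide-loop 2F (sSep ∷ r) p = let (h , k , on , le , ps) = wide-loop 0F r (sSep ∷ p) in h , _ , on , s≤s le , again (read ⨾ move ⨾ ret) refl ps
      wide-loop 2F (sTip ∷ r) p = let (h , k , on , le , ps) = wide-loop 0F r (sTip ∷ p) in h , _ , on , s≤s le , again (read ⨾ move ⨾ ret) refl ps
      wide-loop 2F (sNode ∷ r) p = let (h , k , on , le , ps) = wide-loop 0F r (sNode ∷ p) in h , _ , on , s≤s le , again (read ⨾ move ⨾ ret) refl ps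

      widens-input : widens 0F x ≡ isWide t₀
      widens-input = begin
        widens 0F (encNat n ++ encGraph n 𝒢 ++ encTree t₀ ++ fields) ≡⟨ widens-skip (encNat n) _ (ones-noNode n) ⟩
        widens 0F (encGraph n 𝒢 ++ encTree t₀ ++ fields)  ≡⟨ widens-skip (encGraph n 𝒢) _ (++⁺ (go (allFin n)) ((λ ()) ∷ [])) ⟩
        widens 0F (encTree t₀ ++ fields)                  ≡⟨ widens-tree t₀ fields ⟩
        isWide t₀ ∨ widens 0F fields                      ≡⟨ cong (isWide t₀ ∨_) (trans (cong (widens 0F) (sym (++-identityʳ fields)))
              (widens-skip fields [] (++⁺ (ones-noNode (toℕ u)) (ones-noNode (toℕ v))))) ⟩
        isWide t₀ ∨ false                                 ≡⟨ Data.Bool.Properties.∨-identityʳ (isWide t₀) ⟩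
        isWide t₀ ∎
        where
        open ≡-Reasoning
        row : ∀ i js → All (_≢ sNode) (map (λ j → bit (𝒢 i j)) js)
        row i [] = []
        row i (j ∷ js) with 𝒢 i j
        ... | true = (λ ()) ∷ row i js
        ... | false = (λ ()) ∷ row i js
        go : ∀ is → All (_≢ sNode) (concatMap (λ i → map (λ j → bit (𝒢 i j)) (allFin n)) is)
        go [] = []
        go (i ∷ is) = ++⁺ (row i (allFin n)) (go is)

      wide-from : ∀ {ρ} p r → (p , r) On x → widens 0F r ≡ isWide t₀ → Σ[ h ∈ Head ] h On x ×
        Ex wide ((p , r) , ρ) (isYes (isWide t₀)) (h , ρ)
      wide-from {ρ} p r on e = let (h , k , on′ , le , ps) = wide-loop 0F r p in h , trans on′ on ,
        subst (λ z → Ex wide ((p , r) , ρ) (isYes z) (h , ρ)) e (loop ps (≤-trans le (right<B {p} on)))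

      start-ex : Σ[ h ∈ Head ] h On x × Ex (countField >> wide) (([] , x) , counted []) (isYes (isWide t₀)) (h , counted (cnt n))
      start-ex = let (h , on , ex) = wide-from (replicate n s1 ʳ++ []) (sSep ∷ home-right)
                        (trans (ʳ++-ʳ++ (replicate n s1) [] _) (sym (++-assoc (replicate n s1) _ home-right)))
                        (trans (sym (widens-skip (encNat n) home-right (ones-noNode n))) widens-input)
                 in h , on , countField-ex n [] home-right ≤-refl n<B ⨾ ex

      decide-ex : ∀ b {σ} → Ex (case2 (ret REJECT) (ret ACCEPT) (isYes b)) σ (verdictIx b) σ
      decide-ex true = ret
      decide-ex false = ret

      same-ex : ∀ {h} → h On x → Σ[ σ ∈ State 13 ] Ex sameVertex (h , counted (cnt n)) (verdictIx (toℕ v ≡ᵇ toℕ u)) σ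
      same-ex on = let (h′ , on′ , ex) = equals-ex {cnt (toℕ v)} {[]} {[]} {[]} {[]} {[]} {[]} {[]} {[]} {[]} {[]} 0F u-left (toℕ u) (encNat (toℕ v))
                                           (counter (toℕ v) (<⇒≤ (toℕ<n v))) (toℕ<B u)
                 in _ , fold-sameVertex (((((clear-ex viewI (cnt n) (counter n ≤-refl) ⨾ vField-ex on)
                        ⨾ subst (λ z → Ex countField ((v-left , z) , counted []) 0F (h₁ , counted (cnt (toℕ v)))) (++-identityʳ (encNat (toℕ v)))
                            (countField-ex (toℕ v) v-left [] (<⇒≤ (toℕ<n v)) (toℕ<B v)))
                        ⨾ uField-ex on₁) ⨾ ex)
                        ⨾ subst (λ z → Ex (case2 (ret REJECT) (ret ACCEPT) (isYes (z ≡ᵇ toℕ u))) (h′ , counted (cnt (toℕ v))) (verdictIx (toℕ v ≡ᵇ toℕ u)) (h′ , counted (cnt (toℕ v))))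
                            (sym (val-cnt (toℕ v))) (decide-ex (toℕ v ≡ᵇ toℕ u)))
        where
        h₁ : Head
        h₁ = replicate (toℕ v) s1 ʳ++ v-left , sSep ∷ []
        on₁ : h₁ On x
        on₁ = trans (ʳ++-ʳ++ (replicate (toℕ v) s1) v-left (sSep ∷ [])) v-On

      dispatch : ∀ {w} → isWide t₀ ≡ w → ∀ {h i σ} → Ex (case2 sameVertex search (isYes w)) (h , counted (cnt n)) i σ →
        Ex (case2 sameVertex search (isYes (isWide t₀))) (h , counted (cnt n)) i σ
      dispatch refl ex = ex

      main-narrow : isWide t₀ ≡ false → Σ[ σ ∈ State 13 ] Ex main (([] , x) , no-regs) (verdictIx (toℕ v ≡ᵇ toℕ u)) σ
      main-narrow nw = let (h₁ , on₁ , ex₁) = start-ex ; (σ , ex₂) = same-ex on₁ in σ , fold-main (ex₁ ⨾ dispatch nw ex₂)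

      main-wide : isWide t₀ ≡ true → ∀ {i} → (∀ {h} → h On x → Σ[ σ ∈ State 13 ] Ex search (h , counted (cnt n)) i σ) →
        Σ[ σ ∈ State 13 ] Ex main (([] , x) , no-regs) i σ
      main-wide wd run = let (h₁ , on₁ , ex₁) = start-ex ; (σ , ex₂) = run on₁ in σ , fold-main (ex₁ ⨾ dispatch wd ex₂)

    -- Walking along a branch of the tree

    module Routes (height<H : height t₀ < H) where

      -- Commands that reposition the head themselves work from any place on the input; hiding the
      -- place lets them be composed by their effect on the registers.
      Run : ∀ {k} → Com k → Regs 13 → Fin k → Regs 13 → Set
      Run c ρ k ρ′ = ∀ {h} → h On x → Σ[ h′ ∈ Head ] h′ On x × Ex c (h , ρ) k (h′ , ρ′)

      infixr 6 _⨟_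
      _⨟_ : ∀ {k k′} {c : Com k} {c′ : Fin k → Com k′} {ρ k₁ τ k₂ υ} → Run c ρ k₁ τ → Run (c′ k₁) τ k₂ υ → Run (bind c c′) ρ k₂ υ
      (p ⨟ q) on with p on
      ... | h′ , on′ , ex with q on′
      ...   | h″ , on″ , ex′ = h″ , on″ , ex ⨾ ex′

      bag-after : ∀ {k} (b S : Vec Bool k) p r m m′ → length (comp b S) + length m ≤ H →
        Loop B H {a = 2} bagStep 1F ((p , bits b ++ sSep ∷ r) , st i j e [] [] w w′ m (comp b S ++ m′) f d g a) 0F
          ((sSep ∷ (bits b ʳ++ p) , r) , st i j e [] [] w w′ (comp b S ʳ++ m) m′ f d g a) (suc k)
      bag-after [] [] p r m m′ le = done (read ⨾ move ⨾ ret) refl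
      bag-after (false ∷ b) (x ∷ S) p r m m′ le = again (read ⨾ move ⨾ ret) refl (bag-after b S _ r m m′ le)
      bag-after (true ∷ b) (false ∷ S) p r m m′ le = again (read ⨾ ((pop ⨾ push (m+n≤o⇒n≤o (length (comp b S)) le′)) ⨾ move) ⨾ ret) refl
          (bag-after b S _ r _ m′ le′)
        where le′ = subst (_≤ H) (sym (+-suc (length (comp b S)) (length m))) le
      bag-after (true ∷ b) (true ∷ S) p r m m′ le = again (read ⨾ ((pop ⨾ push (m+n≤o⇒n≤o (length (comp b S)) le′)) ⨾ move) ⨾ ret) refl
          (bag-after b S _ r _ m′ le′)
        where le′ = subst (_≤ H) (sym (+-suc (length (comp b S)) (length m))) le

      orMark-ex : ∀ {h} y g m m′ → length m < H →
        Ex orMark (h , st i j e [] [] w w′ m (y ∷ m′) f d (g ∷ []) a) 0F (h , st i j e [] [] w w′ ((g ∨ y) ∷ m) m′ f d ((g ∨ y) ∷ []) a)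
      orMark-ex false false m m′ lt = pop ⨾ pop ⨾ push lt ⨾ push (≤-<-trans z≤n lt)
      orMark-ex true false m m′ lt = pop ⨾ pop ⨾ push lt ⨾ push (≤-<-trans z≤n lt)
      orMark-ex y true m m′ lt = pop ⨾ pop ⨾ push lt ⨾ push (≤-<-trans z≤n lt)

      bag-before : ∀ {k} (b S : Vec Bool k) p r l c g m m′ → val l ≡ c → c < k → length l ≤ H → length (comp b S) + length m ≤ H →
        Loop B H {a = 2} bagStep 0F ((p , bits b ++ sSep ∷ r) , st i j e l [] w w′ m (comp b S ++ m′) f d (g ∷ []) a) 0F
          ((sSep ∷ (bits b ʳ++ p) , r) ,
            st i j e [] [] w w′ (comp b (proj₁ (orAt c g b S)) ʳ++ m) m′ f d (proj₂ (orAt c g b S) ∷ []) a) (suc k)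
      bag-before (false ∷ b) (y ∷ S) p r l zero g m m′ vl lt l≤ le =
        again {s′ = 1F} (read ⨾ dec-zero l vl l≤ ⨾ move ⨾ ret) refl (bag-after b S _ r m m′ le)
      bag-before (true ∷ b) (y ∷ S) p r l zero g m m′ vl lt l≤ le =
          again {s′ = 1F} (read ⨾ dec-zero l vl l≤ ⨾ (orMark-ex y g m _ (m+n≤o⇒n≤o (length (comp b S)) le′) ⨾ move) ⨾ ret) refl
            (bag-after b S _ r _ m′ le′)
        where le′ = subst (_≤ H) (sym (+-suc (length (comp b S)) (length m))) le
      bag-before (false ∷ b) (y ∷ S) p r l (suc c) g m m′ vl (s≤s lt) l≤ le =
        again (read ⨾ dec-suc l vl l≤ ⨾ move ⨾ ret) refl
          (bag-before b S _ r (decL l) c g m m′ (val-decL l vl) lt (subst (_≤ H) (sym (length-decL l)) l≤) le)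
      bag-before (true ∷ b) (false ∷ S) p r l (suc c) g m m′ vl (s≤s lt) l≤ le =
          again (read ⨾ dec-suc l vl l≤ ⨾ ((pop ⨾ push (m+n≤o⇒n≤o (length (comp b S)) le′)) ⨾ move) ⨾ ret) refl
            (bag-before b S _ r (decL l) c g _ m′ (val-decL l vl) lt (subst (_≤ H) (sym (length-decL l)) l≤) le′)
        where le′ = subst (_≤ H) (sym (+-suc (length (comp b S)) (length m))) le
      bag-before (true ∷ b) (true ∷ S) p r l (suc c) g m m′ vl (s≤s lt) l≤ le =
          again (read ⨾ dec-suc l vl l≤ ⨾ ((pop ⨾ push (m+n≤o⇒n≤o (length (comp b S)) le′)) ⨾ move) ⨾ ret) refl
            (bag-before b S _ r (decL l) c g _ m′ (val-decL l vl) lt (subst (_≤ H) (sym (length-decL l)) l≤) le′)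
        where le′ = subst (_≤ H) (sym (+-suc (length (comp b S)) (length m))) le

      bagOr-ex : ∀ q (b S : Vec Bool n) p r g m m′ → length (pick q i j e) ≤ H → val (pick q i j e) < n → length (comp b S) + length m ≤ H →
        let c = val (pick q i j e) in
        Ex (bagOr (sel q)) ((p , sNode ∷ encSubset b ++ r) , st i j e [] [] w w′ m (comp b S ++ m′) f d (g ∷ []) a) 0F
          ((encSubset b ʳ++ (sNode ∷ p) , r) ,
            st i j e [] [] w w′ (comp b (proj₁ (orAt c g b S)) ʳ++ m) m′ f d (proj₂ (orAt c g b S) ∷ []) a)
      bagOr-ex {i} {j} {e} {w} {w′} {f} {d} {a} q b S p r g m m′ l≤ lt le = subst₂
        (λ y z → Ex (bagOr (sel q)) ((p , sNode ∷ y) , st i j e [] [] w w′ m (comp b S ++ m′) f d (g ∷ []) a) 0F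
          ((z , r) , st i j e [] [] w w′ (comp b (proj₁ (orAt _ g b S)) ʳ++ m) m′ f d (proj₂ (orAt _ g b S) ∷ []) a))
        (sym (++-assoc (bits b) _ r)) (sym (++-ʳ++ (bits b)))
        ((copy-ex q l≤ ⨾ move) ⨾ loop (bag-before b S (sNode ∷ p) r _ _ g m m′ refl lt l≤ le) n<B)

      skipBag-ex : ∀ {ρ} (b : Subset n) p r → Ex skipSep ((p , sNode ∷ encSubset b ++ r) , ρ) 0F ((encSubset b ʳ++ (sNode ∷ p) , r) , ρ)
      skipBag-ex {ρ} b p r = subst₂ (λ y z → Ex skipSep ((p , sNode ∷ y) , ρ) 0F ((z , r) , ρ))
        (sym (++-assoc (bits b) _ r)) (sym (++-ʳ++ (bits b)))
        (skipSep-ex p (sNode ∷ bits b) r ((λ ()) ∷ bits-noSep b) bound)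
        where
        bound : suc (length (bits b)) < B
        bound = ≤-<-trans (≤-reflexive (cong suc (trans (length-map bit (toList b)) (length-toList b)))) 1+n<B

      encTree-++ : ∀ {k} (b : Subset k) l r s → encTree (node b l r) ++ s ≡ sNode ∷ encSubset b ++ encTree l ++ encTree r ++ s
      encTree-++ b l r s = cong (sNode ∷_) (trans (++-assoc (encSubset b) _ s) (cong (encSubset b ++_) (++-assoc (encTree l) _ s)))

      left-On : ∀ p (b : Subset n) l r s → (p , encTree (node b l r) ++ s) On x → (encSubset b ʳ++ (sNode ∷ p) , encTree l ++ encTree r ++ s) On x
      left-On p b l r s on = trans (ʳ++-ʳ++ (encSubset b) (sNode ∷ p) _) (trans (cong (p ʳ++_) (sym (encTree-++ b l r s))) on)

      trues : ℕ → List Bool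
      trues k = replicate k true

      length-trues : ∀ k → length (trues k) ≡ k
      length-trues k = Data.List.Properties.length-replicate k

      treeStep : Com 2
      treeStep = pop D >>= case3 (ret 1F) go go
        where
        go = read >>= case6 (ret 1F) (ret 1F) (ret 1F) (move mR >> ret 0F)
                            (push D true >> push D true >> skipSep >> ret 0F) (ret 1F)

      encTree-ʳ++ : ∀ {k} (b : Subset k) l r p → encTree (node b l r) ʳ++ p ≡ encTree r ʳ++ (encTree l ʳ++ (encSubset b ʳ++ (sNode ∷ p)))
      encTree-ʳ++ b l r p = trans (++-ʳ++ (encSubset b)) (++-ʳ++ (encTree l))

      node-shape : ∀ {k} (b : Subset k) l r s → sNode ∷ bits b ++ sSep ∷ encTree l ++ encTree r ++ s ≡ encTree (node b l r) ++ s
      node-shape b l r s = trans (cong (sNode ∷_) (sym (++-assoc (bits b) _ _))) (sym (encTree-++ b l r s))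

      encTree-length : ∀ {k} (b : Subset k) l r → 1 + (length (encTree l) + length (encTree r)) ≤ length (encTree (node b l r))
      encTree-length b l r = s≤s (≤-trans (≤-reflexive (sym (length-++ (encTree l)))) (≤-trans (m≤n+m _ (length (encSubset b))) (≤-reflexive (sym (length-++ (encSubset b))))))

      -- `k` counts the subtrees that are pending besides `t`. While `t` is read, at most
      -- `suc (height t)` of its own parts are pending, so `D` grows with the height and not with
      -- the size.
      skip-steps : ∀ (t : BT n) p r k → k + suc (height t) ≤ H → Σ[ s ∈ ℕ ] s ≤ length (encTree t) ×
        Steps {1} {1} (λ _ → treeStep) 0F ((p , encTree t ++ r) , st i j e [] [] w w′ m m′ f (trues (suc k)) g a)
                       0F ((encTree t ʳ++ p , r) , st i j e [] [] w w′ m m′ f (trues k) g a) s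
      skip-steps tip p r k le = 1 , ≤-refl , (pop ⨾ read ⨾ move ⨾ ret , refl) ∷ []
      skip-steps {i} {j} {e} {w} {w′} {m} {m′} {f} {g} {a} (node b l r′) p r k le
        with skip-steps {i} {j} {e} {w} {w′} {m} {m′} {f} {g} {a} l (encSubset b ʳ++ (sNode ∷ p)) (encTree r′ ++ r) (suc k)
               (≤-trans (≤-reflexive (sym (+-suc k _))) (≤-trans (+-monoʳ-≤ k (s≤s (s≤s (m≤m⊔n (height l) (height r′))))) le))
           | skip-steps {i} {j} {e} {w} {w′} {m} {m′} {f} {g} {a} r′ (encTree l ʳ++ (encSubset b ʳ++ (sNode ∷ p))) r k
               (≤-trans (+-monoʳ-≤ k (s≤s (m≤n⇒m≤1+n (m≤n⊔m (height l) (height r′))))) le)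
      ... | s , s≤ , ps | s′ , s′≤ , ps′ = 1 + (s + s′) , ≤-trans (s≤s (+-mono-≤ s≤ s′≤)) (encTree-length b l r′) ,
        subst₂ (λ y z → Steps {1} {1} (λ _ → treeStep) 0F ((p , y) , st i j e [] [] w w′ m m′ f (trues (suc k)) g a)
                       0F ((z , r) , st i j e [] [] w w′ m m′ f (trues k) g a) (1 + (s + s′)))
          (sym (encTree-++ b l r′ r)) (sym (encTree-ʳ++ b l r′ p))
          ((pop ⨾ read ⨾ ((push lt₁ ⨾ push lt₂) ⨾ skipBag-ex b p _) ⨾ ret , refl) ∷ (ps then ps′))
        where
        lt₂ : suc (length (trues k)) < H
        lt₂ = ≤-trans (≤-reflexive (trans (cong (2 +_) (length-trues k)) (+-comm 2 k))) (≤-trans (+-monoʳ-≤ k (s≤s (s≤s z≤n))) le)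
        lt₁ : length (trues k) < H
        lt₁ = <-trans (n<1+n _) lt₂

      skipTree-ex : ∀ (t : BT n) p r → height t < H → (p , encTree t ++ r) On x →
        Ex skipTree ((p , encTree t ++ r) , st i j e [] [] w w′ m m′ f [] g a) 0F ((encTree t ʳ++ p , r) , st i j e [] [] w w′ m m′ f [] g a)
      skipTree-ex t p r ht on with skip-steps t p r 0 ht
      ... | s , s≤ , ps = push (≤-<-trans z≤n ht) ⨾
        loop (ps end stop (pop ⨾ ret)) (≤-trans (+-monoˡ-≤ 1 s≤) (≤-trans (≤-reflexive (+-comm _ 1)) (prefix<B {p} {encTree t} on)))

      Marks : Set
      Marks = List Bool × List Bool × List Bool

      -- `route` runs with two kinds of visit, one that rewrites marks and one that skips the bag;
      -- its execution is proved once for visits that touch only the marks and `G`.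
      Visits : Com 1 → (Subset n → Marks → Marks → Set) → (i j e f a : List Bool) → Set
      Visits visit step i j e f a = ∀ {b m m′ g n n′ k} p r w w′ → step b (m , m′ , g) (n , n′ , k) →
        Ex visit ((p , sNode ∷ encSubset b ++ r) , st i j e [] [] w w′ m m′ f [] g a) 0F
                 ((encSubset b ʳ++ (sNode ∷ p) , r) , st i j e [] [] w w′ n n′ f [] k a)

      module Visiting (visit : Com 1) (step : Subset n → Marks → Marks → Set) {i j e f a : List Bool}
                      (visit-ex : Visits visit step i j e f a) where

        data Chain : List (Subset n) → Marks → Marks → Set where
          []  : ∀ {X} → Chain [] X X
          _∷_ : ∀ {b bs X Y Z} → step b X Y → Chain bs Y Z → Chain (b ∷ bs) X Z

        routeStep : Com 2
        routeStep = pop W′ >>= case3 (ret 1F)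
          (push W false >> (pop W′ >>= case3 (ret 1F) (push W false >> ret 0F) (push W true >> ret 0F)))
          (visit >> push W true >> (pop W′ >>= case3 (ret 1F) (push W false >> ret 0F) (push W true >> skipTree >> ret 0F)))

        shift-codes : ∀ w (W₀ : List Bool) → suc (suc (length (codes w))) + length W₀ ≤ H → length (codes w) + suc (suc (length W₀)) ≤ H
        shift-codes w W₀ le = ≤-trans (≤-reflexive (trans (+-suc _ _) (cong suc (+-suc (length (codes w)) _)))) le

        route-loop : ∀ {t : BT n} {w bs t′ m m′ g n n′ k} → Branch t w bs t′ → Chain bs (m , m′ , g) (n , n′ , k) →
          ∀ W₀ p r → (p , encTree t ++ r) On x → height t < H → length (codes w) + length W₀ ≤ H →
          Σ[ p′ ∈ List Sym ] Σ[ r′ ∈ List Sym ] (p′ , encTree t′ ++ r′) On x ×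
          Rep routeStep ((p , encTree t ++ r) , st i j e [] [] W₀ (codes w) m m′ f [] g a) 0F
              ((p′ , encTree t′ ++ r′) , st i j e [] [] (codes w ʳ++ W₀) [] n n′ f [] k a) (suc (length w))
        route-loop here [] W₀ p r on ht le = p , r , on , stop (pop ⨾ ret)
        route-loop {w = first ∷ w} (first br) ch W₀ p r on ht le =
          let (p′ , r′ , on′ , ps) = route-loop br ch (false ∷ false ∷ W₀) p r on ht (shift-codes w W₀ le)
          in p′ , r′ , on′ , more (pop ⨾ push (≤-trans (s≤s (m≤n+m _ (suc (length (codes w))))) le) ⨾ pop ⨾ push (≤-trans (s≤s (s≤s (m≤n+m _ (length (codes w))))) le) ⨾ ret) ps
        route-loop {w = second ∷ w} (second br) ch W₀ p r on ht le =
          let (p′ , r′ , on′ , ps) = route-loop br ch (true ∷ false ∷ W₀) p r on ht (shift-codes w W₀ le)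
          in p′ , r′ , on′ , more (pop ⨾ push (≤-trans (s≤s (m≤n+m _ (suc (length (codes w))))) le) ⨾ pop ⨾ push (≤-trans (s≤s (s≤s (m≤n+m _ (length (codes w))))) le) ⨾ ret) ps
        route-loop {t = node b l r₁} {w = left ∷ w} {t′ = t′} {m} {m′} {g} {n₁} {n₂} {k} (left br) (s ∷ ch) W₀ p r on ht le =
          let (p′ , r′ , on′ , ps) = route-loop br ch (false ∷ true ∷ W₀) (encSubset b ʳ++ (sNode ∷ p)) (encTree r₁ ++ r)
                 (left-On p b l r₁ r on) (≤-trans (s≤s (m≤n⇒m≤1+n (m≤m⊔n (height l) (height r₁)))) ht) (shift-codes w W₀ le)
          in p′ , r′ , on′ ,
          subst (λ y → Rep routeStep ((p , y) , st i j e [] [] W₀ (codes (left ∷ w)) m m′ f [] g a) 0F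
              ((p′ , encTree t′ ++ r′) , st i j e [] [] (codes (left ∷ w) ʳ++ W₀) [] n₁ n₂ f [] k a) (suc (length (left ∷ w))))
            (sym (encTree-++ b l r₁ r))
          (more (pop ⨾ (visit-ex p _ W₀ _ s ⨾ push (≤-trans (s≤s (m≤n+m _ (suc (length (codes w))))) le)) ⨾ pop ⨾ push (≤-trans (s≤s (s≤s (m≤n+m _ (length (codes w))))) le) ⨾ ret) ps)
        route-loop {t = node b l r₁} {w = right ∷ w} {t′ = t′} {m} {m′} {g} {n₁} {n₂} {k} (right br) (s ∷ ch) W₀ p r on ht le =
          let (p′ , r′ , on′ , ps) = route-loop br ch (true ∷ true ∷ W₀) (encTree l ʳ++ (encSubset b ʳ++ (sNode ∷ p))) r
                 (trans (ʳ++-ʳ++ (encTree l) _ _) (left-On p b l r₁ r on))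
                 (≤-trans (s≤s (m≤n⇒m≤1+n (m≤n⊔m (height l) (height r₁)))) ht) (shift-codes w W₀ le)
          in p′ , r′ , on′ ,
          subst (λ y → Rep routeStep ((p , y) , st i j e [] [] W₀ (codes (right ∷ w)) m m′ f [] g a) 0F
              ((p′ , encTree t′ ++ r′) , st i j e [] [] (codes (right ∷ w) ʳ++ W₀) [] n₁ n₂ f [] k a) (suc (length (right ∷ w))))
            (sym (encTree-++ b l r₁ r))
          (more (pop ⨾ (visit-ex p _ W₀ _ s ⨾ push (≤-trans (s≤s (m≤n+m _ (suc (length (codes w))))) le)) ⨾ pop
                 ⨾ (push (≤-trans (s≤s (s≤s (m≤n+m _ (length (codes w))))) le)
                 ⨾ skipTree-ex l _ _ (≤-trans (s≤s (m≤n⇒m≤1+n (m≤m⊔n (height l) (height r₁)))) ht) (left-On p b l r₁ r on)) ⨾ ret) ps)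

        length-codes : ∀ w → length w ≤ length (codes w)
        length-codes [] = z≤n
        length-codes (first ∷ w) = s≤s (m≤n⇒m≤1+n (length-codes w))
        length-codes (second ∷ w) = s≤s (m≤n⇒m≤1+n (length-codes w))
        length-codes (left ∷ w) = s≤s (m≤n⇒m≤1+n (length-codes w))
        length-codes (right ∷ w) = s≤s (m≤n⇒m≤1+n (length-codes w))

        route-ex : ∀ {w bs t′ m m′ g n n′ k} → Branch t₀ w bs t′ → Chain bs (m , m′ , g) (n , n′ , k) →
          length (codes w) ≤ H → ∀ {h} → h On x →
          Σ[ p′ ∈ List Sym ] Σ[ r′ ∈ List Sym ] (p′ , encTree t′ ++ r′) On x ×
          Ex (route visit) (h , st i j e [] [] (codes w ʳ++ []) [] m m′ f [] g a) 0F
              ((p′ , encTree t′ ++ r′) , st i j e [] [] (codes w ʳ++ []) [] n n′ f [] k a)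
        route-ex {w} {bs} {t′} {m} {m′} {g} {n₁} {n₂} {k} br ch le on with route-loop br ch [] root-left fields root-On height<H (≤-trans (≤-reflexive (+-identityʳ _)) le)
        ... | p′ , r′ , on′ , ps = p′ , r′ , on′ , (root-ex on ⨾
            subst (λ z → Ex (pour W W′) (_ , st i j e [] [] (codes w ʳ++ []) [] m m′ f [] g a) 0F (_ , st i j e [] [] [] z m m′ f [] g a))
              (Data.List.Properties.reverse-involutive (codes w))
              (pour-ex viewWW′
                 (codes w ʳ++ []) [] (≤-trans (≤-reflexive (trans (+-identityʳ _) (trans (length-ʳ++′ (codes w) []) (+-identityʳ _)))) le)))
            ⨾ loop ps (≤-trans (s≤s (≤-trans (length-codes w) le)) H<B)

      idle : (i j e : List Bool) → List Letter → Levels n → (f g a : List Bool) → Regs 13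
      idle i j e w ls f g a = st i j e [] [] (codes w ʳ++ []) [] (flat ls ʳ++ []) [] f [] g a

      flat-snoc : ∀ (ls : Levels n) b S → flat (ls ++ (b , S) ∷ []) ≡ flat ls ++ comp b S
      flat-snoc ls b S = trans (flat-++ ls _) (cong (flat ls ++_) (++-identityʳ (comp b S)))

      module _ {i j e f a : List Bool} (q : Fin 3) (l≤ : length (pick q i j e) ≤ H) (lt : val (pick q i j e) < n) where

        orStep : Subset n → Marks → Marks → Set
        orStep b (m , m′ , g) (n , n′ , k) = Σ[ S ∈ Vec Bool _ ] Σ[ y ∈ Bool ]
          m′ ≡ comp b S ++ n′ × g ≡ y ∷ [] × n ≡ comp b (proj₁ (orAt (val (pick q i j e)) y b S)) ʳ++ m ×
          k ≡ proj₂ (orAt (val (pick q i j e)) y b S) ∷ [] × length (comp b S) + length m ≤ H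

        or-visits : Visits (bagOr (sel q)) orStep i j e f a
        or-visits {b} {m} p r w w′ (S , y , refl , refl , refl , refl , le) = bagOr-ex q b S p r y m _ l≤ lt le

        open Visiting (bagOr (sel q)) orStep {i} {j} {e} {f} {a} or-visits

        walk-chain : ∀ (ls : Levels n) y m m′ → length (flat ls) + length m ≤ H →
          Chain (bags ls) (m , flat ls ++ m′ , y ∷ [])
            (flat (proj₁ (walkL (val (pick q i j e)) y ls)) ʳ++ m , m′ , proj₂ (walkL (val (pick q i j e)) y ls) ∷ [])
        walk-chain [] y m m′ le = []
        walk-chain ((b , S) ∷ ls) y m m′ le =
          (S , y , ++-assoc (comp b S) (flat ls) m′ , refl , refl , refl ,
            ≤-trans (+-monoˡ-≤ (length m) (≤-trans (m≤m+n _ _) (≤-reflexive (sym (length-++ (comp b S)))))) le) ∷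
          subst (λ z → Chain (bags ls) (comp b S′ ʳ++ m , flat ls ++ m′ , proj₂ (orAt (val (pick q i j e)) y b S) ∷ []) (z , m′ , _)) (sym (++-ʳ++ (comp b (proj₁ (orAt (val (pick q i j e)) y b S)))))
            (walk-chain ls (proj₂ (orAt (val (pick q i j e)) y b S)) _ m′ le′)
          where
          S′ = proj₁ (orAt (val (pick q i j e)) y b S)
          le′ : length (flat ls) + length (comp b S′ ʳ++ m) ≤ H
          le′ = ≤-trans (≤-reflexive (trans (cong (length (flat ls) +_) (trans (length-ʳ++′ (comp b S′) m)
                   (cong (_+ length m) (length-comp b S′ S))))
                 (trans (sym (+-assoc (length (flat ls)) _ _)) (cong (_+ length m) (trans (+-comm (length (flat ls)) _) (sym (length-++ (comp b S)))))))) le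

        walk-ex : ∀ {w bs b l r} → Branch t₀ w bs (node b l r) → ∀ ls → bags ls ≡ bs ++ b ∷ [] →
          length (codes w) ≤ H → length (flat ls) ≤ H → ∀ y →
          Run (walk (sel q)) (idle i j e w ls f (y ∷ []) a) 0F
              (idle i j e w (proj₁ (walkL (val (pick q i j e)) y ls)) f (proj₂ (walkL (val (pick q i j e)) y ls) ∷ []) a)
        walk-ex {w} {bs} {b} {l} {r} br ls bs≡ w≤ ls≤ y on with unsnoc ls bs b bs≡
        ... | ls₁ , S , refl , refl with route-ex br (walk-chain ls₁ y [] (comp b S) le₁) w≤ on
          where
          le₁ : length (flat ls₁) + 0 ≤ H
          le₁ = ≤-trans (+-monoʳ-≤ (length (flat ls₁)) z≤n) (≤-trans (≤-reflexive (sym (trans (cong length (flat-snoc ls₁ b S)) (length-++ (flat ls₁))))) ls≤)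
        ...   | p′ , r′ , on′ , ex = _ , on″ ,
          fold-walk ((subst (λ z → Ex (pour Mk Mk′) (_ , idle i j e w (ls₁ ++ (b , S) ∷ []) f (y ∷ []) a) 0F
                         (_ , st i j e [] [] (codes w ʳ++ []) [] [] z f [] (y ∷ []) a))
             (trans (Data.List.Properties.reverse-involutive (flat (ls₁ ++ (b , S) ∷ []))) (flat-snoc ls₁ b S))
             (pour-ex viewMM′ (flat (ls₁ ++ (b , S) ∷ []) ʳ++ []) []
               (≤-trans (≤-reflexive (trans (+-identityʳ _) (trans (length-ʳ++′ (flat (ls₁ ++ (b , S) ∷ [])) []) (+-identityʳ _)))) ls≤))
           ⨾ ex)
           ⨾ final)
          where
          cv = val (pick q i j e)
          ls₁′ = proj₁ (walkL cv y ls₁)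
          y′ = proj₂ (walkL cv y ls₁)
          on″ : (encSubset b ʳ++ (sNode ∷ p′) , encTree l ++ encTree r ++ r′) On x
          on″ = trans (ʳ++-ʳ++ (encSubset b) (sNode ∷ p′) _) (trans (cong (p′ ʳ++_) (sym (encTree-++ b l r r′))) on′)
          marks≡ : comp b (proj₁ (orAt cv y′ b S)) ʳ++ (flat ls₁′ ʳ++ []) ≡ flat (proj₁ (walkL cv y (ls₁ ++ (b , S) ∷ []))) ʳ++ []
          marks≡ = trans (sym (++-ʳ++ (flat ls₁′))) (cong (_ʳ++ [])
            (trans (sym (flat-snoc ls₁′ b _)) (cong (flat ∘ proj₁) (sym (walkL-++ cv y ls₁ b S)))))
          flag≡ : proj₂ (orAt cv y′ b S) ≡ proj₂ (walkL cv y (ls₁ ++ (b , S) ∷ []))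
          flag≡ = cong proj₂ (sym (walkL-++ cv y ls₁ b S))
          le₂ : length (comp b S) + length (flat ls₁′ ʳ++ []) ≤ H
          le₂ = ≤-trans (≤-reflexive (trans (cong (length (comp b S) +_) (trans (length-ʳ++′ (flat ls₁′) []) (trans (+-identityʳ _) (flat-length ls₁′ ls₁ (bags-walkL cv y ls₁)))))
                  (trans (+-comm (length (comp b S)) _) (sym (trans (cong length (flat-snoc ls₁ b S)) (length-++ (flat ls₁))))))) ls≤
          h″ : Head
          h″ = encSubset b ʳ++ (sNode ∷ p′) , encTree l ++ encTree r ++ r′
          before : List Bool → Regs 13
          before z = st i j e [] [] (codes w ʳ++ []) [] (flat ls₁′ ʳ++ []) z f [] (y′ ∷ []) a
          final : Ex (bagOr (sel q)) ((p′ , encTree (node b l r) ++ r′) , before (comp b S)) 0F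
                     (h″ , idle i j e w (proj₁ (walkL cv y (ls₁ ++ (b , S) ∷ []))) f (proj₂ (walkL cv y (ls₁ ++ (b , S) ∷ [])) ∷ []) a)
          final = subst₂ (λ z ρ → Ex (bagOr (sel q)) ((p′ , z) , before (comp b S)) 0F (h″ , ρ))
            (sym (encTree-++ b l r r′)) (cong₂ (λ z k → st i j e [] [] (codes w ʳ++ []) [] z [] f [] (k ∷ []) a) marks≡ flag≡)
            (subst (λ z → Ex (bagOr (sel q)) ((p′ , sNode ∷ encSubset b ++ encTree l ++ encTree r ++ r′) , before z) 0F
                  (h″ , st i j e [] [] (codes w ʳ++ []) [] (comp b (proj₁ (orAt cv y′ b S)) ʳ++ (flat ls₁′ ʳ++ [])) [] f [] (proj₂ (orAt cv y′ b S) ∷ []) a))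
              (++-identityʳ (comp b S)) (bagOr-ex q b S p′ (encTree l ++ encTree r ++ r′) y′ (flat ls₁′ ʳ++ []) [] l≤ lt le₂))

        reached : List Bool
        reached = if val (pick q i j e) ≡ᵇ toℕ v then true ∷ [] else a

        mark-ex : ∀ {w bs b l r} → Branch t₀ w bs (node b l r) → ∀ ls → bags ls ≡ bs ++ b ∷ [] →
          length (codes w) ≤ H → length (flat ls) ≤ H → length a ≤ H →
          Run (mark (sel q)) (idle i j e w ls f (true ∷ []) a) 0F
              (idle i j e w (proj₁ (walkL (val (pick q i j e)) true ls)) f (true ∷ []) reached)
        mark-ex {w} br ls bs≡ w≤ ls≤ a≤ {h₀} on =
          let (h₁ , on₁ , ex₁) = walk-ex br ls bs≡ w≤ ls≤ true {h₀} on
              (h₂ , on₂ , ex₂) = equals-ex {i} {j} {e} {codes w ʳ++ []} {[]} {marks ʳ++ []} {[]} {f} {[]} {true ∷ []} {a} q v-left (toℕ v) [] l≤ (toℕ<B v)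
          in h₂ , trans on₂ (trans (cong (v-left ʳ++_) (++-identityʳ (encNat (toℕ v)))) v-On) , fold-mark
            (((subst (λ y → Ex (walk (sel q)) (h₀ , idle i j e w ls f (true ∷ []) a) 0F (h₁ , after (y ∷ []) a)) (walkL-true cv ls) ex₁
               ⨾ vField-ex {h₁} on₁)
              ⨾ subst (λ z → Ex (equals (sel q)) ((v-left , z) , after (true ∷ []) a) (isYes (cv ≡ᵇ toℕ v)) (h₂ , after (true ∷ []) a))
                  (++-identityʳ (encNat (toℕ v))) ex₂)
             ⨾ flag (cv ≡ᵇ toℕ v))
          where
          cv : ℕ
          cv = val (pick q i j e)
          marks : List Bool
          marks = flat (proj₁ (walkL cv true ls))
          after : List Bool → List Bool → Regs 13
          after y z = st i j e [] [] (codes w ʳ++ []) [] (marks ʳ++ []) [] f [] y z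
          flag : ∀ b {h} → Ex (case2 skip (clear A >> push A true) (isYes b)) (h , after (true ∷ []) a) 0F
                              (h , after (true ∷ []) (if b then true ∷ [] else a))
          flag true = clear-ex viewA a a≤ ⨾ push (≤-<-trans z≤n height<H)
          flag false = ret

      module _ {i j e f a : List Bool} where

        Same : Subset n → Marks → Marks → Set
        Same _ = _≡_

        skip-visits : Visits skipSep Same i j e f a
        skip-visits {b} p r w w′ refl = skipBag-ex b p r

        open Visiting skipSep Same {i} {j} {e} {f} {a} skip-visits

        still : ∀ bs {X} → Chain bs X X
        still [] = []
        still (b ∷ bs) = refl ∷ still bs

        goto-ex : ∀ {w bs t′ m m′ g} → Branch t₀ w bs t′ → length (codes w) ≤ H → ∀ {h} → h On x →
          Σ[ p′ ∈ List Sym ] Σ[ r′ ∈ List Sym ] (p′ , encTree t′ ++ r′) On x ×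
          Ex (route skipSep) (h , st i j e [] [] (codes w ʳ++ []) [] m m′ f [] g a) 0F
              ((p′ , encTree t′ ++ r′) , st i j e [] [] (codes w ʳ++ []) [] m m′ f [] g a)
        goto-ex {bs = bs} br w≤ on = route-ex br (still bs) w≤ on

        grow-loop : ∀ {k} (b : Subset k) p y r m {w w′ m′ g} → length (comp b (fresh k)) + length m ≤ H → Σ[ h ∈ Head ] h On (p ʳ++ (y ∷ bits b ++ sSep ∷ r)) ×
          Rep {1} (move mR >> read >>= case6 (ret 0F) (push Mk false >> ret 0F) (ret 1F) (ret 1F) (ret 1F) (ret 1F))
            ((p , y ∷ bits b ++ sSep ∷ r) , st i j e [] [] w w′ m m′ f [] g a) 0F
            (h , st i j e [] [] w w′ (comp b (fresh k) ʳ++ m) m′ f [] g a) (suc k)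
        grow-loop [] p y r m le = _ , refl , stop ((move ⨾ read) ⨾ ret)
        grow-loop (false ∷ b) p y r m le with grow-loop b (y ∷ p) s0 r m le
        ... | h , on , ps = h , on , more ((move ⨾ read) ⨾ ret) ps
        grow-loop (true ∷ b) p y r m le with grow-loop b (y ∷ p) s1 r (false ∷ m) (≤-trans (≤-reflexive (+-suc _ _)) le)
        ... | h , on , ps = h , on , more ((move ⨾ read) ⨾ push (≤-trans (s≤s (m≤n+m _ (length (comp b (fresh _))))) le) ⨾ ret) ps

        shrink-loop : ∀ {k} (b : Subset k) (S : Vec Bool k) p y r l m {w w′ m′ g} → length l ≡ length (comp b S) → Σ[ h ∈ Head ] h On (p ʳ++ (y ∷ bits b ++ sSep ∷ r)) ×
          Rep {1} (move mR >> read >>= case6 (ret 0F) ((pop Mk >>= λ _ → skip) >> ret 0F) (ret 1F) (ret 1F) (ret 1F) (ret 1F))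
            ((p , y ∷ bits b ++ sSep ∷ r) , st i j e [] [] w w′ (l ++ m) m′ f [] g a) 0F
            (h , st i j e [] [] w w′ m m′ f [] g a) (suc k)
        shrink-loop [] [] p y r [] m le = _ , refl , stop ((move ⨾ read) ⨾ ret)
        shrink-loop (false ∷ b) (_ ∷ S) p y r l m le with shrink-loop b S (y ∷ p) s0 r l m le
        ... | h , on , ps = h , on , more ((move ⨾ read) ⨾ ret) ps
        shrink-loop (true ∷ b) (_ ∷ S) p y r (_ ∷ l) m le with shrink-loop b S (y ∷ p) s1 r l m (suc-injective le)
        ... | h , on , ps = h , on , more ((move ⨾ read) ⨾ (pop ⨾ ret) ⨾ ret) ps

        enter-node : ∀ {w bs b l r} → Branch t₀ w bs (node b l r) → ∀ ls {g} → length (codes w) ≤ H →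
          length (flat (ls ++ (b , fresh n) ∷ [])) ≤ H →
          Run enterBag (idle i j e w ls f g a) 1F (idle i j e w (ls ++ (b , fresh n) ∷ []) f g a)
        enter-node {w} {bs} {b} {l} {r} br ls {g} w≤ ls≤ on =
          let (p , s , on′ , ex) = goto-ex {m = flat ls ʳ++ []} {m′ = []} {g = g} br w≤ on
              (h , on″ , ps) = grow-loop b p sNode (encTree l ++ encTree r ++ s) (flat ls ʳ++ []) {codes w ʳ++ []} {[]} {[]} {g} le
          in h , trans on″ (trans (cong (p ʳ++_) (node-shape b l r s)) on′) ,
            fold-enterBag ((ex ⨾ read) ⨾ subst₂ (λ z y → Ex (eachMember (push Mk false)) ((p , z) , idle i j e w ls f g a) 0F (h , st i j e [] [] (codes w ʳ++ []) [] y [] f [] g a))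
              (node-shape b l r s) (trans (sym (++-ʳ++ (flat ls))) (cong (_ʳ++ []) (sym (flat-snoc ls b (fresh n)))))
              (loop ps n<B) ⨾ ret)
          where
          le : length (comp b (fresh n)) + length (flat ls ʳ++ []) ≤ H
          le = ≤-trans (≤-reflexive (trans (cong (length (comp b (fresh n)) +_) (trans (length-ʳ++′ (flat ls) []) (+-identityʳ _)))
                 (trans (+-comm (length (comp b (fresh n))) _) (sym (trans (cong length (flat-snoc ls b (fresh n))) (length-++ (flat ls))))))) ls≤

        enter-tip : ∀ {w bs} → Branch t₀ w bs tip → ∀ ls {g} → length (codes w) ≤ H →
          Run enterBag (idle i j e w ls f g a) 0F (idle i j e w ls f g a)
        enter-tip {w} br ls {g} w≤ on = let (p , s , on′ , ex) = goto-ex {m = flat ls ʳ++ []} {m′ = []} {g = g} br w≤ on in _ , on′ , fold-enterBag ((ex ⨾ read) ⨾ ret)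

        leave-ex : ∀ {w bs b l r} → Branch t₀ w bs (node b l r) → ∀ ls S {g} → length (codes w) ≤ H →
          Run leaveBag (idle i j e w (ls ++ (b , S) ∷ []) f g a) 0F (idle i j e w ls f g a)
        leave-ex {w} {bs} {b} {l} {r} br ls S {g} w≤ on =
          let (p , s , on′ , ex) = goto-ex {m = flat (ls ++ (b , S) ∷ []) ʳ++ []} {m′ = []} {g = g} br w≤ on
              (h , on″ , ps) = shrink-loop b S p sNode (encTree l ++ encTree r ++ s) (comp b S ʳ++ []) (flat ls ʳ++ []) {codes w ʳ++ []} {[]} {[]} {g}
                                 (trans (length-ʳ++′ (comp b S) []) (+-identityʳ _))
          in h , trans on″ (trans (cong (p ʳ++_) (node-shape b l r s)) on′) ,
            fold-leaveBag (ex ⨾ subst₂ (λ z y → Ex (eachMember (pop Mk >>= λ _ → skip)) ((p , z) , st i j e [] [] (codes w ʳ++ []) [] y [] f [] g a) 0F (h , idle i j e w ls f g a))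
              (node-shape b l r s) marks≡ (loop ps n<B))
          where
          marks≡ : (comp b S ʳ++ []) ++ (flat ls ʳ++ []) ≡ flat (ls ++ (b , S) ∷ []) ʳ++ []
          marks≡ = trans (sym (Data.List.Properties.ʳ++-defn (comp b S))) (trans (sym (++-ʳ++ (flat ls))) (cong (_ʳ++ []) (sym (flat-snoc ls b S))))

      -- Propagation of marks along the edges

      module Spread (b₀ : Subset n) (l₀ r₀ : BT n) (t₀≡ : t₀ ≡ node b₀ l₀ r₀)
                    (counter : ∀ m → m ≤ n * n → length (cnt m) ≤ H) where

        root-shape : ∀ s → encTree t₀ ++ s ≡ sNode ∷ encSubset b₀ ++ encTree l₀ ++ encTree r₀ ++ s
        root-shape s = trans (cong (λ t → encTree t ++ s) t₀≡) (encTree-++ b₀ l₀ r₀ s)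

        n≤n² : n ≤ n * n
        n≤n² = m≤m*n n n {{>-nonZero (≤-<-trans z≤n (toℕ<n u))}}

        counter′ : ∀ m → m ≤ n → length (cnt m) ≤ H
        counter′ m le = counter m (≤-trans le n≤n²)

        accL≤ : ∀ a → length (accL a) ≤ H
        accL≤ true = ≤-<-trans z≤n height<H
        accL≤ false = z≤n

        split-entries : ∀ i j → Σ[ s ∈ List Sym ] Σ[ r ∈ List Sym ] entries ≡ s ++ bit (𝒢 i j) ∷ r × length s ≡ toℕ i * n + toℕ j
        split-entries i j with split-tabulate id i | split-tabulate id j
        ... | s , r , e , e′ | s₂ , r₂ , e₂ , e₂′ = concatMap row s ++ map cel s₂ , map cel r₂ ++ concatMap row r ,
          trans (cong (concatMap row) e) (trans (concatMap-++ row s (i ∷ r))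
            (trans (cong (λ z → concatMap row s ++ map cel z ++ concatMap row r) e₂)
            (trans (cong (λ z → concatMap row s ++ z ++ concatMap row r) (map-++ cel s₂ (j ∷ r₂)))
            (trans (cong (concatMap row s ++_) (++-assoc (map cel s₂) _ _)) (sym (++-assoc (concatMap row s) _ _)))))) ,
          trans (length-++ (concatMap row s)) (cong₂ _+_
            (trans (length-concatMap row n (λ i → trans (length-map _ (allFin n)) (length-tabulate id)) s) (cong (_* n) e′))
            (trans (length-map cel s₂) e₂′))
          where
          row : Fin n → List Sym
          row i = map (λ j → bit (𝒢 i j)) (allFin n)
          cel : Fin n → Sym
          cel j = bit (𝒢 i j)

        Sound : Levels n → Bool → Set
        Sound ls a = (∀ z → Marked ls z → Reach 𝒢 u z) × (a ≡ true → Reach 𝒢 u v)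

        Source : Levels n → Fin n → Set
        Source ls z = z ≡ u ⊎ Marked ls z

        Done : Levels n → Bool → Fin n → Set
        Done ls a z = Full ls z × (z ≡ v → a ≡ true)

        -- Soundness is an implication from the earlier to the later marks. Steps can thus be
        -- chained first and applied once, to the unmarked initial state.
        record Better (ls : Levels n) (a : Bool) (ls′ : Levels n) (a′ : Bool) : Set where
          constructor better
          field
            grow : Grow ls ls′
            keep : a ≡ true → a′ ≡ true
            sound : Sound ls a → Sound ls′ a′
        open Better

        better-refl : ∀ {ls a} → Better ls a ls a
        better-refl = better grow-refl id id

        better-trans : ∀ {ls a ls′ a′ ls″ a″} → Better ls a ls′ a′ → Better ls′ a′ ls″ a″ → Better ls a ls″ a″
        better-trans p q = better (grow-trans (grow p) (grow q)) (keep q ∘ keep p) (sound q ∘ sound p)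

        done-mono : ∀ {ls a ls′ a′ z} → Better ls a ls′ a′ → Done ls a z → Done ls′ a′ z
        done-mono p (fl , ac) = full-grow (grow p) fl , keep p ∘ ac

        source-mono : ∀ {ls a ls′ a′ z} → Better ls a ls′ a′ → Source ls z → Source ls′ z
        source-mono p (inj₁ e) = inj₁ e
        source-mono p (inj₂ m) = inj₂ (marked-grow (grow p) m)

        source-reach : ∀ {ls a z} → Sound ls a → Source ls z → Reach 𝒢 u z
        source-reach sd (inj₁ refl) = ε
        source-reach sd (inj₂ m) = proj₁ sd _ m

        mark-better : ∀ z ls a → (Sound ls a → Reach 𝒢 u z) →
          Better ls a (proj₁ (walkL (toℕ z) true ls)) ((toℕ z ≡ᵇ toℕ v) ∨ a) ×
          Done (proj₁ (walkL (toℕ z) true ls)) ((toℕ z ≡ᵇ toℕ v) ∨ a) z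
        mark-better z ls a re = better (walkL-grow (toℕ z) true ls) (∨-right (toℕ z ≡ᵇ toℕ v)) sd ,
          walkL-full z ls , λ { refl → ∨-left a (≡ᵇ-refl (toℕ z)) }
          where
          sd : Sound ls a → Sound (proj₁ (walkL (toℕ z) true ls)) ((toℕ z ≡ᵇ toℕ v) ∨ a)
          sd so = marks , flag
            where
            marks : ∀ z′ → Marked (proj₁ (walkL (toℕ z) true ls)) z′ → Reach 𝒢 u z′
            marks z′ m with walkL-sound z true ls m
            ... | inj₁ m′ = proj₁ so z′ m′
            ... | inj₂ (refl , _) = re so
            flag : (toℕ z ≡ᵇ toℕ v) ∨ a ≡ true → Reach 𝒢 u v
            flag e with ∨-true (toℕ z ≡ᵇ toℕ v) a e
            ... | inj₁ e′ = subst (Reach 𝒢 u) (≡ᵇ-sound z v e′) (re so)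
            ... | inj₂ e′ = proj₂ so e′

        module _ {w : List Letter} {bs b l r} (br : Branch t₀ w bs (node b l r)) (w≤ : length (codes w) ≤ H)
                 {f : List Bool} where

          record Stage : Set where
            constructor stage
            field
              cntI cntJ cntE : List Bool
              lvl : Levels n
              acc : Bool
          open Stage

          at : Stage → List Bool → Regs 13
          at s g = idle (cntI s) (cntJ s) (cntE s) w (lvl s) f g (accL (acc s))

          Fits : Levels n → Set
          Fits ls = bags ls ≡ bs ++ b ∷ [] × length (flat ls) ≤ H

          fits-grow : ∀ {ls ls′} → Grow ls ls′ → Fits ls → Fits ls′
          fits-grow gr (e , le) = trans (grow-bags gr) e , subst (_≤ H) (flat-length _ _ (sym (grow-bags gr))) le

          -- The loop rule for `eachIndex`, with `P k` as the invariant before round `k`. The final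
          -- stage is given before any head position, because later stages have to be named
          -- independently of it.
          module _ (q : Fin 3) (c : Com 1) (g : List Bool) (P : ℕ → Stage → Set)
            (index : ∀ {k s} → P k s → pick q (cntI s) (cntJ s) (cntE s) ≡ cnt k)
            (body : ∀ (k : Fin n) s → P (toℕ k) s → Σ[ s′ ∈ Stage ] P (suc (toℕ k)) s′ × Run c (at s g) 0F (at s′ g)) where

            indexStep : Com 2
            indexStep = root >> move mR >> seek (sel q) >> read >>= case6 (c >> ret 0F) (c >> ret 0F) (ret 1F) (ret 1F) (ret 1F) (ret 1F)

            probe : ∀ {k s z r′} sy → P k s → k ≤ n → encTree t₀ ++ fields ≡ sNode ∷ z ++ sy ∷ r′ → length z ≡ k → ∀ {h} → h On x →
              Σ[ h′ ∈ Head ] h′ On x × Ex (root >> move mR >> seek (sel q) >> read) (h , at s g) (symIx (just sy)) (h′ , at s g)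
            probe {k} {s} {z} {r′} sy p k≤ e lz on = _ , on′ ,
              ((root-ex on ⨾ subst (λ y → Ex (move mR) ((root-left , y) , at s g) 0F ((sNode ∷ root-left , z ++ sy ∷ r′) , at s g)) (sym e) move)
               ⨾ seek-ex q (sNode ∷ root-left) z (sy ∷ r′) (trans (cong val (index p)) (trans (val-cnt k) (sym lz)))
                    (subst (λ l → length l ≤ H) (sym (index p)) (counter′ k k≤)) (subst (_< B) (sym lz) (≤-<-trans k≤ n<B))) ⨾ read
              where
              on′ : (z ʳ++ (sNode ∷ root-left) , sy ∷ r′) On x
              on′ = trans (ʳ++-ʳ++ z (sNode ∷ root-left) _) (trans (cong (root-left ʳ++_) (sym e)) root-On)

            index-loop : ∀ d k s → k + d ≡ n → P k s → Σ[ s′ ∈ Stage ] P n s′ × (∀ {h} → h On x →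
              Σ[ h′ ∈ Head ] h′ On x × Rep indexStep (h , at s g) 0F (h′ , at s′ g) (suc d))
            index-loop zero k s e p with refl ← trans (sym (+-identityʳ k)) e = s , p , λ on →
              let (h′ , on′ , ex) = probe {z = bits b₀} sSep p ≤-refl
                    (trans (root-shape fields) (cong (sNode ∷_) (++-assoc (bits b₀) _ _)))
                    (trans (length-map bit (toList b₀)) (length-toList b₀)) on
              in h′ , on′ , stop (ex ⨾ ret)
            index-loop (suc d) k s e p = one (fromℕ< k<n) (toℕ-fromℕ< k<n)
              where
              k<n : k < n
              k<n = ≤-trans (s≤s (m≤m+n k d)) (≤-reflexive (trans (sym (+-suc k d)) e))
              one : ∀ (κ : Fin n) → toℕ κ ≡ k → Σ[ s′ ∈ Stage ] P n s′ × (∀ {h} → h On x →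
                Σ[ h′ ∈ Head ] h′ On x × Rep indexStep (h , at s g) 0F (h′ , at s′ g) (suc (suc d)))
              one κ refl with split-bits b₀ κ | body κ s p
              ... | z , r′ , e′ , lz | s₁ , p₁ , run₁ with index-loop d (suc k) s₁ (trans (sym (+-suc k d)) e) p₁
              ...   | s₂ , p₂ , run₂ = s₂ , p₂ , λ on →
                let (h₁ , on₁ , ex₁) = probe {z = z} (bit (lookup b₀ κ)) p (<⇒≤ k<n) shape lz on
                    (h₂ , on₂ , ex₂) = run₁ on₁
                    (h₃ , on₃ , ps) = run₂ on₂
                in h₃ , on₃ , more (ex₁ ⨾ either (lookup b₀ κ) ex₂) ps
                where
                shape : encTree t₀ ++ fields ≡ sNode ∷ z ++ bit (lookup b₀ κ) ∷ (r′ ++ sSep ∷ encTree l₀ ++ encTree r₀ ++ fields)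
                shape = trans (root-shape fields) (cong (sNode ∷_) (trans (++-assoc (bits b₀) _ _)
                  (trans (cong (_++ sSep ∷ encTree l₀ ++ encTree r₀ ++ fields) e′) (++-assoc z _ _))))
                either : ∀ β {h h′ : Head} {ρ ρ′} → Ex c (h , ρ) 0F (h′ , ρ′) →
                  Ex {2} (case6 (c >> ret 0F) (c >> ret 0F) (ret 1F) (ret 1F) (ret 1F) (ret 1F) (symIx (just (bit β)))) (h , ρ) 0F (h′ , ρ′)
                either true ex = ex ⨾ ret
                either false ex = ex ⨾ ret

            abstract
              index-ex : ∀ s → P 0 s → Σ[ s′ ∈ Stage ] P n s′ × Run (repeat indexStep) (at s g) 0F (at s′ g)
              index-ex s p with index-loop n 0 s refl p
              ... | s′ , p′ , run = s′ , p′ , λ on → let (h′ , on′ , ps) = run on in h′ , on′ , loop ps n<B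

          accL-reached : ∀ c a → (if c then true ∷ [] else accL a) ≡ accL (c ∨ a)
          accL-reached true a = refl
          accL-reached false a = refl

          mark-run : ∀ q z s → pick q (cntI s) (cntJ s) (cntE s) ≡ cnt (toℕ z) → Fits (lvl s) →
            Run (mark (sel q)) (at s (true ∷ [])) 0F
                (at (record s { lvl = proj₁ (walkL (toℕ z) true (lvl s)) ; acc = (toℕ z ≡ᵇ toℕ v) ∨ acc s }) (true ∷ []))
          mark-run q z s e (be , fl) = subst₂ (λ c a → Run (mark (sel q)) (at s (true ∷ [])) 0F
              (idle (cntI s) (cntJ s) (cntE s) w (proj₁ (walkL c true (lvl s))) f (true ∷ []) a)) v≡
              (trans (cong (λ c → if c ≡ᵇ toℕ v then true ∷ [] else accL (acc s)) v≡) (accL-reached (toℕ z ≡ᵇ toℕ v) (acc s)))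
              (mark-ex q (subst (λ l → length l ≤ H) (sym e) (counter′ (toℕ z) (<⇒≤ (toℕ<n z))))
                 (subst (_< n) (sym v≡) (toℕ<n z)) br (lvl s) be w≤ fl (accL≤ (acc s)))
            where
            v≡ : val (pick q (cntI s) (cntJ s) (cntE s)) ≡ toℕ z
            v≡ = trans (cong val e) (val-cnt (toℕ z))

          walk-run : ∀ z s g → cntI s ≡ cnt (toℕ z) → Fits (lvl s) →
            Run (walk I) (at s (g ∷ [])) 0F
                (at (record s { lvl = proj₁ (walkL (toℕ z) g (lvl s)) }) (proj₂ (walkL (toℕ z) g (lvl s)) ∷ []))
          walk-run z s g e (be , fl) = subst (λ c → Run (walk I) (at s (g ∷ [])) 0F
              (idle (cntI s) (cntJ s) (cntE s) w (proj₁ (walkL c g (lvl s))) f (proj₂ (walkL c g (lvl s)) ∷ []) (accL (acc s)))) v≡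
              (walk-ex 0F (subst (λ l → length l ≤ H) (sym e) (counter′ (toℕ z) (<⇒≤ (toℕ<n z))))
                 (subst (_< n) (sym v≡) (toℕ<n z)) br (lvl s) be w≤ fl g)
            where
            v≡ : val (cntI s) ≡ toℕ z
            v≡ = trans (cong val e) (val-cnt (toℕ z))

          inc-cnt : ∀ k → k < n * n → length (cnt k) < B × length (incL (cnt k)) ≤ H
          inc-cnt k lt = ≤-<-trans (counter k (<⇒≤ lt)) H<B , counter (suc k) lt

          entry< : ∀ (i j : Fin n) → toℕ i * n + toℕ j < n * n
          entry< i j = <-≤-trans (+-monoʳ-< (toℕ i * n) (toℕ<n j)) (≤-trans (≤-reflexive (+-comm _ n)) (*-monoˡ-≤ n (toℕ<n i)))

          InRow : Fin n → Bool → Levels n → Bool → ℕ → Stage → Set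
          InRow i g ls a k (stage ci cj ce ls′ a′) = ci ≡ cnt (toℕ i) × cj ≡ cnt k × ce ≡ cnt (toℕ i * n + k) ×
            Better ls a ls′ a′ × (g ≡ true → ∀ (j : Fin n) → toℕ j < k → Edge 𝒢 i j → Done ls′ a′ j)

          cellStep : Fin 6 → Com 1
          cellStep = case6 skip (ifMarked (mark J)) skip skip skip skip

          cell-ex : ∀ i j g s → cntJ s ≡ cnt (toℕ j) → (g ≡ true → Source (lvl s) i) → Fits (lvl s) →
            Σ[ ls ∈ Levels n ] Σ[ a ∈ Bool ] Better (lvl s) (acc s) ls a × (g ≡ true → Edge 𝒢 i j → Done ls a j) ×
            (∀ {p r} → (p , bit (𝒢 i j) ∷ r) On x → Σ[ h′ ∈ Head ] h′ On x ×
              Ex (cellStep (symIx (just (bit (𝒢 i j))))) ((p , bit (𝒢 i j) ∷ r) , at s (g ∷ [])) 0F (h′ , at (record s { lvl = ls ; acc = a }) (g ∷ [])))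
          cell-ex i j g s cj src ft with 𝒢 i j in ed
          ... | false = lvl s , acc s , better-refl , (λ _ ()) , λ on → _ , on , ret
          cell-ex i j false s cj src ft | true = lvl s , acc s , better-refl , (λ ()) , λ on → _ , on , pop ⨾ push (≤-<-trans z≤n height<H)
          cell-ex i j true s cj src ft | true = _ , _ , proj₁ mb , (λ _ _ → proj₂ mb) , λ on →
              let (h′ , on′ , ex) = mark-run 1F j s cj ft on in h′ , on′ , pop ⨾ push (≤-<-trans z≤n height<H) ⨾ ex
            where mb = mark-better j (lvl s) (acc s) (λ so → source-reach so (src refl) ◅◅ (ed ◅ ε))

          entry-ex : ∀ i g ls a → (g ≡ true → Source ls i) → Fits ls → ∀ (j : Fin n) s → InRow i g ls a (toℕ j) s →
            Σ[ s′ ∈ Stage ] InRow i g ls a (suc (toℕ j)) s′ × Run entryStep (at s (g ∷ [])) 0F (at s′ (g ∷ []))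
          entry-ex i g ls a src ft j s@(stage _ _ _ ls₁ a₁) (refl , refl , refl , bt , dn)
            with cell-ex i j g s refl (source-mono bt ∘ src) (fits-grow (grow bt) ft) | split-entries i j
          ... | ls₂ , a₂ , bt₂ , dn₂ , cell-run | z , r′ , e , lz = stage (cnt (toℕ i)) (cnt (suc (toℕ j))) (cnt (suc (toℕ i * n + toℕ j))) ls₂ a₂ ,
              (refl , refl , cong cnt (sym (+-suc (toℕ i * n) (toℕ j))) , better-trans bt bt₂ , dn′) , outcome
            where
            dn′ : g ≡ true → ∀ j′ → toℕ j′ < suc (toℕ j) → Edge 𝒢 i j′ → Done ls₂ a₂ j′
            dn′ ge j′ lt ed with m≤n⇒m<n∨m≡n (≤-pred lt)
            ... | inj₁ l = done-mono bt₂ (dn ge j′ l ed)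
            ... | inj₂ e with refl ← toℕ-injective e = dn₂ ge ed
            rest : List Sym
            rest = r′ ++ sSep ∷ encTree t₀ ++ fields
            shape : home-right ≡ z ++ bit (𝒢 i j) ∷ rest
            shape = trans (++-assoc entries _ _) (trans (cong (_++ sSep ∷ encTree t₀ ++ fields) e) (++-assoc z _ _))
            on₁ : (z ʳ++ home-left , bit (𝒢 i j) ∷ rest) On x
            on₁ = trans (ʳ++-ʳ++ z home-left _) (trans (cong (home-left ʳ++_) (sym shape)) home-On)
            z<B : length z < B
            z<B = prefix<B {home-left} {z} (trans (cong (home-left ʳ++_) (sym shape)) home-On)
            outcome : Run entryStep (at s (g ∷ [])) 0F (at (stage (cnt (toℕ i)) (cnt (suc (toℕ j))) (cnt (suc (toℕ i * n + toℕ j))) ls₂ a₂) (g ∷ []))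
            outcome on = let (h₂ , on₂ , ex₂) = cell-run on₁ in h₂ , on₂ , fold-entryStep
              (((((subst (λ q → Ex home (_ , at s (g ∷ [])) 0F ((home-left , q) , at s (g ∷ []))) shape (home-ex on)
                 ⨾ seek-ex 2F home-left z (bit (𝒢 i j) ∷ rest) (trans (val-cnt _) (sym lz)) (counter _ (<⇒≤ (entry< i j))) z<B)
                ⨾ read) ⨾ ex₂)
               ⨾ inc-ex viewJT (cnt (toℕ j)) (proj₁ (inc-cnt (toℕ j) j<)) (proj₂ (inc-cnt (toℕ j) j<)))
               ⨾ inc-ex viewET (cnt (toℕ i * n + toℕ j)) (proj₁ (inc-cnt _ (entry< i j))) (proj₂ (inc-cnt _ (entry< i j))))
              where
              j< : toℕ j < n * n
              j< = <-≤-trans (toℕ<n j) n≤n²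

          -- Sources are those of the marks `ls` before the pass: a vertex marked in passing need
          -- not be processed again. One pass promises one edge, which is all that a segment
          -- consisting of an edge asks for.
          AllRows : Levels n → Bool → ℕ → Stage → Set
          AllRows ls a k (stage ci cj ce ls′ a′) = ci ≡ cnt k × cj ≡ [] × ce ≡ cnt (k * n) ×
            Better ls a ls′ a′ × (∀ (i : Fin n) → toℕ i < k → Source ls i → ∀ z → i ≡ z ⊎ Edge 𝒢 i z → Done ls′ a′ z)

          row-ex : ∀ ls a → Fits ls → ∀ (i : Fin n) s → AllRows ls a (toℕ i) s →
            Σ[ s′ ∈ Stage ] AllRows ls a (suc (toℕ i)) s′ × Run rowStep (at s []) 0F (at s′ [])
          row-ex ls a ft i s@(stage _ _ _ ls₁ a₁) (refl , refl , refl , bt , dn) = s₅ ,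
              (refl , refl , cong cnt (+-comm (toℕ i * n) n) , better-trans bt bt₅ , dn′) , outcome
            where
            γ₀ γ : Bool
            γ₀ = toℕ i ≡ᵇ toℕ u
            ls₂ = proj₁ (walkL (toℕ i) γ₀ ls₁)
            γ = proj₂ (walkL (toℕ i) γ₀ ls₁)
            cause : γ₀ ≡ true ⊎ Marked ls₁ i → Source ls₁ i
            cause (inj₁ e) = inj₁ (≡ᵇ-sound i u e)
            cause (inj₂ m) = inj₂ m
            bt₂ : Better ls₁ a₁ ls₂ a₁
            bt₂ = better (walkL-grow (toℕ i) γ₀ ls₁) id (λ so → (λ z m → sd so z m) , proj₂ so)
              where
              sd : Sound ls₁ a₁ → ∀ z → Marked ls₂ z → Reach 𝒢 u z
              sd so z m with walkL-sound i γ₀ ls₁ m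
              ... | inj₁ m′ = proj₁ so z m′
              ... | inj₂ (refl , c) = source-reach so (cause c)
            flagged : Source ls₁ i → γ ≡ true
            flagged (inj₁ refl) = walkL-flag i γ₀ ls₁ (inj₁ (≡ᵇ-refl (toℕ i)))
            flagged (inj₂ m) = walkL-flag i γ₀ ls₁ (inj₂ m)
            src₂ : γ ≡ true → Source ls₂ i
            src₂ e = source-mono bt₂ (cause (walkL-cause i γ₀ ls₁ e))
            s₂ : Stage
            s₂ = stage (cnt (toℕ i)) [] (cnt (toℕ i * n)) ls₂ a₁
            ft₂ : Fits ls₂
            ft₂ = fits-grow (grow (better-trans bt bt₂)) ft
            selfMark : ∀ γ → (γ ≡ true → Source ls₂ i) → Σ[ ls₃ ∈ Levels n ] Σ[ a₃ ∈ Bool ] Better ls₂ a₁ ls₃ a₃ × (γ ≡ true → Done ls₃ a₃ i) ×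
              Run (ifMarked (mark I)) (at s₂ (γ ∷ [])) 0F (at (record s₂ { lvl = ls₃ ; acc = a₃ }) (γ ∷ []))
            selfMark false src = ls₂ , a₁ , better-refl , (λ ()) , λ on → _ , on , pop ⨾ push (≤-<-trans z≤n height<H)
            selfMark true src = _ , _ , proj₁ mb , (λ _ → proj₂ mb) , λ on →
                let (h′ , on′ , ex) = mark-run 0F i s₂ refl ft₂ on in h′ , on′ , pop ⨾ push (≤-<-trans z≤n height<H) ⨾ ex
              where mb = mark-better i ls₂ a₁ (λ so → source-reach so (src refl))
            sm = selfMark γ src₂
            ls₃ = proj₁ sm
            a₃ = proj₁ (proj₂ sm)
            bt₃ : Better ls₂ a₁ ls₃ a₃
            bt₃ = proj₁ (proj₂ (proj₂ sm))
            src₃ : γ ≡ true → Source ls₃ i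
            src₃ = source-mono bt₃ ∘ src₂
            ft₃ : Fits ls₃
            ft₃ = fits-grow (grow bt₃) ft₂
            cols = index-ex 1F entryStep (γ ∷ []) (InRow i γ ls₃ a₃) (λ { (_ , cj , _) → cj }) (λ j s p → entry-ex i γ ls₃ a₃ src₃ ft₃ j s p)
              (stage (cnt (toℕ i)) [] (cnt (toℕ i * n)) ls₃ a₃) (refl , refl , cong cnt (sym (+-identityʳ (toℕ i * n))) , better-refl , λ _ _ ())
            s₄ : Stage
            s₄ = proj₁ cols
            in₄ : InRow i γ ls₃ a₃ n s₄
            in₄ = proj₁ (proj₂ cols)
            bt₄ : Better ls₃ a₃ (lvl s₄) (acc s₄)
            bt₄ = proj₁ (proj₂ (proj₂ (proj₂ in₄)))
            bt₅ : Better ls₁ a₁ (lvl s₄) (acc s₄)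
            bt₅ = better-trans bt₂ (better-trans bt₃ bt₄)
            s₅ : Stage
            s₅ = stage (cnt (suc (toℕ i))) [] (cnt (toℕ i * n + n)) (lvl s₄) (acc s₄)
            here-done : Source ls i → ∀ z → i ≡ z ⊎ Edge 𝒢 i z → Done (lvl s₄) (acc s₄) z
            here-done src z (inj₁ e) = subst (Done (lvl s₄) (acc s₄)) e (done-mono bt₄ (proj₁ (proj₂ (proj₂ (proj₂ sm))) (flagged (source-mono bt src))))
            here-done src z (inj₂ ed) = proj₂ (proj₂ (proj₂ (proj₂ in₄))) (flagged (source-mono bt src)) z (toℕ<n z) ed
            dn′ : ∀ i′ → toℕ i′ < suc (toℕ i) → Source ls i′ → ∀ z → i′ ≡ z ⊎ Edge 𝒢 i′ z → Done (lvl s₄) (acc s₄) z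
            dn′ i′ lt src z hyp = [ (λ l → done-mono bt₅ (dn i′ l src z hyp)) ,
              (λ e → here-done (subst (Source ls) (toℕ-injective e) src) z (subst (λ q → q ≡ z ⊎ Edge 𝒢 q z) (toℕ-injective e) hyp)) ]′
              (m≤n⇒m<n∨m≡n (≤-pred lt))
            i< : toℕ i < n * n
            i< = <-≤-trans (toℕ<n i) n≤n²
            start : ∀ {h} → Ex (case2 (push G false) (push G true) (isYes (val (cnt (toℕ i)) ≡ᵇ toℕ u))) (h , at s []) 0F (h , at s (γ₀ ∷ []))
            start rewrite val-cnt (toℕ i) with toℕ i ≡ᵇ toℕ u
            ... | true = push (≤-<-trans z≤n height<H)
            ... | false = push (≤-<-trans z≤n height<H)
            cleared : Stage
            cleared = record s₄ { cntJ = [] }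
            wipe-J : ∀ {h} → Ex (clear J) (h , at s₄ (γ ∷ [])) 0F (h , at cleared (γ ∷ []))
            wipe-J = clear-ex viewJ (cntJ s₄) (subst (λ l → length l ≤ H) (sym (proj₁ (proj₂ in₄))) (counter′ n ≤-refl))
            wipe-G : ∀ {h} → Ex (clear G) (h , at cleared (γ ∷ [])) 0F (h , at cleared [])
            wipe-G = clear-ex viewG (γ ∷ []) (≤-<-trans z≤n height<H)
            bump : ∀ {h} → Ex (inc I) (h , at cleared []) 0F (h , at s₅ [])
            bump {h} = subst₂ (λ p q → Ex (inc I) (h , at cleared []) 0F (h , at (stage p [] q (lvl s₄) (acc s₄)) []))
              (cong incL (proj₁ in₄)) (proj₁ (proj₂ (proj₂ in₄)))
              (inc-ex viewIT (cntI s₄) (subst (λ l → length l < B) (sym (proj₁ in₄)) (proj₁ (inc-cnt _ i<)))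
                                     (subst (λ l → length (incL l) ≤ H) (sym (proj₁ in₄)) (proj₂ (inc-cnt _ i<))))
            outcome : Run rowStep (at s []) 0F (at s₅ [])
            outcome on =
              let (h₁ , on₁ , ex₁) = equals-ex {cnt (toℕ i)} {[]} {cnt (toℕ i * n)} {codes w ʳ++ []} {[]} {flat ls₁ ʳ++ []} {[]} {f} {[]} {[]} {accL a₁}
                          0F u-left (toℕ u) (encNat (toℕ v)) (counter′ (toℕ i) (<⇒≤ (toℕ<n i))) (toℕ<B u)
                  (h₂ , on₂ , ex₂) = walk-run i s γ₀ refl (fits-grow (grow bt) ft) (trans on₁ u-On)
                  (h₃ , on₃ , ex₃) = proj₂ (proj₂ (proj₂ (proj₂ sm))) on₂
                  (h₄ , on₄ , ex₄) = proj₂ (proj₂ cols) on₃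
              in h₄ , on₄ , fold-rowStep (((((((uField-ex on ⨾ ex₁) ⨾ start) ⨾ ex₂) ⨾ ex₃) ⨾ ex₄ ⨾ wipe-J) ⨾ wipe-G) ⨾ bump)

          -- The case `i ≡ z` carries a mark from one bag to all others of the branch, and turns a
          -- source that is v into the flag.
          propagate-ex : ∀ ls a → Fits ls → Σ[ ls′ ∈ Levels n ] Σ[ a′ ∈ Bool ] Better ls a ls′ a′ ×
            (∀ i z → Source ls i → i ≡ z ⊎ Edge 𝒢 i z → Done ls′ a′ z) ×
            Run propagate (idle [] [] [] w ls f [] (accL a)) 0F (idle [] [] [] w ls′ f [] (accL a′))
          propagate-ex ls a ft with index-ex 0F rowStep [] (AllRows ls a) (λ { (ci , _) → ci }) (row-ex ls a ft)
                                      (stage [] [] [] ls a) (refl , refl , refl , better-refl , λ _ ())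
          ... | stage _ _ _ ls′ a′ , (refl , refl , refl , bt , dn) , run = ls′ , a′ , bt , (λ i z src hyp → dn i (toℕ<n i) src z hyp) ,
            λ on → let (h′ , on′ , ex) = run on in h′ , on′ ,
              fold-propagate ((ex ⨾ clear-ex viewI (cnt n) (counter′ n ≤-refl)) ⨾ clear-ex viewE (cnt (n * n)) (counter (n * n) ≤-refl))

        -- The recursive search

        module Searching (K : ℕ) where

          open Decompose 𝒢 u v
          open Better

          raw : List Bool → Levels n → ℕ → Bool → Regs 13
          raw W₁ ls s a = st [] [] [] [] [] W₁ [] (flat ls ʳ++ []) [] (trues s) [] [] (accL a)

          ρ : List Letter → Levels n → ℕ → Bool → Regs 13
          ρ w ls s a = raw (codes w ʳ++ []) ls s a

          ρ-snoc : ∀ w c ls s a → raw (code c ʳ++ (codes w ʳ++ [])) ls s a ≡ ρ (w ++ c ∷ []) ls s a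
          ρ-snoc w c ls s a = cong (λ W₁ → raw W₁ ls s a) (sym (trans (cong (_ʳ++ []) (codes-snoc w c)) (++-ʳ++ (codes w))))

          RunS : Fin 5 → Regs 13 → Fin 5 → Regs 13 → ℕ → Set
          RunS s ρ₁ s′ ρ₂ k = ∀ {h} → h On x → Σ[ h′ ∈ Head ] h′ On x × Steps {1} {5} searchStep s (h , ρ₁) s′ (h′ , ρ₂) k

          once : ∀ {s ρ₁ e s′ ρ₂} → Run (searchStep s) ρ₁ e ρ₂ → splitAt 5 e ≡ inj₁ s′ → RunS s ρ₁ s′ ρ₂ 1
          once r e on = let (h , on′ , ex) = r on in h , on′ , (ex , e) ∷ []

          infixr 5 _∙_
          _∙_ : ∀ {s ρ₁ s′ ρ₂ s″ ρ₃ k k′} → RunS s ρ₁ s′ ρ₂ k → RunS s′ ρ₂ s″ ρ₃ k′ → RunS s ρ₁ s″ ρ₃ (k + k′)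
          (p ∙ q) on = let (_ , on₁ , ps) = p on ; (h , on₂ , qs) = q on₁ in h , on₂ , (ps then qs)

          -- v need not be marked anywhere when a path arrives there; the flag records it instead. A
          -- set flag makes every further claim of completeness true, so the rest of such a path
          -- need not be followed.
          Src : Levels n → Bool → Fin n → Set
          Src ls a z = a ≡ true ⊎ Source ls z

          src-mono : ∀ {ls a ls′ a′ z} → Better ls a ls′ a′ → Src ls a z → Src ls′ a′ z
          src-mono p (inj₁ e) = inj₁ (keep p e)
          src-mono p (inj₂ s) = inj₂ (source-mono p s)

          done-src : ∀ {ls a bs b z} → bags ls ≡ bs ++ b ∷ [] → Bnd b z → Full ls z → (z ≡ v → a ≡ true) → Src ls a z
          done-src be (inj₁ (inj₁ e)) fl ac = inj₂ (inj₁ e)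
          done-src be (inj₁ (inj₂ e)) fl ac = inj₁ (ac e)
          done-src {ls} {bs = bs} {b} be (inj₂ h) fl ac with unsnoc ls bs b be
          ... | ls₁ , S , refl , _ with Allₚ.++⁻ʳ ls₁ fl
          ...   | f ∷ [] = inj₂ (inj₂ (Anyₚ.++⁺ʳ ls₁ (here (h , f h))))

          -- Room for `k` more letters of two bits each.
          Deeper : List Letter → ℕ → Set
          Deeper w k = length (codes w) + 2 * k ≤ H

          deeper-≤ : ∀ {w k} → Deeper w k → length (codes w) ≤ H
          deeper-≤ d = m+n≤o⇒m≤o _ d

          deeper-snoc : ∀ {w k c} → length (code c) ≡ 2 → Deeper w (suc k) → Deeper (w ++ c ∷ []) k
          deeper-snoc {w} {k} {c} e d = ≤-trans (≤-reflexive (trans (cong (λ z → length z + 2 * k) (codes-snoc w c))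
            (trans (cong (_+ 2 * k) (trans (length-++ (codes w)) (cong (length (codes w) +_) e)))
              (trans (+-assoc (length (codes w)) 2 (2 * k)) (cong (length (codes w) +_) (sym (*-suc 2 k))))))) d

          codes-length : ∀ w → length (codes w ʳ++ []) ≡ length (codes w)
          codes-length w = trans (length-ʳ++′ (codes w) []) (+-identityʳ _)

          push-letter : ∀ {w k ls s a} c κ σ → code c ≡ κ ∷ σ ∷ [] → Deeper w (suc k) → ∀ {h} →
            Ex (pushLetter κ σ) (h , ρ w ls s a) 0F (h , ρ (w ++ c ∷ []) ls s a)
          push-letter {w} {k} {ls} {s} {a} c κ σ e d {h} = subst (λ y → Ex (pushLetter κ σ) (h , ρ w ls s a) 0F (h , y))
              (trans (cong (λ z → raw (z ʳ++ (codes w ʳ++ [])) ls s a) (sym e)) (ρ-snoc w c ls s a))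
              (push (<-trans (n<1+n _) lt) ⨾ push lt)
            where
            lt : suc (length (codes w ʳ++ [])) < H
            lt = ≤-trans (≤-reflexive (trans (cong (2 +_) (codes-length w)) (+-comm 2 _)))
                  (≤-trans (+-monoʳ-≤ (length (codes w)) (≤-trans (m≤m+n 2 (2 * k)) (≤-reflexive (sym (*-suc 2 k))))) d)

          ρ-letter : ∀ w c κ σ ls s a → code c ≡ κ ∷ σ ∷ [] → ρ (w ++ c ∷ []) ls s a ≡ raw (σ ∷ κ ∷ (codes w ʳ++ [])) ls s a
          ρ-letter w c κ σ ls s a e = trans (sym (ρ-snoc w c ls s a)) (cong (λ z → raw (z ʳ++ (codes w ʳ++ [])) ls s a) e)

          pop-letter : ∀ {w ls s a} c κ σ → code c ≡ κ ∷ σ ∷ [] → ∀ {h} →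
            Ex popLetter (h , ρ (w ++ c ∷ []) ls s a) 0F (h , ρ w ls s a)
          pop-letter {w} {ls} {s} {a} c κ σ e {h} = subst (λ y → Ex popLetter (h , y) 0F (h , ρ w ls s a))
            (sym (ρ-letter w c κ σ ls s a e)) (pop ⨾ pop ⨾ ret)

          nextOf : Bool → Fin 6
          nextOf false = AFTER-LEFT
          nextOf true = AFTER-BODY

          nextS : Bool → Fin 5
          nextS false = AFTER-LEFT
          nextS true = AFTER-BODY

          next-split : ∀ d → splitAt 5 {1} (nextOf d) ≡ inj₁ (nextS d)
          next-split false = refl
          next-split true = refl

          return-child : ∀ d {W₁ ls s a e τ h h′} → suc (length W₁) < H → Ex (fromChild d (nextOf d)) (h , raw W₁ ls s a) e (h′ , τ) →
            Ex (searchStep RETURN) (h , raw (d ∷ true ∷ W₁) ls s a) e (h′ , τ)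
          return-child false lt ex = pop ⨾ pop ⨾ ex
          return-child true lt ex = pop ⨾ pop ⨾ ex

          record Result (t′ : BT n) (b : Subset n) (s : ℕ) (Good : (ls : Levels n) (a : Bool) → Set)
                        (ls : Levels n) (a : Bool) (bound : ℕ) (Runs : Levels n → Bool → ℕ → Set) : Set where
            constructor result
            field
              {ls′} : Levels n
              {a′} : Bool
              improves : Better ls a ls′ a′
              good : Good ls′ a′
              {time} : ℕ
              time≤ : time ≤ bound
              runs : Runs ls′ a′ time

          Completes : (t′ : BT n) (b : Subset n) (s : ℕ) (ls : Levels n) (a : Bool) → Levels n → Bool → Set
          Completes t′ b s ls a ls′ a′ = ∀ {x z m} → Path t′ x z m → m ≤ 2 ^ s → Bnd b x → Bnd b z → Src ls a x → Src ls′ a′ z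

          -- Stated for all branches to the node and all marks on them, because a subtree is
          -- searched under many control words. The two inequalities reserve space for the letters
          -- and marks still to come below.
          Goal : BT n → ℕ → Set
          -- `Regs 0` is the unit type: an absent child is never searched.
          Goal tip s = Regs 0
          Goal t′@(node b l r) s = ∀ {w bs} → Branch t₀ w bs t′ → ∀ ls a → bags ls ≡ bs ++ b ∷ [] →
            Deeper w (height t′ + s) → length (flat ls) + K * (height l ⊔ height r) ≤ H →
            Result t′ b s (Completes t′ b s ls a) ls a (weight t′ s) (λ ls′ a′ → RunS DOWN (ρ w ls s a) RETURN (ρ w ls′ s a′))

          -- Either the child is absent and one round passes over it, or it is entered, searched and
          -- left.
          Through : Bool → List Letter → ℕ → Levels n → Bool → Levels n → Bool → ℕ → Set
          Through d w s ls a ls′ a′ k =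
            Run (tryChild d (nextOf d)) (ρ w ls s a) (nextOf d) (ρ w ls′ s a′)
            ⊎ Σ[ τ ∈ Regs 13 ] Run (tryChild d (nextOf d)) (ρ w ls s a) DOWN τ × RunS DOWN τ (nextS d) (ρ w ls′ s a′) k

          through : ∀ {d w s ls a ls′ a′ k s₁ τ₀} → Through d w s ls a ls′ a′ k →
            (∀ {e τ} → Run (tryChild d (nextOf d)) (ρ w ls s a) e τ → Run (searchStep s₁) τ₀ e τ) →
            Σ[ k′ ∈ ℕ ] k′ ≤ suc k × RunS s₁ τ₀ (nextS d) (ρ w ls′ s a′) k′
          through {d} (inj₁ r) f = 1 , s≤s z≤n , once (f r) (next-split d)
          through (inj₂ (τ , r , rs)) f = _ , ≤-refl , once (f r) refl ∙ rs

          module _ {w bs b b′ l′ r′ s} d (br : Branch t₀ (w ++ childLetter d ∷ []) (bs ++ b ∷ []) (node b′ l′ r′)) (small : ∣ b′ ∣ ≤ K)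
                   (co : ∀ x → Has b x → Some (In x) (node b′ l′ r′) → Has b′ x) (ls : Levels n) (a : Bool) (be : bags ls ≡ bs ++ b ∷ [])
                   (dp : Deeper w (suc (height (node b′ l′ r′)) + s)) (fl : length (flat ls) + K * height (node b′ l′ r′) ≤ H) where

            private
              w⁺ = w ++ (childLetter d) ∷ []
              ls⁺ = ls ++ (b′ , fresh n) ∷ []

            deeper⁺ : Deeper w⁺ (height (node b′ l′ r′) + s)
            deeper⁺ = deeper-snoc {w} {height (node b′ l′ r′) + s} {(childLetter d)} (cong length (code-child d)) dp

            codes⁺ : length (codes w⁺) ≤ H
            codes⁺ = deeper-≤ {w⁺} {height (node b′ l′ r′) + s} deeper⁺

            bags⁺ : bags ls⁺ ≡ (bs ++ b ∷ []) ++ b′ ∷ []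
            bags⁺ = trans (map-++ proj₁ ls _) (cong (_++ b′ ∷ []) be)

            flat⁺ : length (flat ls⁺) + K * (height l′ ⊔ height r′) ≤ H
            flat⁺ = ≤-trans (≤-reflexive (trans (cong (_+ K * (height l′ ⊔ height r′)) (trans (cong length (flat-snoc ls b′ (fresh n)))
                      (trans (length-++ (flat ls)) (cong (length (flat ls) +_) (length-comp-∣∣ b′ (fresh n))))))
                    (+-assoc (length (flat ls)) ∣ b′ ∣ _)))
                  (≤-trans (+-monoʳ-≤ (length (flat ls)) (≤-trans (+-monoˡ-≤ _ small) (≤-reflexive (sym (*-suc K _))))) fl)

            enter-child : Run (tryChild d (nextOf d)) (ρ w ls s a) DOWN (ρ w⁺ ls⁺ s a)
            enter-child on = let (h′ , on′ , ex) = enter-node {[]} {[]} {[]} {trues s} {accL a} br ls codes⁺ (m+n≤o⇒m≤o _ flat⁺) on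
              in h′ , on′ , (push-letter {w} {height (node b′ l′ r′) + s} {ls} {s} {a} (childLetter d) true d (code-child d) dp ⨾ ex) ⨾ ret

            leave-child : ∀ {ls₂ a₂ ls₄ a₃ S₄} →
              Run propagate (ρ w⁺ ls₂ s a₂) 0F (ρ w⁺ (ls₄ ++ (b′ , S₄) ∷ []) s a₃) →
              Run (searchStep RETURN) (ρ w⁺ ls₂ s a₂) (nextOf d) (ρ w ls₄ s a₃)
            leave-child {ls₂} {a₂} {ls₄} {a₃} {S₄} prop {h} on =
              let (h₁ , on₁ , ex₁) = prop on
                  (h₂ , on₂ , ex₂) = leave-ex {[]} {[]} {[]} {trues s} {accL a₃} br ls₄ S₄ codes⁺ on₁
              in h₂ , on₂ , subst (λ y → Ex (searchStep RETURN) (h , y) (nextOf d) (h₂ , ρ w ls₄ s a₃))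
                (sym (ρ-letter w (childLetter d) true d ls₂ s a₂ (code-child d)))
                (return-child d {codes w ʳ++ []} {ls₂} {s} {a₂} lt ((((push-letter {w} {height (node b′ l′ r′) + s} {ls₂} {s} {a₂} (childLetter d) true d (code-child d) dp ⨾ ex₁)
                    ⨾ ex₂) ⨾ pop-letter {w} {ls₄} {s} {a₃} (childLetter d) true d (code-child d)) ⨾ ret))
              where
              lt : suc (length (codes w ʳ++ [])) < H
              lt = ≤-trans (≤-reflexive (trans (cong (2 +_) (codes-length w)) (+-comm 2 _)))
                    (≤-trans (+-monoʳ-≤ (length (codes w)) (≤-trans (m≤m+n 2 (2 * (height (node b′ l′ r′) + s))) (≤-reflexive (sym (*-suc 2 (height (node b′ l′ r′) + s)))))) dp)

            src⁺ : ∀ {z} → Src ls a z → Src ls⁺ a z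
            src⁺ (inj₁ e) = inj₁ e
            src⁺ (inj₂ (inj₁ e)) = inj₂ (inj₁ e)
            src⁺ (inj₂ (inj₂ m)) = inj₂ (inj₂ (Anyₚ.++⁺ˡ m))

            -- Lets the induction hypothesis, which speaks of the child's bag, apply to paths
            -- between vertices of the parent's bag.
            bnd⁺ : ∀ {z} → Bnd b z → Some (In z) (node b′ l′ r′) → Bnd b′ z
            bnd⁺ (inj₁ e) s = inj₁ e
            bnd⁺ (inj₂ h) s = inj₂ (co _ h s)

            child-improves : ∀ {ls₄ S₄ a₃} → bags ls₄ ≡ bs ++ b ∷ [] → Better ls⁺ a (ls₄ ++ (b′ , S₄) ∷ []) a₃ → Better ls a ls₄ a₃
            child-improves {ls₄} be₄ bt = better (grow-init ls ls₄ (trans be (sym be₄)) (grow bt)) (keep bt)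
              (λ so → let (m₃ , r₃) = sound bt ((λ z m → proj₁ so z (marked-fresh ls b′ m)) , proj₂ so)
                      in (λ z m → m₃ z (Anyₚ.++⁺ˡ m)) , r₃)

            Passed : Set
            Passed = Result (node b′ l′ r′) b s (Completes (node b′ l′ r′) b s ls a) ls a (suc (weight (node b′ l′ r′) s)) (Through d w s ls a)

            -- What the search below has marked may sit in the child's bag only. The propagation
            -- before that bag is dropped makes these marks `Full`, hence present in the parent's
            -- bag too.
            child-return : ∀ {ls₂ a₂ k} → Better ls⁺ a ls₂ a₂ → Completes (node b′ l′ r′) b′ s ls⁺ a ls₂ a₂ → k ≤ weight (node b′ l′ r′) s →
              RunS DOWN (ρ w⁺ ls⁺ s a) RETURN (ρ w⁺ ls₂ s a₂) k →
              ∀ {ls₃ a₃} → Better ls₂ a₂ ls₃ a₃ → (∀ i z → Source ls₂ i → i ≡ z ⊎ Edge 𝒢 i z → Done ls₃ a₃ z) →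
              Run propagate (ρ w⁺ ls₂ s a₂) 0F (ρ w⁺ ls₃ s a₃) →
              ∀ {ls₄ S₄} → ls₃ ≡ ls₄ ++ (b′ , S₄) ∷ [] → bags ls₄ ≡ bs ++ b ∷ [] → Passed
            child-return {ls₂} {a₂} {k} bt₂ complete k≤ runs {a₃ = a₃} bt₃ dn prop {ls₄} refl be₄ =
                result improve complete′ (≤-trans (≤-reflexive (+-comm k 1)) (s≤s k≤))
                  (inj₂ (ρ w⁺ ls⁺ s a , enter-child , (runs ∙ once (leave-child {ls₂} {a₂} {ls₄} {a₃} prop) (next-split d))))
              where
              improve : Better ls a ls₄ a₃
              improve = child-improves be₄ (better-trans bt₂ bt₃)
              settle : ∀ {z} → Bnd b z → Src ls₂ a₂ z → Src ls₄ a₃ z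
              settle bz (inj₁ e) = inj₁ (keep bt₃ e)
              settle {z} bz (inj₂ sr) with dn z z sr (inj₁ refl)
              ... | full , acc = done-src be₄ bz (Allₚ.++⁻ˡ ls₄ full) acc
              complete′ : Completes (node b′ l′ r′) b s ls a ls₄ a₃
              -- A path without edges need not meet the subtree; otherwise both ends occur in it, as
              -- `bnd⁺` requires.
              complete′ p m≤ bx bz src with path-ends p
              ... | inj₁ refl = src-mono improve src
              ... | inj₂ (sx , sz) = settle bz (complete p m≤ (bnd⁺ bx sx) (bnd⁺ bz sz) (src⁺ src))

            child-settle : Result (node b′ l′ r′) b′ s (Completes (node b′ l′ r′) b′ s ls⁺ a) ls⁺ a (weight (node b′ l′ r′) s)
                             (λ ls₂ a₂ → RunS DOWN (ρ w⁺ ls⁺ s a) RETURN (ρ w⁺ ls₂ s a₂)) → Passed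
            child-settle (result {ls₂} {a₂} bt₂ complete k≤ runs)
                with propagate-ex br codes⁺ {trues s} ls₂ a₂ (trans (grow-bags (grow bt₂)) bags⁺ ,
                       ≤-trans (≤-reflexive (flat-length ls₂ ls⁺ (grow-bags (grow bt₂)))) (m+n≤o⇒m≤o _ flat⁺))
            ...   | ls₃ , a₃ , bt₃ , dn , prop
                  with unsnoc ls₃ (bs ++ b ∷ []) b′ (trans (grow-bags (grow bt₃)) (trans (grow-bags (grow bt₂)) bags⁺))
            ...     | ls₄ , S₄ , eq₄ , be₄ = child-return bt₂ complete k≤ runs bt₃ dn prop eq₄ be₄

            child-node : Goal (node b′ l′ r′) s → Passed
            child-node goal = child-settle (goal {w⁺} {bs ++ b ∷ []} br ls⁺ a bags⁺ deeper⁺ flat⁺)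

          child-ex : ∀ d {w bs b t₁ s} → Branch t₀ (w ++ childLetter d ∷ []) (bs ++ b ∷ []) t₁ → Narrow K t₁ →
            (∀ x → Has b x → Some (In x) t₁ → Root (In x) t₁) → Goal t₁ s → ∀ ls a → bags ls ≡ bs ++ b ∷ [] →
            Deeper w (suc (height t₁) + s) → length (flat ls) + K * height t₁ ≤ H →
            Result t₁ b s (Completes t₁ b s ls a) ls a (suc (weight t₁ s)) (Through d w s ls a)
          child-ex d {w} {t₁ = tip} {s} br nw co goal ls a be dp fl = result better-refl (λ p _ _ _ src → empty p src) {0} z≤n (inj₁
              (λ {h} on → let (h′ , on′ , ex) = enter-tip {[]} {[]} {[]} {trues s} {accL a} br ls (deeper-≤ {w ++ childLetter d ∷ []} {s} (deeper-snoc {w} {s} {childLetter d} (cong length (code-child d)) dp)) on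
                in h′ , on′ , (push-letter {w} {s} {ls} {s} {a} (childLetter d) true d (code-child d) dp ⨾ ex) ⨾ pop-letter {w} {ls} {s} {a} (childLetter d) true d (code-child d) ⨾ ret))
            where
            empty : ∀ {x z m} → Path tip x z m → Src ls a x → Src ls a z
            empty [] src = src
            empty (p ▷ (_ , ()))
          child-ex d {w} {bs} {b} {t₁ = node b′ l′ r′} {s} br (node small nl nr) co goal ls a be dp fl =
            child-node {w} {bs} {b} {b′} {l′} {r′} {s} d br small co ls a be dp fl goal

          Covered : (b : Subset n) (l r : BT n) (s : ℕ) (ls : Levels n) (a : Bool) → Levels n → Bool → Set
          Covered b l r s ls a ls′ a′ = ∀ {x z d} → Segment b l r x z d → d ≤ 2 ^ s → Bnd b x → Bnd b z → Src ls a x → Src ls′ a′ z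

          module _ {w bs b l r} (br : Branch t₀ w bs (node b l r)) (co : Coherent (node b l r)) (nw : Narrow K (node b l r)) where

            Budget : ℕ → Levels n → Set
            Budget s ls = bags ls ≡ bs ++ b ∷ [] × Deeper w (height (node b l r) + s) × length (flat ls) + K * (height l ⊔ height r) ≤ H

            budget-mono : ∀ {s ls a ls′ a′} → Better ls a ls′ a′ → Budget s ls → Budget s ls′
            budget-mono bt (be , dp , fl) = trans (grow-bags (grow bt)) be , dp ,
              ≤-trans (≤-reflexive (cong (_+ K * (height l ⊔ height r)) (flat-length _ _ (grow-bags (grow bt))))) fl

            Body : ℕ → Levels n → Bool → Set
            Body s ls a = Result (node b l r) b s (Covered b l r s ls a) ls a (weight l s + weight r s + 4)
              (λ ls′ a′ → RunS BODY (ρ w ls s a) AFTER-BODY (ρ w ls′ s a′))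

            Into : Bool → ℕ → Levels n → Bool → Set
            Into d s ls a = Result (child d l r) b s (Completes (child d l r) b s ls a) ls a (suc (weight (child d l r) s)) (Through d w s ls a)

            into : ∀ d s → Goal (child d l r) s → ∀ ls a → Budget s ls → Into d s ls a
            into false s goal ls a (be , dp , fl) = child-ex false {w} {bs} {b} {l} {s} (branch-child false br) (narrow-left nw) (in-left co) goal ls a be
              (≤-trans (+-monoʳ-≤ (length (codes w)) (*-monoʳ-≤ 2 (s≤s (+-monoˡ-≤ s (m≤m⊔n (height l) (height r)))))) dp)
              (≤-trans (+-monoʳ-≤ (length (flat ls)) (*-monoʳ-≤ K (m≤m⊔n (height l) (height r)))) fl)
            into true s goal ls a (be , dp , fl) = child-ex true {w} {bs} {b} {r} {s} (branch-child true br) (narrow-right nw) (in-right co) goal ls a be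
              (≤-trans (+-monoʳ-≤ (length (codes w)) (*-monoʳ-≤ 2 (s≤s (+-monoˡ-≤ s (m≤n⊔m (height l) (height r)))))) dp)
              (≤-trans (+-monoʳ-≤ (length (flat ls)) (*-monoʳ-≤ K (m≤n⊔m (height l) (height r)))) fl)

            body-join : ∀ {s ls a ls₁ a₁} → bags ls ≡ bs ++ b ∷ [] → Better ls a ls₁ a₁ →
              (∀ i z → Source ls i → i ≡ z ⊎ Edge 𝒢 i z → Done ls₁ a₁ z) →
              Run propagate (ρ w ls s a) 0F (ρ w ls₁ s a₁) →
              (lft : Into false s ls₁ a₁) → Into true s (Result.ls′ lft) (Result.a′ lft) → Body s ls a
            body-join {s} {ls} {a} {ls₁} {a₁} be bt₁ dn prop (result {ls₂} {a₂} bt₂ good₂ {k₂} k₂≤ run₂) (result {ls₃} {a₃} bt₃ good₃ {k₃} k₃≤ run₃)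
              with through {false} {w} {s} {ls₁} {a₁} {ls₂} {a₂} {k₂} {BODY} {ρ w ls s a} run₂ (λ r {h} → _⨟_ {c = propagate} prop r {h})
                 | through {true} {w} {s} {ls₂} {a₂} {ls₃} {a₃} {k₃} {AFTER-LEFT} {ρ w ls₂ s a₂} run₃ (λ r {h} → r {h})
            ... | k , k≤ , rs | k′ , k′≤ , rs′ = result (better-trans bt₁ (better-trans bt₂ bt₃)) covered
                (≤-trans (+-mono-≤ (≤-trans k≤ (s≤s k₂≤)) (≤-trans k′≤ (s≤s k₃≤))) (≤-reflexive (arith (weight l s) (weight r s)))) (rs ∙ rs′)
              where
              -- For each child one round to enter and one to return, besides its own rounds.
              arith : ∀ p q → suc (suc p) + suc (suc q) ≡ p + q + 4
              arith = solve 2 (λ p q → con 2 :+ p :+ (con 2 :+ q) := p :+ q :+ con 4) refl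
                where open +-*-Solver
              covered : Covered b l r s ls a ls₃ a₃
              covered (edge e both) m≤ bx bz (inj₁ ac) = inj₁ (keep (better-trans bt₁ (better-trans bt₂ bt₃)) ac)
              covered (edge e both) m≤ bx bz (inj₂ sr) with dn _ _ sr (inj₂ e)
              ... | full , ac = src-mono (better-trans bt₂ bt₃) (done-src (trans (grow-bags (grow bt₁)) be) bz full ac)
              covered (left p) m≤ bx bz src = src-mono bt₃ (good₂ p m≤ bx bz (src-mono bt₁ src))
              covered (right p) m≤ bx bz src = good₃ p m≤ bx bz (src-mono (better-trans bt₁ bt₂) src)

            codes-fit : ∀ {s ls} → Budget s ls → length (codes w) ≤ H
            codes-fit {s} (_ , dp , _) = deeper-≤ {w} {height (node b l r) + s} dp

            body-ex : ∀ s → Goal l s → Goal r s → ∀ ls a → Budget s ls → Body s ls a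
            body-ex s goal-l goal-r ls a bu@(be , dp , fl) with propagate-ex br (codes-fit {s} {ls} bu) {trues s} ls a (be , m+n≤o⇒m≤o _ fl)
            ... | ls₁ , a₁ , bt₁ , dn , prop = body-join {s} {ls} {a} be bt₁ dn prop lft
                  (into true s goal-r (Result.ls′ lft) (Result.a′ lft) (budget-mono (Result.improves lft) bu₁))
              where
              bu₁ : Budget s ls₁
              bu₁ = budget-mono bt₁ bu
              lft : Into false s ls₁ a₁
              lft = into false s goal-l ls₁ a₁ bu₁

            Whole : ℕ → Levels n → Bool → Set
            Whole s ls a = Result (node b l r) b s (Completes (node b l r) b s ls a) ls a (weight-node l r s)
              (λ ls′ a′ → RunS DOWN (ρ w ls s a) RETURN (ρ w ls′ s a′))

            whole-zero : ∀ {ls a} → Body 0 ls a → Whole 0 ls a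
            whole-zero {ls} {a} (result {ls₁} {a₁} bt good {k} k≤ rs) = result bt complete
                (≤-trans (≤-reflexive (+-comm 1 (k + 1))) (≤-trans (≤-reflexive (+-assoc k 1 1)) (≤-trans (+-monoˡ-≤ 2 k≤) (≤-reflexive (+-assoc _ 4 2)))))
                (once (λ on → _ , on , pop ⨾ ret) refl ∙ rs ∙ once (λ on → _ , on , pop ⨾ ret) refl)
              where
              complete : Completes (node b l r) b 0 ls a ls₁ a₁
              -- A path of at most one edge is empty or a single segment with nothing before or
              -- after it.
              complete p m≤ bx bz src with split 0 (segments co p bx bz) bz
              ... | inj₁ z≤n with [] ← p = src-mono bt src
              ... | inj₂ (cut {m₁ = zero} {d} {zero} [] b₁ mid b₂ [] sh lo eq) = good mid (≤-trans (≤-trans (m≤m+n d 0) (≤-reflexive eq)) m≤) b₁ b₂ src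
              ... | inj₂ (cut {m₁ = zero} {d} {suc m₂} pre b₁ mid b₂ post sh lo eq) with s≤s () ← ≤-trans (≤-trans (s≤s (≤-trans lo (m≤n+m (d + 0) m₂))) (≤-reflexive eq)) m≤

            whole-suc : ∀ {s ls a} → (s<H : s < H) → suc (suc (length (codes w))) ≤ H →
              (fst : Result (node b l r) b s (Completes (node b l r) b s ls a) ls a (weight-node l r s)
                 (λ ls′ a′ → RunS DOWN (ρ (w ++ first ∷ []) ls s a) RETURN (ρ (w ++ first ∷ []) ls′ s a′))) →
              (mid : Body (suc s) (Result.ls′ fst) (Result.a′ fst)) →
              Result (node b l r) b s (Completes (node b l r) b s (Result.ls′ mid) (Result.a′ mid)) (Result.ls′ mid) (Result.a′ mid) (weight-node l r s)
                 (λ ls′ a′ → RunS DOWN (ρ (w ++ second ∷ []) (Result.ls′ mid) s (Result.a′ mid)) RETURN (ρ (w ++ second ∷ []) ls′ s a′)) →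
              Whole (suc s) ls a
            whole-suc {s} {ls} {a} s<H w< (result {ls₁} {a₁} bt₁ good₁ {k₁} k₁≤ rs₁) (result {ls₂} {a₂} bt₂ good₂ {k₂} k₂≤ rs₂) (result {ls₃} {a₃} bt₃ good₃ {k₃} k₃≤ rs₃) =
              result (better-trans bt₁ (better-trans bt₂ bt₃)) complete
                (≤-trans (s≤s (+-mono-≤ k₁≤ (s≤s (+-mono-≤ k₂≤ (s≤s (+-monoˡ-≤ 1 k₃≤))))))
                         (≤-reflexive (arith (weight-node l r s) (weight l (suc s) + weight r (suc s)))))
                (down ∙ rs₁ ∙ mid ∙ rs₂ ∙ again′ ∙ rs₃ ∙ up)
              where
              -- Besides both halves and the body there are four rounds, which push and pop the
              -- letters `first` and `second`.
              arith : ∀ q c → suc (q + suc (c + 4 + suc (q + 1))) ≡ q + q + (c + 8)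
              arith = solve 2 (λ q c → con 1 :+ (q :+ (con 1 :+ (c :+ con 4 :+ (con 1 :+ (q :+ con 1))))) := q :+ q :+ (c :+ con 8)) refl
                where open +-*-Solver
              dp : Deeper w 1
              dp = ≤-trans (≤-reflexive (+-comm _ 2)) w<
              t<H : length (trues s) < H
              t<H = subst (_< H) (sym (length-trues s)) s<H
              down : RunS DOWN (ρ w ls (suc s) a) DOWN (ρ (w ++ first ∷ []) ls s a) 1
              down = once (λ on → _ , on , pop ⨾ push-letter {w} {0} {ls} {s} {a} first false false refl dp ⨾ ret) refl
              again′ : RunS AFTER-BODY (ρ w ls₂ (suc s) a₂) DOWN (ρ (w ++ second ∷ []) ls₂ s a₂) 1
              again′ = once (λ on → _ , on , pop ⨾ push-letter {w} {0} {ls₂} {s} {a₂} second false true refl dp ⨾ ret) refl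
              mid : RunS RETURN (ρ (w ++ first ∷ []) ls₁ s a₁) BODY (ρ w ls₁ (suc s) a₁) 1
              mid = once (λ {h} on → h , on , subst (λ q → Ex (searchStep RETURN) (h , q) BODY (h , ρ w ls₁ (suc s) a₁))
                (sym (ρ-letter w first false false ls₁ s a₁ refl)) (pop ⨾ pop ⨾ push t<H ⨾ ret)) refl
              up : RunS RETURN (ρ (w ++ second ∷ []) ls₃ s a₃) RETURN (ρ w ls₃ (suc s) a₃) 1
              up = once (λ {h} on → h , on , subst (λ q → Ex (searchStep RETURN) (h , q) RETURN (h , ρ w ls₃ (suc s) a₃))
                (sym (ρ-letter w second false true ls₃ s a₃ refl)) (pop ⨾ pop ⨾ push t<H ⨾ ret)) refl
              complete : Completes (node b l r) b (suc s) ls a ls₃ a₃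
              complete p m≤ bx bz src with split (2 ^ s) (segments co p bx bz) bz
              ... | inj₁ short = src-mono (better-trans bt₂ bt₃) (good₁ p short bx bz src)
              ... | inj₂ (cut {m₁ = m₁} {d} {m₂} pre b₁ middle b₂ post sh lo eq) =
                good₃ post (≤-trans (m+n≤o⇒m≤o∸n m₂ (≤-trans (≤-reflexive eq) m≤)) over) b₂ bz
                  (good₂ middle (≤-trans (≤-trans (m≤m+n d m₁) (≤-trans (m≤n+m (d + m₁) m₂) (≤-reflexive eq))) m≤) b₁ b₂
                    (good₁ pre sh bx b₁ src))
                where
                -- The middle piece ends beyond the first half of the bound, so at most the other
                -- half is left for the rest.
                over : 2 ^ suc s ∸ (d + m₁) ≤ 2 ^ s
                over = ≤-trans (∸-monoʳ-≤ (2 ^ suc s) (<⇒≤ lo)) (≤-reflexive (trans (cong (_∸ 2 ^ s) (cong (2 ^ s +_) (+-identityʳ (2 ^ s)))) (m+n∸n≡m (2 ^ s) (2 ^ s))))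

          goal-suc : ∀ {b l r} → Coherent (node b l r) → Narrow K (node b l r) → ∀ s →
            Goal (node b l r) s → Goal l (suc s) → Goal r (suc s) → Goal (node b l r) (suc s)
          goal-suc {b} {l} {r} co nw s same goal-l goal-r {w} {bs} br ls a be dp fl =
              whole-suc br co nw {s} {ls} {a} s<H w< fst mid
                (same (branch-second br) (Result.ls′ mid) (Result.a′ mid) (proj₁ bu₂)
                  (deeper-snoc {w} {height (node b l r) + s} {second} refl dp′) (proj₂ (proj₂ bu₂)))
            where
            dp′ : Deeper w (suc (height (node b l r) + s))
            dp′ = ≤-trans (≤-reflexive (cong (λ z → length (codes w) + 2 * z) (sym (+-suc (height (node b l r)) s)))) dp
            fst = same (branch-first br) ls a be (deeper-snoc {w} {height (node b l r) + s} {first} refl dp′) fl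
            bu₁ = budget-mono br co nw {suc s} (Result.improves fst) (be , dp , fl)
            mid : Body br co nw (suc s) (Result.ls′ fst) (Result.a′ fst)
            mid = body-ex br co nw (suc s) goal-l goal-r (Result.ls′ fst) (Result.a′ fst) bu₁
            bu₂ = budget-mono br co nw {suc s} (Result.improves mid) bu₁
            w< : suc (suc (length (codes w))) ≤ H
            w< = ≤-trans (≤-reflexive (+-comm 2 _)) (≤-trans (+-monoʳ-≤ (length (codes w)) (*-monoʳ-≤ 2 {1} {suc (height (node b l r) + s)} (s≤s z≤n))) dp′)
            s<H : s < H
            s<H = ≤-trans (≤-trans (s≤s (m≤n+m s (height (node b l r)))) (m≤m+n (suc (height (node b l r) + s)) _)) (≤-trans (m≤n+m (2 * suc (height (node b l r) + s)) (length (codes w))) dp′)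

          abstract
            -- Lexicographic in the tree and the budget: calls on the same node spend budget, calls
            -- on children keep it, as the middle piece may be as long as the whole path. Nested
            -- calls thus number at most the height plus the budget.
            search-tree : ∀ t′ → Coherent t′ → Narrow K t′ → ∀ s → Goal t′ s
            search-tree tip co nw s = tt
            search-tree (node b l r) co@(node _ _ _ cl cr) nw@(node _ nl nr) zero br ls a be dp fl =
              whole-zero br co nw (body-ex br co nw 0 (search-tree l cl nl 0) (search-tree r cr nr 0) ls a (be , dp , fl))
            search-tree (node b l r) co@(node _ _ _ cl cr) nw@(node _ nl nr) (suc s) =
              goal-suc co nw s (search-tree (node b l r) co nw s) (search-tree l cl nl (suc s)) (search-tree r cr nr (suc s))

          module Decide (co : Coherent (node b₀ l₀ r₀)) (nw : Narrow K (node b₀ l₀ r₀))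
                        (codes≤ : 2 * (height (node b₀ l₀ r₀) + length (cnt n)) ≤ H)
                        (marks≤ : K * height (node b₀ l₀ r₀) ≤ H)
                        (rounds≤ : weight (node b₀ l₀ r₀) (length (cnt n)) < B) where

            top-node : BT n
            top-node = node b₀ l₀ r₀

            at-top : Branch t₀ [] [] top-node
            at-top = subst (Branch t₀ [] []) t₀≡ here

            S : ℕ
            S = length (cnt n)

            ls₀ : Levels n
            ls₀ = (b₀ , fresh n) ∷ []

            S≤H : S ≤ H
            S≤H = counter′ n ≤-refl

            viewFT : View (F ∷ T ∷ []) (λ v → st [] [] [] [] (lookup v 1F) [] [] [] [] (lookup v 0F) [] [] [])
            viewFT = record { look = λ { 0F v → refl ; 1F v → refl }
                            ; upd = λ { 0F l (_ ∷ _ ∷ []) → refl ; 1F l (_ ∷ _ ∷ []) → refl } }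

            marks₀ : length (flat ls₀) + K * (height l₀ ⊔ height r₀) ≤ H
            marks₀ = ≤-trans (+-monoˡ-≤ _ (≤-trans (≤-reflexive (trans (cong length (++-identityʳ (comp b₀ (fresh n)))) (length-comp-∣∣ b₀ (fresh n)))) (narrow-root nw)))
                                     (≤-trans (≤-reflexive (sym (*-suc K _))) marks≤)

            setup : Run (pour I T >> fill F true >> enterBag) (counted (cnt n)) 1F (ρ [] ls₀ S false)
            setup on = let (h , on′ , ex) = enter-node {[]} {[]} {[]} {trues S} {[]} at-top [] {[]} z≤n (m+n≤o⇒m≤o _ marks₀) on in
              h , on′ , (pour-ex viewIT (cnt n) [] (≤-trans (≤-reflexive (+-identityʳ S)) S≤H)
                ⨾ subst (λ z → Ex (fill F true) (_ , st [] [] [] [] (cnt n ʳ++ []) [] [] [] [] [] [] [] []) 0F (_ , st [] [] [] [] [] [] [] [] [] z [] [] []))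
                    (trans (fills-trues (cnt n ʳ++ []) 0) (cong (λ z → replicate z true) (trans (+-identityʳ _) (trans (length-ʳ++′ (cnt n) []) (+-identityʳ S)))))
                    (fill-ex viewFT true [] (cnt n ʳ++ []) (≤-trans (≤-reflexive (trans (+-identityʳ _) (trans (length-ʳ++′ (cnt n) []) (+-identityʳ S)))) S≤H)))
                ⨾ ex

            conclude : ∀ a {c : Com 1} {σ h ls} → Ex c σ 0F (h , ρ [] ls S a) →
              Σ[ τ ∈ State 13 ] Ex (c >> pop A >>= case3 (ret REJECT) (ret ACCEPT) (ret ACCEPT)) σ (verdictIx a) τ
            conclude true p = _ , (p ⨾ pop) ⨾ ret
            conclude false p = _ , (p ⨾ pop) ⨾ ret

            Answer : Set
            Answer = Σ[ a ∈ Bool ] (a ≡ true → Reach 𝒢 u v) × (∀ {m} → Path top-node u v m → m ≤ 2 ^ S → a ≡ true) ×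
              (∀ {h} → h On x → Σ[ σ ∈ State 13 ] Ex search (h , counted (cnt n)) (verdictIx a) σ)

            whole : ∀ {ls₁ a₁ ls₂ a₂ k} → k ≤ weight top-node S → RunS DOWN (ρ [] ls₀ S false) RETURN (ρ [] ls₁ S a₁) k →
              Run propagate (ρ [] ls₁ S a₁) 0F (ρ [] ls₂ S a₂) →
              ∀ {h} → h On x → Σ[ σ ∈ State 13 ] Ex search (h , counted (cnt n)) (verdictIx a₂) σ
            whole {ls₁} {a₁} {ls₂} {a₂} {k} k≤ runs prop on =
                let (h₁ , on₁ , ex₁) = setup on
                    (h₂ , on₂ , ps) = runs on₁
                    (h₃ , on₃ , ex₃) = prop on₂
                    (σ , ex₄) = conclude a₂ {loop 5 searchStep DOWN >> propagate} {h₁ , ρ [] ls₀ S false} {h₃} {ls₂} (rounds {h₁} {h₂} ps ⨾ ex₃)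
                in σ , fold-search (ex₁ ⨾ ex₄)
              where
              rounds : ∀ {h₁ h₂} → Steps {1} {5} searchStep DOWN (h₁ , ρ [] ls₀ S false) RETURN (h₂ , ρ [] ls₁ S a₁) k →
                Ex (loop {n = 1} 5 searchStep DOWN) (h₁ , ρ [] ls₀ S false) 0F (h₂ , ρ [] ls₁ S a₁)
              rounds ps = loop (_end_ {1} {5} ps (done (pop ⨾ ret) refl)) (≤-trans (≤-reflexive (+-comm k 1)) (≤-trans (s≤s k≤) rounds≤))

            answer : Result top-node b₀ S (Completes top-node b₀ S ls₀ false) ls₀ false (weight top-node S)
                       (λ ls′ a′ → RunS DOWN (ρ [] ls₀ S false) RETURN (ρ [] ls′ S a′)) → Answer
            answer (result {ls₁} {a₁} bt complete {k} k≤ runs)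
              with propagate-ex {[]} {[]} at-top z≤n {trues S} ls₁ a₁ (grow-bags (grow bt) ,
                     ≤-trans (≤-reflexive (flat-length ls₁ ls₀ (grow-bags (grow bt)))) (m+n≤o⇒m≤o _ marks₀))
            ... | ls₂ , a₂ , bt₂ , dn , prop = a₂ , proj₂ (sound (better-trans bt bt₂) ((λ z m → unmarked (marked-fresh [] b₀ m)) , λ ())) , accepted , whole {ls₁} {a₁} {ls₂} {a₂} {k} k≤ runs prop
              where
              unmarked : ∀ {z} → Marked [] z → Reach 𝒢 u z
              unmarked ()
              accepted : ∀ {m} → Path top-node u v m → m ≤ 2 ^ S → a₂ ≡ true
              accepted p m≤ with complete p m≤ (inj₁ (inj₁ refl)) (inj₁ (inj₂ refl)) (inj₂ (inj₁ refl))
              ... | inj₁ e = keep bt₂ e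
              -- So far v may only be marked, or equal to u; the last propagation turns this into
              -- the flag.
              ... | inj₂ src = proj₂ (dn v v src (inj₁ refl)) refl

            abstract
              search-answer : Answer
              search-answer = answer (search-tree top-node co nw S at-top ls₀ false refl codes≤ marks₀)

-- Size bounds and the theorem

height≤length : ∀ {n} (t : BT n) → height t ≤ length (encTree t)
height≤length tip = z≤n
height≤length (node b l r) = s≤s (≤-trans (⊔-lub (≤-trans (height≤length l) (m≤m+n _ _)) (≤-trans (height≤length r) (m≤n+m _ _)))
  (≤-trans (≤-reflexive (sym (length-++ (encTree l)))) (≤-trans (m≤n+m _ (length (encSubset b))) (≤-reflexive (sym (length-++ (encSubset b)))))))

width≤n : ∀ {n} (t : BT n) → width t ≤ n
width≤n tip = z≤n
width≤n (node b l r) = ⊔-lub (≤-trans (m∸n≤m ∣ b ∣ 1) (∣p∣≤n b)) (⊔-lub (width≤n l) (width≤n r))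

n≤2^n : ∀ n → n ≤ 2 ^ n
n≤2^n zero = z≤n
n≤2^n (suc n) = ≤-trans (+-mono-≤ (m^n>0 2 n) (n≤2^n n)) (≤-reflexive (cong (2 ^ n +_) (sym (+-identityʳ (2 ^ n)))))

log≤n : ∀ n → ⌊log₂ n ⌋ ≤ n
log≤n n = ≤-trans (⌊log₂⌋-mono-≤ (n≤2^n n)) (≤-reflexive (⌊log₂[2^n]⌋≡n n))

tree≤input : ∀ n (𝒢 : Digraph n) t u v → length (encTree t) ≤ length (encode n 𝒢 t u v)
tree≤input n 𝒢 t u v = ≤-trans (≤-trans (≤-trans (m≤m+n _ _) (≤-reflexive (sym (length-++ (encTree t)))))
    (≤-trans (m≤n+m _ (length (encGraph n 𝒢))) (≤-reflexive (sym (length-++ (encGraph n 𝒢))))))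
    (≤-trans (m≤n+m _ (length (encNat n))) (≤-reflexive (sym (length-++ (encNat n)))))

n≤input : ∀ n (𝒢 : Digraph n) t u v → n ≤ length (encode n 𝒢 t u v)
n≤input n 𝒢 t u v = ≤-trans (≤-trans (≤-reflexive (sym (length-replicate n))) (≤-trans (m≤m+n _ 1) (≤-reflexive (sym (length-++ (replicate n s1))))))
  (≤-trans (m≤m+n _ _) (≤-reflexive (sym (length-++ (encNat n)))))

*-^ : ∀ e a b → (a * b) ^ e ≡ a ^ e * b ^ e
*-^ zero a b = refl
*-^ (suc e) a b = trans (cong ((a * b) *_) (*-^ e a b))
  (solve 4 (λ a b p q → (a :* b) :* (p :* q) := (a :* p) :* (b :* q)) refl a b (a ^ e) (b ^ e))
  where open +-*-Solver

cube : ∀ k m → 2 ^ k ≤ m → 8 ^ k ≤ m * (m * m)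
cube k m le = ≤-trans (≤-reflexive (trans (^-*-assoc 2 3 k) (trans (cong (2 ^_) (solve 1 (λ k → con 3 :* k := k :+ (k :+ k)) refl k))
    (trans (^-distribˡ-+-* 2 k (k + k)) (cong (2 ^ k *_) (^-distribˡ-+-* 2 k k))))))
    (*-mono-≤ le (*-mono-≤ le le))
  where open +-*-Solver

module _ (N : ℕ) (1≤N : 1 ≤ N) where

  private
    P = N ^ 9

  -- Covers the space term 4 · 14 · (4 Z + 5) ≤ 728 N ^ 2 and the 64 N ^ 9 rounds of the search.
  abstract
    scale : ℕ
    scale = 728 * P

    1≤P : 1 ≤ P
    1≤P = m^n>0 N {{>-nonZero 1≤N}} 9

    N≤P : N ≤ P
    N≤P = ≤-trans (≤-reflexive (sym (*-identityʳ N))) (^-monoʳ-≤ N {{>-nonZero 1≤N}} {1} {9} (s≤s z≤n))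

    NN≤P : N * N ≤ P
    NN≤P = ≤-trans (≤-reflexive (cong (N *_) (sym (*-identityʳ N)))) (^-monoʳ-≤ N {{>-nonZero 1≤N}} {2} {9} (s≤s (s≤s z≤n)))

    weight-scale : ∀ {n} (t : BT n) s → 2 ^ height t ≤ N * N → 2 ^ s ≤ 2 * N → weight t s < scale
    weight-scale t s hh hs = begin-strict
      weight t s              <⟨ m<m+n (weight t s) (s≤s z≤n) ⟩
      weight t s + 8          ≤⟨ weight-bound t s ⟩
      8 * 8 ^ (height t + s)  ≡⟨ cong (8 *_) (^-distribˡ-+-* 8 (height t) s) ⟩
      8 * (8 ^ height t * 8 ^ s) ≤⟨ *-monoʳ-≤ 8 (*-mono-≤ (cube (height t) (N * N) hh) (cube s (2 * N) hs)) ⟩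
      8 * ((N * N) * ((N * N) * (N * N)) * ((2 * N) * ((2 * N) * (2 * N)))) ≡⟨ solve 1 (λ N → con 8 :* ((N :* N) :* ((N :* N) :* (N :* N)) :* ((con 2 :* N) :* ((con 2 :* N) :* (con 2 :* N))))
                                    := con 64 :* (N :^ 9)) refl N ⟩
      64 * P                  ≤⟨ *-monoˡ-≤ P (≤ᵇ⇒≤ 64 728 tt) ⟩
      scale ∎
      where
      open ≤-Reasoning
      open +-*-Solver

    space-scale : ∀ z → z ≤ N * N + N → 4 * (suc (4 * z + 4) * 14) ≤ scale
    space-scale z le = begin
      4 * (suc (4 * z + 4) * 14)   ≡⟨ solve 1 (λ z → con 4 :* ((con 1 :+ (con 4 :* z :+ con 4)) :* con 14) := con 224 :* z :+ con 280 :* con 1) refl z ⟩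
      224 * z + 280 * 1            ≤⟨ +-mono-≤ (*-monoʳ-≤ 224 (≤-trans le (+-mono-≤ NN≤P N≤P))) (*-monoʳ-≤ 280 1≤P) ⟩
      224 * (P + P) + 280 * P      ≡⟨ solve 1 (λ P → con 224 :* (P :+ P) :+ con 280 :* P := con 728 :* P) refl P ⟩
      scale ∎
      where
      open ≤-Reasoning
      open +-*-Solver

    N<scale : N < scale
    N<scale = ≤-trans (+-mono-≤ 1≤P N≤P) (≤-trans (≤-reflexive (solve 1 (λ P → P :+ P := con 2 :* P) refl P)) (*-monoˡ-≤ P (≤ᵇ⇒≤ 2 728 tt)))
      where open +-*-Solver

    2≤scale : 2 ≤ scale
    2≤scale = ≤-trans (≤-trans (s≤s 1≤N) N<scale) ≤-refl

    scale-power : ∀ e → suc (scale ^ e) ≤ (728 ^ e + 70) * N ^ (9 * e) + (728 ^ e + 70)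
    scale-power e = begin
      suc (scale ^ e)                             ≡⟨ cong suc (trans (*-^ e 728 P) (cong (728 ^ e *_) (^-*-assoc N 9 e))) ⟩
      1 + 728 ^ e * N ^ (9 * e)                   ≡⟨ +-comm 1 _ ⟩
      728 ^ e * N ^ (9 * e) + 1                   ≤⟨ +-mono-≤ (*-monoˡ-≤ (N ^ (9 * e)) (m≤m+n (728 ^ e) 70)) (≤-trans (s≤s z≤n) (m≤n+m 70 (728 ^ e))) ⟩
      (728 ^ e + 70) * N ^ (9 * e) + (728 ^ e + 70) ∎
      where open ≤-Reasoning

-- Choice of the bounds and correctness of the program

module Bounds {n′} (𝒢 : Digraph (suc n′)) (b₀ : Subset (suc n′)) (l₀ r₀ : BT (suc n′)) (u v : Fin (suc n′))
              (td : IsTreeDecomposition 𝒢 (node b₀ l₀ r₀)) (bal : Balanced (node b₀ l₀ r₀)) where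

  open IsTreeDecomposition td

  n N h ω g Z H B : ℕ
  n = suc n′
  t₀ : BT n
  t₀ = node b₀ l₀ r₀
  N = length (encode n 𝒢 t₀ u v)
  h = height t₀
  ω = width t₀
  g = ⌊log₂ n ⌋
  Z = ω * h + g
  -- Covers `4 * Z + 2` bits of control word, `2 * Z` marks, and counters of at most `3 + 2 * g`
  -- digits.
  H = 4 * Z + 4

  n≤N : n ≤ N
  n≤N = n≤input n 𝒢 t₀ u v

  1≤N : 1 ≤ N
  1≤N = ≤-trans (s≤s z≤n) n≤N

  B = scale N 1≤N

  Z≤ : Z ≤ N * N + N
  Z≤ = +-mono-≤ (*-mono-≤ (≤-trans (width≤n t₀) n≤N) (≤-trans (height≤length t₀) (tree≤input n 𝒢 t₀ u v))) (≤-trans (log≤n n) n≤N)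

  H<B : H < B
  H<B = ≤-trans (≤-trans (≤-trans (m≤m*n (suc H) 14) (m≤n*m (suc H * 14) 4)) (space-scale N 1≤N Z Z≤)) ≤-refl

  len<B : N < B
  len<B = N<scale N 1≤N

  counter : ∀ m → m ≤ n * n → length (cnt m) ≤ H
  counter m le = ≤-trans (cnt-square n′ m le) (≤-trans (+-mono-≤ {3} {4} (≤ᵇ⇒≤ 3 4 tt) (*-mono-≤ {2} {4} (≤ᵇ⇒≤ 2 4 tt) (m≤n+m g (ω * h)))) (≤-reflexive (+-comm 4 (4 * Z))))

  counter′ : ∀ m → m ≤ n → length (cnt m) ≤ H
  counter′ m le = counter m (≤-trans le (m≤m*n n n))

  cover : ∀ y z → Edge 𝒢 y z → Some (λ b → Has b y × Has b z) t₀
  cover y z e = let (p , b , at , hy , hz) = edgeCover y z e in at-some at ([]=⇒lookup hy , []=⇒lookup hz)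

  Decides : Set
  Decides = Σ[ a ∈ Bool ] (a ≡ true → Reach 𝒢 u v) × (Reach 𝒢 u v → a ≡ true) ×
    Σ[ σ ∈ State 13 ] Exec B H main (([] , encode n 𝒢 t₀ u v) , no-regs) (verdictIx a) σ

  decide-narrow : isWide t₀ ≡ false → Decides
  decide-narrow nw = (toℕ v ≡ᵇ toℕ u) , (λ e → subst (Reach 𝒢 u) (sym (≡ᵇ-sound v u e)) ε) , (λ re → trans (cong (λ z → toℕ z ≡ᵇ toℕ u) (sym (stay re))) (≡ᵇ-refl (toℕ u))) ,
      Registers.Positions.Start.main-narrow B H H<B 𝒢 t₀ u v len<B counter′ nw
    where
    stay : ∀ {y z} → Reach 𝒢 y z → y ≡ z
    stay ε = refl
    stay (e ◅ es) = trans (narrow-some (narrow-isWide t₀ nw) (cover _ _ e)) (stay es)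

  decide-wide : isWide t₀ ≡ true → Decides
  decide-wide wd = let (a , snd , cmp , run) = answer in
      a , snd , (λ re → let (m , m≤ , p) = short-path cover re in cmp p (≤-trans m≤ (cnt-below n))) ,
      Registers.Positions.Start.main-wide B H H<B 𝒢 t₀ u v len<B counter′ wd run
    where
    -- A bag with two members is what lets `ω * h` pay for the control word and for the one bit per
    -- bag beyond the width.
    1≤ω : 1 ≤ ω
    1≤ω = width-isWide t₀ wd
    h≤ωh : h ≤ ω * h
    h≤ωh = ≤-trans (≤-reflexive (sym (*-identityˡ h))) (*-monoˡ-≤ h 1≤ω)
    h≤Z : h ≤ Z
    h≤Z = ≤-trans h≤ωh (m≤m+n (ω * h) g)
    height<H : h < H
    height<H = ≤-trans (s≤s (≤-trans h≤Z (m≤n*m Z 4))) (≤-trans (m<m+n (4 * Z) (s≤s z≤n)) ≤-refl)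
    codes≤ : 2 * (h + length (cnt n)) ≤ H
    codes≤ = begin
      2 * (h + length (cnt n))      ≤⟨ *-monoʳ-≤ 2 (+-mono-≤ h≤Z (≤-trans (cnt-log n′) (s≤s (m≤n+m g (ω * h))))) ⟩
      2 * (Z + suc Z)               ≡⟨ solve 1 (λ Z → con 2 :* (Z :+ (con 1 :+ Z)) := con 4 :* Z :+ con 2) refl Z ⟩
      4 * Z + 2                     ≤⟨ +-monoʳ-≤ (4 * Z) (≤ᵇ⇒≤ 2 4 tt) ⟩
      H ∎
      where
      open ≤-Reasoning
      open +-*-Solver
    marks≤ : suc ω * h ≤ H
    marks≤ = begin
      h + ω * h   ≤⟨ +-mono-≤ h≤Z (m≤m+n (ω * h) g) ⟩
      Z + Z       ≤⟨ m≤m+n (Z + Z) (2 * Z + 4) ⟩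
      Z + Z + (2 * Z + 4) ≡⟨ solve 1 (λ Z → Z :+ Z :+ (con 2 :* Z :+ con 4) := con 4 :* Z :+ con 4) refl Z ⟩
      H ∎
      where
      open ≤-Reasoning
      open +-*-Solver
    tips≤N : tips t₀ ≤ N
    tips≤N = ≤-trans (tips-length t₀) (tree≤input n 𝒢 t₀ u v)
    answer = Registers.Positions.Routes.Spread.Searching.Decide.search-answer B H H<B 𝒢 t₀ u v len<B height<H b₀ l₀ r₀ refl counter (suc ω)
      (coherent t₀ coherence) (narrow-width t₀) codes≤ marks≤
      (weight-scale N 1≤N t₀ (length (cnt n)) (≤-trans (balanced-tips bal) (*-mono-≤ tips≤N tips≤N)) (≤-trans (cnt-pow n′) (*-monoʳ-≤ 2 n≤N)))
    open Shorten 𝒢 u v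

  decide-by : ∀ w → isWide t₀ ≡ w → Decides
  decide-by true = decide-wide
  decide-by false = decide-narrow

  decides : Decides
  decides = decide-by (isWide t₀) refl

-- Machine and exponent depend on the program only; the bounds `B`, `H` and `X` come afterwards and
-- may vary with the input.
Simulates : Com 2 → TM → ℕ → Set
Simulates prog M e = ∀ {B H X} → 2 ≤ X → B ≤ X → 4 * (suc H * 14) ≤ X → ∀ {s i h ρ} →
  Exec B H prog (([] , s) , no-regs) i (h , ρ) →
  Σ[ t ∈ ℕ ] TM.halted M (state (run M s t)) ≡ just (verdict i) × t ≤ suc (X ^ e) × space (run M s t) ≤ suc H * 14

compile : (prog : Com 2) → Σ[ M ∈ TM ] Σ[ e ∈ ℕ ] Simulates prog M e
compile prog = Compile.tm prog , cost prog , λ {B} {H} {X} 2≤X B≤X H≤X ex → Simulate.simulate prog B H X 2≤X B≤X H≤X ex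

abstract
  compiled : Σ[ M ∈ TM ] Σ[ e ∈ ℕ ] Simulates main M e
  compiled = compile main

decider : TM
decider = proj₁ compiled

exponent : ℕ
exponent = proj₁ (proj₂ compiled)

theorem3 : Σ TM λ M → Σ ℕ λ c → Σ ℕ λ k →
    ∀ n (G : Digraph n) (t : BT n) → IsTreeDecomposition G t → Balanced t →
    (u v : Fin n) →
    Σ ℕ λ steps → Σ Bool λ b →
    TM.halted M (state (run M (encode n G t u v) steps)) ≡ just b
    × steps ≤ c * length (encode n G t u v) ^ k + c
    × space (run M (encode n G t u v) steps) ≤ c * (width t * height t + ⌊log₂ n ⌋) + c
    × (b ≡ true → Reach G u v)
    × (Reach G u v → b ≡ true)
theorem3 = decider , 728 ^ exponent + 70 , 9 * exponent , bounds
  where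
  c = 728 ^ exponent + 70
  space-bound : ∀ z → suc (4 * z + 4) * 14 ≤ c * z + c
  space-bound z = ≤-trans (≤-reflexive (arith z)) (≤-trans (+-mono-≤ (*-monoˡ-≤ z (≤ᵇ⇒≤ 56 70 tt)) ≤-refl)
      (+-mono-≤ (*-monoˡ-≤ z (m≤n+m 70 (728 ^ exponent))) (m≤n+m 70 (728 ^ exponent))))
    where
    open +-*-Solver
    -- The factor 14 counts the tracks of the work tape: thirteen stacks and the one that holds the
    -- marker.
    arith : ∀ z → suc (4 * z + 4) * 14 ≡ 56 * z + 70
    arith = solve 1 (λ z → (con 1 :+ (con 4 :* z :+ con 4)) :* con 14 := con 56 :* z :+ con 70) refl
  bounds : ∀ n (G : Digraph n) (t : BT n) → IsTreeDecomposition G t → Balanced t → (u v : Fin n) → _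
  -- An empty tree has no bag that could contain `u`.
  bounds n 𝒢 tip td bal u v with () ← proj₁ (proj₂ (proj₂ (IsTreeDecomposition.vertexCover td u)))
  bounds (suc n′) 𝒢 t@(node b l r) td bal u v = answer decides
    where
    open Bounds 𝒢 b l r u v td bal
    answer : Decides → Σ ℕ λ steps → Σ Bool λ a →
      TM.halted decider (state (run decider (encode (suc n′) 𝒢 t u v) steps)) ≡ just a
      × steps ≤ c * length (encode (suc n′) 𝒢 t u v) ^ (9 * exponent) + c
      × space (run decider (encode (suc n′) 𝒢 t u v) steps) ≤ c * (width t * height t + ⌊log₂ suc n′ ⌋) + c
      × (a ≡ true → Reach 𝒢 u v)
      × (Reach 𝒢 u v → a ≡ true)
    answer (a , snd , cmp , σ , ex) =
      let (k , halts , k≤ , sp) = proj₂ (proj₂ compiled) {B} {H} {B} (2≤scale N 1≤N) ≤-refl (space-scale N 1≤N Z Z≤) ex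
      in k , a , trans halts (cong just (verdict≡ a)) ,
         ≤-trans k≤ (scale-power N 1≤N exponent) ,
         ≤-trans sp (space-bound Z) , snd , cmp
      where
      verdict≡ : ∀ a → verdict (verdictIx a) ≡ a
      verdict≡ true = refl
      verdict≡ false = refl
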